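{- Let $p$ be an odd prime and $r\ge 3$ an integer with $p\nmid r$. Up to isomorphism, the number of irreducible rotary augmented PX maps of length $r$ is $|\mathrm{Irr}(\mathrm{D}_{2r})|$ if $r$ is odd, and $|\mathrm{Irr}(\mathrm{D}_{2r})|-1$ if $r$ is even.
   Context: $\mathrm{D}_{2r}$ is the dihedral group of order $2r$ and $\mathrm{Irr}(\mathrm{D}_{2r})$ is the set of isomorphism classes of irreducible representations of $\mathrm{D}_{2r}$ over $\mathbb{F}_p$. For $s\ge1$, the Praeger–Xu graph $\mathrm{C}(p,r,s)$ has vertex set $\mathbb{Z}_r\times\mathbb{Z}_p^s$, with $(i,x_0,\dots,x_{s-1})$ adjacent to $(i+1,x_1,\dots,x_s)$. The augmented PX graph $\mathrm{C}^*(p,r,s,\delta)$ ($s\ge 0$, $\delta\in\{\pm1\}$) is $\mathrm{C}(p,r,s)$ if $s\ge1$; the $r$-cycle with every adjacent pair joined by $p$ parallel edges if $(s,\delta)=(0,1)$; the cycle $\mathrm{C}_{pr}$ if $(s,\delta)=(0,-1)$; $r$ is its length. An augmented PX map of length $r$ is a map whose underlying graph is an augmented PX graph of length $r$. A map is rotary if the surface is orientable and the group $G$ of orientation-preserving automorphisms acts transitively (hence regularly) on arcs. For a group $G\cong\mathbb{Z}_p^{d}\rtimes_\psi\mathrm{D}_{2r}$ the semidirect product is with respect to a representation $\psi:\mathrm{D}_{2r}\to\mathrm{GL}_d(\mathbb{F}_p)$ acting on $\mathbb{Z}_p^d=\mathbb{F}_p^d$. A rotary augmented PX map is irreducible if its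 orientation-preserving automorphism group is isomorphic to $\mathbb{Z}_p^{d}\rtimes_\psi\mathrm{D}_{2r}$ with $\psi$ irreducible. -}

module Defs where

open import Level using (Level) renaming (suc to lsuc)
open import Data.Nat using (ℕ; zero; suc; _+_; _*_; _∸_; _≤_; NonZero)
open import Data.Nat.Properties using (m*n≢0)
open import Data.Nat.DivMod using (_mod_)
open import Data.Fin using (Fin; toℕ; _≟_)
open import Data.Fin.Permutation using (Permutation′; _⟨$⟩ʳ_; _⟨$⟩ˡ_)
open import Data.Bool using (Bool; true; false; if_then_else_; _xor_; not)
open import Data.Vec using (Vec; []; _∷_; map; zipWith; tabulate; transpose; replicate; init; tail)
open import Data.Product using (Σ; _×_; _,_)
open import Data.Sum using (_⊎_)
open import Relation.Binary.PropositionalEquality using (_≡_; _≢_)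
open import Relation.Nullary using (¬_)
open import Relation.Nullary.Decidable using (⌊_⌋)

addZ : (n : ℕ) .{{_ : NonZero n}} → Fin n → Fin n → Fin n
addZ n a b = (toℕ a + toℕ b) mod n

mulZ : (n : ℕ) .{{_ : NonZero n}} → Fin n → Fin n → Fin n
mulZ n a b = (toℕ a * toℕ b) mod n

negZ : (n : ℕ) .{{_ : NonZero n}} → Fin n → Fin n
negZ n a = (n ∸ toℕ a) mod n

zeroZ : (n : ℕ) .{{_ : NonZero n}} → Fin n
zeroZ n = 0 mod n

oneZ : (n : ℕ) .{{_ : NonZero n}} → Fin n
oneZ n = 1 mod n

-- The dihedral group D_{2r}: the pair (a , b) stands for ρ^a τ^b,
-- with ρ of order r, τ of order 2, τ ρ τ = ρ⁻¹.

Dih : ℕ → Set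
Dih r = Fin r × Bool

dihMul : (r : ℕ) .{{_ : NonZero r}} → Dih r → Dih r → Dih r
dihMul r (a , b) (c , e) = addZ r a (if b then negZ r c else c) , (b xor e)

dihOne : (r : ℕ) .{{_ : NonZero r}} → Dih r
dihOne r = zeroZ r , false

Mat : ℕ → ℕ → ℕ → Set
Mat p m n = Vec (Vec (Fin p) n) m

dot : (p : ℕ) .{{_ : NonZero p}} → ∀ {k} → Vec (Fin p) k → Vec (Fin p) k → Fin p
dot p [] [] = zeroZ p
dot p (x ∷ xs) (y ∷ ys) = addZ p (mulZ p x y) (dot p xs ys)

matVec : (p : ℕ) .{{_ : NonZero p}} → ∀ {m n} → Mat p m n → Vec (Fin p) n → Vec (Fin p) m
matVec p M v = map (λ row → dot p row v) M

matMul : (p : ℕ) .{{_ : NonZero p}} → ∀ {m k n} → Mat p m k → Mat p k n → Mat p m n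
matMul p M N = map (λ row → map (λ col → dot p row col) (transpose N)) M

idMat : (p : ℕ) .{{_ : NonZero p}} → (n : ℕ) → Mat p n n
idMat p n = tabulate (λ i → tabulate (λ j → if ⌊ i ≟ j ⌋ then oneZ p else zeroZ p))

vecAdd : (p : ℕ) .{{_ : NonZero p}} → ∀ {d} → Vec (Fin p) d → Vec (Fin p) d → Vec (Fin p) d
vecAdd p u v = zipWith (addZ p) u v

scal : (p : ℕ) .{{_ : NonZero p}} → ∀ {d} → Fin p → Vec (Fin p) d → Vec (Fin p) d
scal p c v = map (mulZ p c) v

zeroVec : (p : ℕ) .{{_ : NonZero p}} → (d : ℕ) → Vec (Fin p) d
zeroVec p d = replicate d (zeroZ p)

IsRep : (p r : ℕ) .{{_ : NonZero p}} .{{_ : NonZero r}} (d : ℕ) → (Dih r → Mat p d d) → Set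
IsRep p r d ψ =
  (∀ g h → ψ (dihMul r g h) ≡ matMul p (ψ g) (ψ h)) × (ψ (dihOne r) ≡ idMat p d)

IsInvSubspace : (p r : ℕ) .{{_ : NonZero p}} .{{_ : NonZero r}} (d : ℕ) →
  (Dih r → Mat p d d) → (Vec (Fin p) d → Set) → Set
IsInvSubspace p r d ψ W =
  W (zeroVec p d)
  × (∀ u v → W u → W v → W (vecAdd p u v))
  × (∀ c v → W v → W (scal p c v))
  × (∀ g v → W v → W (matVec p (ψ g) v))

IsIrreducible : (p r : ℕ) .{{_ : NonZero p}} .{{_ : NonZero r}} (d : ℕ) →
  (Dih r → Mat p d d) → Set₁
IsIrreducible p r d ψ =
  1 ≤ d × IsRep p r d ψ ×
  ¬ (Σ (Vec (Fin p) d → Set) λ W → IsInvSubspace p r d ψ W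
       × (Σ (Vec (Fin p) d) λ v → W v × v ≢ zeroVec p d)
       × (Σ (Vec (Fin p) d) λ u → ¬ W u))

IrrRep : (p r : ℕ) .{{_ : NonZero p}} .{{_ : NonZero r}} → Set₁
IrrRep p r = Σ ℕ λ d → Σ (Dih r → Mat p d d) λ ψ → IsIrreducible p r d ψ

RepIso : (p r : ℕ) .{{_ : NonZero p}} .{{_ : NonZero r}} → IrrRep p r → IrrRep p r → Set
RepIso p r (d , ψ , _) (d' , ψ' , _) =
  Σ (Mat p d' d) λ A → Σ (Mat p d d') λ B →
    matMul p A B ≡ idMat p d' × matMul p B A ≡ idMat p d
    × (∀ g → matMul p A (ψ g) ≡ matMul p (ψ' g) A)

SD : ℕ → ℕ → ℕ → Set
SD p r d = Vec (Fin p) d × Dih r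

sdMul : (p r : ℕ) .{{_ : NonZero p}} .{{_ : NonZero r}} (d : ℕ) →
  (Dih r → Mat p d d) → SD p r d → SD p r d → SD p r d
sdMul p r d ψ (v , g) (w , h) = vecAdd p v (matVec p (ψ g) w) , dihMul r g h

-- Oriented (combinatorial) maps: darts Fin n, rotation R (around vertices),
-- dart-reversing involution L.  Such a map lives on an orientable surface.

data Reach {n : ℕ} (R L : Permutation′ n) (x : Fin n) : Fin n → Set where
  here  : Reach R L x x
  stepR : ∀ {y} → Reach R L x y → Reach R L x (R ⟨$⟩ʳ y)
  stepL : ∀ {y} → Reach R L x y → Reach R L x (L ⟨$⟩ʳ y)

IsMap : (n : ℕ) → Permutation′ n → Permutation′ n → Set
IsMap n R L =
  (∀ x → L ⟨$⟩ʳ (L ⟨$⟩ʳ x) ≡ x) × (∀ x → L ⟨$⟩ʳ x ≢ x) × (∀ x y → Reach R L x y)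

IsAut : (n : ℕ) → Permutation′ n → Permutation′ n → (Fin n → Fin n) → Set
IsAut n R L f =
  (∀ x → f (R ⟨$⟩ʳ x) ≡ R ⟨$⟩ʳ (f x)) × (∀ x → f (L ⟨$⟩ʳ x) ≡ L ⟨$⟩ʳ (f x))
  × Σ (Fin n → Fin n) λ g → (∀ x → g (f x) ≡ x) × (∀ x → f (g x) ≡ x)

IsRotary : (n : ℕ) → Permutation′ n → Permutation′ n → Set
IsRotary n R L = ∀ x y → Σ (Fin n → Fin n) λ f → IsAut n R L f × f x ≡ y

AutIsoSD : (p r : ℕ) .{{_ : NonZero p}} .{{_ : NonZero r}} (n : ℕ) →
  Permutation′ n → Permutation′ n → (d : ℕ) → (Dih r → Mat p d d) → Set
AutIsoSD p r n R L d ψ =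
  Σ (SD p r d → Fin n → Fin n) λ Φ →
    (∀ a → IsAut n R L (Φ a))
    × (∀ a b x → Φ (sdMul p r d ψ a b) x ≡ Φ a (Φ b x))
    × (∀ a b → (∀ x → Φ a x ≡ Φ b x) → a ≡ b)
    × (∀ f → IsAut n R L f → Σ (SD p r d) λ a → ∀ x → Φ a x ≡ f x)

-- Graphs given by their arcs (allows parallel edges)

record DGraph : Set₁ where
  field
    Vert : Set
    Arc  : Set
    rev  : Arc → Arc
    src  : Arc → Vert

open DGraph public

-- Praeger–Xu graph C(p,r,s) (s ≥ 0): the edge indexed by (i , x₀…x_s) joins
-- (i , x₀…x_{s-1}) and (i+1 , x₁…x_s); for s = 0 this is the r-cycle with
-- each edge of multiplicity p.
PXGraph : (p r : ℕ) .{{_ : NonZero r}} → ℕ → DGraph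
PXGraph p r s = record
  { Vert = Fin r × Vec (Fin p) s
  ; Arc  = Fin r × Vec (Fin p) (suc s) × Bool
  ; rev  = λ { (i , x , b) → i , x , not b }
  ; src  = λ { (i , x , true) → i , init x ; (i , x , false) → addZ r i (oneZ r) , tail x }
  }

CycleGraph : (m : ℕ) .{{_ : NonZero m}} → DGraph
CycleGraph m = record
  { Vert = Fin m
  ; Arc  = Fin m × Bool
  ; rev  = λ { (i , b) → i , not b }
  ; src  = λ { (i , true) → i ; (i , false) → addZ m i (oneZ m) }
  }

-- augmented PX graph C*(p,r,s,δ); δ = true means δ = 1, false means δ = -1
AugPX : (p r : ℕ) .{{_ : NonZero p}} .{{_ : NonZero r}} → ℕ → Bool → DGraph
AugPX p r zero true = PXGraph p r zero
AugPX p r zero false = CycleGraph (p * r) {{m*n≢0 p r}}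
AugPX p r (suc s) _ = PXGraph p r (suc s)

Rpow : ∀ {n} → Permutation′ n → ℕ → Fin n → Fin n
Rpow R zero x = x
Rpow R (suc k) x = R ⟨$⟩ʳ (Rpow R k x)

SameVertex : ∀ {n} → Permutation′ n → Fin n → Fin n → Set
SameVertex R x y = Σ ℕ λ k → Rpow R k x ≡ y

-- the underlying graph of the map (vertices = R-orbits, edges = L-orbits)
-- is isomorphic to Γ
UnderlyingIso : (n : ℕ) → Permutation′ n → Permutation′ n → DGraph → Set
UnderlyingIso n R L Γ =
  Σ (Fin n → Arc Γ) λ φ →
    (Σ (Arc Γ → Fin n) λ φ⁻ → (∀ x → φ⁻ (φ x) ≡ x) × (∀ a → φ (φ⁻ a) ≡ a))
    × (∀ x → φ (L ⟨$⟩ʳ x) ≡ rev Γ (φ x))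
    × (∀ x y → src Γ (φ x) ≡ src Γ (φ y) → SameVertex R x y)
    × (∀ x y → SameVertex R x y → src Γ (φ x) ≡ src Γ (φ y))
    × (∀ v → Σ (Fin n) λ x → src Γ (φ x) ≡ v)

IrrRotAugPXMap : (p r : ℕ) .{{_ : NonZero p}} .{{_ : NonZero r}} → Set₁
IrrRotAugPXMap p r =
  Σ ℕ λ n → Σ (Permutation′ n) λ R → Σ (Permutation′ n) λ L →
    IsMap n R L × IsRotary n R L
    × (Σ ℕ λ s → Σ Bool λ δ → UnderlyingIso n R L (AugPX p r s δ))
    × (Σ ℕ λ d → Σ (Dih r → Mat p d d) λ ψ → IsIrreducible p r d ψ × AutIsoSD p r n R L d ψ)

-- map isomorphism (possibly orientation-reversing)
MapIso : (p r : ℕ) .{{_ : NonZero p}} .{{_ : NonZero r}} → IrrRotAugPXMap p r → IrrRotAugPXMap p r → Set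
MapIso p r (n , R , L , _) (n' , R' , L' , _) =
  Σ (Fin n → Fin n') λ f → Σ (Fin n' → Fin n) λ g →
    (∀ x → g (f x) ≡ x) × (∀ y → f (g y) ≡ y)
    × (∀ x → f (L ⟨$⟩ʳ x) ≡ L' ⟨$⟩ʳ (f x))
    × ((∀ x → f (R ⟨$⟩ʳ x) ≡ R' ⟨$⟩ʳ (f x)) ⊎ (∀ x → f (R ⟨$⟩ʳ x) ≡ R' ⟨$⟩ˡ (f x)))

HasCount : ∀ {a b} (A : Set a) → (A → A → Set b) → ℕ → Set (a Level.⊔ b)
HasCount A _≅_ N =
  Σ (Fin N → A) λ f → (∀ i j → f i ≅ f j → i ≡ j) × (∀ x → Σ (Fin N) λ i → x ≅ f i)

isEven : ℕ → Bool
isEven zero = true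
isEven (suc n) = not (isEven n)

{-# OPTIONS --safe #-}
module Submission where

-- Write τ for a reflection, ρ for the generating rotation and β = τρ, so that D = ⟨τ, β⟩.  A rotary map with group
-- G = V ⋊ D is a Cayley map: its darts are the elements of G, and the rotation and the edge reversal are right
-- multiplication by some α and z which generate G.  The valency is 2p or 2, and p does not divide 2r, so α and z map to
-- reflections generating D; twisting ψ by an automorphism of D we may take these to be τ and β.
-- Conjugation by V then brings the pair to z = (0, β) and α = (v, τ), where v ≠ 0 and either τ v = v, or τ and β both act
-- as -1.  All such v are equivalent under the centraliser of D in GL(V), so the map is determined by ψ, and conversely ψ is
-- recovered from the map because V is the set of elements of p-power order.  Such a v exists for every irreducible ψ except
-- the character τ ↦ -1, β ↦ 1, which is a character of D exactly when r is even.
--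
-- The underlying graph of the map is always an augmented Praeger–Xu graph.  If τ v = v, the vectors v, ρ⁻¹v, …, ρ⁻ˢv
-- (s = d - 1) form a basis of V.  Let ℓ be the functional that kills all of them but the last.  Then
-- (ℓ(ρ⁻ʲx), ℓ(ρ⁻ʲ⁻¹x), …, ℓ(ρ⁻ʲ⁻ˢx)) are the Praeger–Xu coordinates of the darts over x in the j-th layer; dropping the last
-- one quotients by ρʲv, i.e. passes to vertices.  If τ and β act as -1, then αz generates a cyclic group of order pr.

open import Defs
open import Level using (0ℓ)
open import Algebra.Bundles using (AbelianGroup; CommutativeRing; Group)
open import Algebra.Structures using (IsAbelianGroup; IsGroup)
import Algebra.Properties.AbelianGroup
import Algebra.Properties.CommutativeSemigroup
import Algebra.Properties.Group
import Algebra.Properties.Monoid.Mult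
import Algebra.Properties.Ring
open import Data.Bool as Bool using (Bool; true; false; if_then_else_; not; _xor_)
open import Data.Bool.Properties using (not-involutive; ¬-not; not-distribˡ-xor; not-distribʳ-xor; xor-assoc; xor-identityʳ; xor-same)
open import Data.Empty using (⊥)
open import Data.Fin as F using (Fin; zero; suc; toℕ; punchIn; punchOut)
open import Data.Fin.Permutation using (Permutation′; permutation; _⟨$⟩ʳ_; _⟨$⟩ˡ_) renaming (inverseˡ to permutation-inverseˡ)
open import Data.Fin.Properties as F using (2↔Bool; any?; injective⇒≤; pigeonhole; punchIn-injective; punchIn-punchOut; punchInᵢ≢i; punchOut-injective; toℕ-fromℕ<; toℕ-injective; toℕ<n)
open import Data.List as List using (List; _++_)
open import Data.List.Relation.Unary.Any as Any using (Any; here; there)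
open import Data.List.Relation.Unary.Any.Properties using (++⁺ˡ; ++⁺ʳ; lookup-index)
open import Data.Maybe using (Maybe; just; nothing)
open import Data.Maybe.Properties using (just-injective)
open import Data.Nat as ℕ using (ℕ; zero; suc; _≤_; _<_; _∸_; _^_; NonZero; s≤s; z≤n)
import Data.Nat.Properties as ℕ
open import Data.Nat.Coprimality using (Coprime; coprime-divisor)
open import Data.Nat.DivMod using (_mod_; _%_; _/_; m%n<n; m<n⇒m%n≡m; m≡m%n+[m/n]*n; n%n≡0; [m+kn]%n≡m%n; %-distribˡ-+; %-distribˡ-*)
open import Data.Nat.Divisibility using (_∣_; divides; m%n≡0⇒n∣m; n∣m⇒m%n≡0; ∣⇒≤; *-monoˡ-∣)
open import Data.Nat.Primality using (Prime; euclidsLemma; prime⇒irreducible; prime⇒nonTrivial)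
open import Data.Product using (Σ; ∃; _×_; _,_; proj₁; proj₂; uncurry)
open import Data.Product.Function.NonDependent.Propositional using (_×-↔_)
open import Data.Product.Properties using (,-injective)
open import Data.Sum using (_⊎_; inj₁; inj₂)
open import Data.Vec using (Vec; []; _∷_; _⊛_; _∷ʳ_; head; init; initLast; last; lookup; map; replicate; tabulate; transpose; zipWith)
open import Data.Vec.Properties using (≡-dec; ∷-injectiveˡ; ∷-injectiveʳ; ∷ʳ-injectiveʳ; init-∷ʳ; lookup∘tabulate; map-replicate; tabulate-cong; tabulate-∘; zipWith-assoc; zipWith-comm; zipWith-identityˡ; zipWith-identityʳ; zipWith-inverseˡ; zipWith-inverseʳ)
open import Function using (_∘_; id; _↔_; mk↔ₛ′; Inverse)
open import Function.Properties.Inverse using (↔-refl; ↔-sym; ↔-trans)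
open import Relation.Binary.PropositionalEquality hiding ([_]; setoid)
open import Relation.Nullary using (¬_; Dec; yes; no; contradiction)
open import Relation.Nullary.Decidable using (⌊_⌋; map′; ¬?; decidable-stable; _×-dec_; _→-dec_)

-- Finite types and arithmetic modulo n

-- The number of irreducible representations is never computed: a finite search yields some N
-- together with representatives, and the maps are counted against these same representatives. To
-- make the search possible, irreducibility, which quantifies over arbitrary predicates on the
-- space, is replaced by an equivalent decidable condition: the orbit of every nonzero vector spans.
-- The same condition is the induction principle behind Schur's lemma, the eigenvector arguments and
-- the basis. One group V ⋊ D may carry several non-isomorphic maps, since generating pairs can be
-- twisted by automorphisms of D. A map is therefore filed not under the ψ it comes with, but under
-- ψ composed with the automorphism that sends τ and β to its two reflections. The exceptional
-- character drops out because of the coboundaries u - τu and u - βu, by which conjugation alters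
-- the vector parts. For it z² = 1 makes the vector part of z vanish and, 2 being invertible, that
-- of α can be conjugated away without changing z. The pair then lies in a complement of V and
-- cannot generate.

opaque
  vecOf↔ : ∀ {A : Set} {k} → A ↔ Fin k → ∀ d → Vec A d ↔ Fin (k ^ d)
  vecOf↔ e zero = mk↔ₛ′ (λ _ → zero) (λ _ → []) (λ { zero → refl }) (λ { [] → refl })
  vecOf↔ {A} {k} e (suc d) = ↔-trans cons↔ (↔-trans (e ×-↔ vecOf↔ e d) (↔-sym (F.*↔× {k} {k ^ d})))
    where
    cons↔ : Vec A (suc d) ↔ (A × Vec A d)
    cons↔ = mk↔ₛ′ (λ { (x ∷ xs) → x , xs }) (uncurry _∷_) (λ _ → refl) (λ { (x ∷ xs) → refl })

  vec↔ : ∀ p d → Vec (Fin p) d ↔ Fin (p ^ d)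
  vec↔ p d = vecOf↔ ↔-refl d

  dih↔ : ∀ r → Dih r ↔ Fin (r ℕ.* 2)
  dih↔ r = ↔-trans (↔-refl ×-↔ ↔-sym F.2↔Bool) (↔-sym (F.*↔× {r} {2}))

  sd↔ : ∀ p r d → SD p r d ↔ Fin (p ^ d ℕ.* (r ℕ.* 2))
  sd↔ p r d = ↔-trans (vec↔ p d ×-↔ dih↔ r) (↔-sym (F.*↔× {p ^ d} {r ℕ.* 2}))

to-from : ∀ {A B : Set} (e : A ↔ B) → ∀ y → Inverse.to e (Inverse.from e y) ≡ y
to-from e y = Inverse.inverseˡ e refl

from-to : ∀ {A B : Set} (e : A ↔ B) → ∀ x → Inverse.from e (Inverse.to e x) ≡ x
from-to e x = Inverse.inverseʳ e refl

to-injective : ∀ {A B : Set} (e : A ↔ B) → ∀ {x y} → Inverse.to e x ≡ Inverse.to e y → x ≡ y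
to-injective e {x} {y} eq = trans (sym (from-to e x)) (trans (cong (Inverse.from e) eq) (from-to e y))

search : ∀ {A : Set} {n} → A ↔ Fin n → {P : A → Set} → (∀ x → Dec (P x)) → Dec (Σ A P)
search e {P} P? = map′
  (λ { (i , q) → Inverse.from e i , q })
  (λ { (x , q) → Inverse.to e x , subst P (sym (from-to e x)) q })
  (any? (λ i → P? (Inverse.from e i)))

searchAll : ∀ {A : Set} {n} → A ↔ Fin n → {P : A → Set} → (∀ x → Dec (P x)) → Dec (∀ x → P x)
searchAll e P? = map′
  (λ ¬ex x → decidable-stable (P? x) (λ ¬Px → ¬ex (x , ¬Px)))
  (λ all (x , ¬Px) → ¬Px (all x))
  (¬? (search e (λ x → ¬? (P? x))))

Fin-injective⇒surjective : ∀ {n} (f : Fin n → Fin n) → (∀ x y → f x ≡ f y → x ≡ y) → ∀ y → ∃ λ x → f x ≡ y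
Fin-injective⇒surjective {suc n} f inj y with any? (λ x → f x F.≟ y)
... | yes q = q
... | no ¬q = contradiction
  (injective⇒≤ {f = λ x → punchOut {i = y} {j = f x} (λ eq → ¬q (x , sym eq))}
    (λ {i} {j} eq → inj i j (punchOut-injective {i = y} (λ q → ¬q (i , sym q)) (λ q → ¬q (j , sym q)) eq)))
  ℕ.1+n≰n

injective⇒surjective : ∀ {A : Set} {n} → A ↔ Fin n → (f : A → A) → (∀ x y → f x ≡ f y → x ≡ y) → ∀ y → ∃ λ x → f x ≡ y
injective⇒surjective e f inj y =
  let i , eq = Fin-injective⇒surjective (Inverse.to e ∘ f ∘ Inverse.from e)
        (λ i j eq → trans (sym (to-from e i)) (trans (cong (Inverse.to e) (inj _ _ (to-injective e eq))) (to-from e j)))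
        (Inverse.to e y)
  in Inverse.from e i , to-injective e eq

-- A section of `f` is injective, hence by finiteness surjective, and so it is a two-sided inverse.
surjective⇒injective : ∀ {A : Set} {n} → A ↔ Fin n → (f : A → A) → (∀ y → ∃ λ x → f x ≡ y) → ∀ x y → f x ≡ f y → x ≡ y
surjective⇒injective {A} e f surj x y eq =
  let g-surj = injective⇒surjective e g (λ u v q → trans (sym (fg u)) (trans (cong f q) (fg v)))
      u , gu = g-surj x
      v , gv = g-surj y
  in trans (sym gu) (trans (cong g (trans (sym (fg u)) (trans (cong f gu) (trans eq (trans (cong f (sym gv)) (fg v)))))) gv)
  where
  g : A → A
  g = proj₁ ∘ surj
  fg : ∀ u → f (g u) ≡ u
  fg = proj₂ ∘ surj

card-≤ : ∀ {A B : Set} {m n} → A ↔ Fin m → B ↔ Fin n → (f : A → B) → (∀ x y → f x ≡ f y → x ≡ y) → m ≤ n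
card-≤ e e′ f inj = injective⇒≤ {f = Inverse.to e′ ∘ f ∘ Inverse.from e}
  (λ {i} {j} eq → trans (sym (to-from e i)) (trans (cong (Inverse.to e) (inj _ _ (to-injective e′ eq))) (to-from e j)))

-- Dimensions are compared by counting points, p^m against p^n. Any injection will do, for instance
-- a mere choice of coefficients.
vec-dim-≤ : ∀ {m n p} → 1 < p → (f : Vec (Fin p) m → Vec (Fin p) n) → (∀ x y → f x ≡ f y → x ≡ y) → m ≤ n
vec-dim-≤ {m} {n} {p@(suc _)} 1<p f inj with m ℕ.≤? n
... | yes m≤n = m≤n
... | no m≰n = contradiction (card-≤ (vec↔ p m) (vec↔ p n) f inj) (ℕ.<⇒≱ (ℕ.^-monoʳ-< p 1<p (ℕ.≰⇒> m≰n)))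

module _ {a b} {A : Set a} (_≅_ : A → A → Set b) (≅-refl : ∀ {x} → x ≅ x) (≅-sym : ∀ {x y} → x ≅ y → y ≅ x)
         (_≅?_ : ∀ x y → Dec (x ≅ y)) where

  -- Greedy selection: an element is kept only if it is related to nothing kept so far, and a
  -- discarded one remembers the kept element that excluded it.
  representatives : ∀ k (h : Fin k → A) →
    Σ ℕ λ N → Σ (Fin N → A) λ f → (∀ i j → f i ≅ f j → i ≡ j) × (∀ i → Σ (Fin N) λ j → h i ≅ f j)
  representatives zero h = 0 , (λ ()) , (λ ()) , λ ()
  representatives (suc k) h with representatives k (h ∘ suc)
  ... | N , f , inj , sur with any? (λ j → h zero ≅? f j)
  ...   | yes q = N , f , inj , λ { zero → q ; (suc i) → sur i }
  ...   | no ¬q = suc N , f′ , inj′ , sur′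
    where
    f′ : Fin (suc N) → A
    f′ zero = h zero
    f′ (suc j) = f j
    inj′ : ∀ i j → f′ i ≅ f′ j → i ≡ j
    inj′ zero zero _ = refl
    inj′ zero (suc j) q = contradiction (j , q) ¬q
    inj′ (suc i) zero q = contradiction (i , ≅-sym q) ¬q
    inj′ (suc i) (suc j) q = cong suc (inj i j q)
    sur′ : ∀ i → Σ (Fin (suc N)) λ j → h i ≅ f′ j
    sur′ zero = zero , ≅-refl
    sur′ (suc i) = let j , q = sur i in suc j , q

module _ (n : ℕ) .{{_ : NonZero n}} where

  toℕ-mod : ∀ k → toℕ (k mod n) ≡ k % n
  toℕ-mod k = toℕ-fromℕ< (m%n<n k n)

  mod-cong : ∀ {j k} → j % n ≡ k % n → j mod n ≡ k mod n
  mod-cong {j} {k} eq = toℕ-injective (trans (toℕ-mod j) (trans eq (sym (toℕ-mod k))))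

  mod-toℕ : ∀ x → toℕ x mod n ≡ x
  mod-toℕ x = toℕ-injective (trans (toℕ-mod (toℕ x)) (m<n⇒m%n≡m (toℕ<n x)))

  mod-+ : ∀ j k → (j ℕ.+ k) mod n ≡ addZ n (j mod n) (k mod n)
  mod-+ j k = mod-cong (trans (%-distribˡ-+ j k n)
    (cong₂ (λ x y → (x ℕ.+ y) % n) (sym (toℕ-mod j)) (sym (toℕ-mod k))))

  mod-* : ∀ j k → (j ℕ.* k) mod n ≡ mulZ n (j mod n) (k mod n)
  mod-* j k = mod-cong (trans (%-distribˡ-* j k n)
    (cong₂ (λ x y → (x ℕ.* y) % n) (sym (toℕ-mod j)) (sym (toℕ-mod k))))

  n-mod : n mod n ≡ zeroZ n
  n-mod = mod-cong (trans (n%n≡0 n) (sym (m<n⇒m%n≡m (ℕ.>-nonZero⁻¹ n))))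

  private
    -- Every law descends from ℕ along the surjective semiring morphism k ↦ k mod n.
    lift₁ : {f g : Fin n → Fin n} → (∀ k → f (k mod n) ≡ g (k mod n)) → ∀ x → f x ≡ g x
    lift₁ {f} {g} eq x = subst (λ y → f y ≡ g y) (mod-toℕ x) (eq (toℕ x))

    lift₂ : {f g : Fin n → Fin n → Fin n} → (∀ j k → f (j mod n) (k mod n) ≡ g (j mod n) (k mod n)) → ∀ x y → f x y ≡ g x y
    lift₂ eq x = lift₁ (λ k → lift₁ (λ j → eq j k) x)

    lift₃ : {f g : Fin n → Fin n → Fin n → Fin n} →
      (∀ i j k → f (i mod n) (j mod n) (k mod n) ≡ g (i mod n) (j mod n) (k mod n)) → ∀ x y z → f x y z ≡ g x y z
    lift₃ eq x y = lift₁ (λ k → lift₂ (λ i j → eq i j k) x y)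

  addZ-comm : ∀ x y → addZ n x y ≡ addZ n y x
  addZ-comm x y = cong (_mod n) (ℕ.+-comm (toℕ x) (toℕ y))

  mulZ-comm : ∀ x y → mulZ n x y ≡ mulZ n y x
  mulZ-comm x y = cong (_mod n) (ℕ.*-comm (toℕ x) (toℕ y))

  addZ-assoc : ∀ x y z → addZ n (addZ n x y) z ≡ addZ n x (addZ n y z)
  addZ-assoc = lift₃ λ i j k → trans (cong (λ w → addZ n w (k mod n)) (sym (mod-+ i j)))
    (trans (sym (mod-+ (i ℕ.+ j) k)) (trans (cong (_mod n) (ℕ.+-assoc i j k))
    (trans (mod-+ i (j ℕ.+ k)) (cong (addZ n (i mod n)) (mod-+ j k)))))

  mulZ-assoc : ∀ x y z → mulZ n (mulZ n x y) z ≡ mulZ n x (mulZ n y z)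
  mulZ-assoc = lift₃ λ i j k → trans (cong (λ w → mulZ n w (k mod n)) (sym (mod-* i j)))
    (trans (sym (mod-* (i ℕ.* j) k)) (trans (cong (_mod n) (ℕ.*-assoc i j k))
    (trans (mod-* i (j ℕ.* k)) (cong (mulZ n (i mod n)) (mod-* j k)))))

  addZ-identityˡ : ∀ x → addZ n (zeroZ n) x ≡ x
  addZ-identityˡ = lift₁ λ k → sym (mod-+ 0 k)

  mulZ-identityˡ : ∀ x → mulZ n (oneZ n) x ≡ x
  mulZ-identityˡ = lift₁ λ k → trans (sym (mod-* 1 k)) (cong (_mod n) (ℕ.*-identityˡ k))

  mulZ-distribˡ : ∀ x y z → mulZ n x (addZ n y z) ≡ addZ n (mulZ n x y) (mulZ n x z)
  mulZ-distribˡ = lift₃ λ i j k → trans (cong (mulZ n (i mod n)) (sym (mod-+ j k)))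
    (trans (sym (mod-* i (j ℕ.+ k))) (trans (cong (_mod n) (ℕ.*-distribˡ-+ i j k))
    (trans (mod-+ (i ℕ.* j) (i ℕ.* k)) (cong₂ (addZ n) (mod-* i j) (mod-* i k)))))

  addZ-inverseʳ : ∀ x → addZ n x (negZ n x) ≡ zeroZ n
  addZ-inverseʳ x = trans (cong (λ y → addZ n y (negZ n x)) (sym (mod-toℕ x)))
    (trans (sym (mod-+ (toℕ x) (n ℕ.∸ toℕ x))) (trans (cong (_mod n) (ℕ.m+[n∸m]≡n (ℕ.<⇒≤ (toℕ<n x)))) n-mod))

  0%n≡0 : 0 % n ≡ 0
  0%n≡0 = m<n⇒m%n≡m (ℕ.>-nonZero⁻¹ n)

  mod≡0⇒∣ : ∀ k → k mod n ≡ zeroZ n → n ∣ k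
  mod≡0⇒∣ k eq = m%n≡0⇒n∣m k n (trans (sym (toℕ-mod k)) (trans (cong toℕ eq) (trans (toℕ-mod 0) 0%n≡0)))

  ∣⇒mod≡0 : ∀ k → n ∣ k → k mod n ≡ zeroZ n
  ∣⇒mod≡0 k n∣k = mod-cong (trans (n∣m⇒m%n≡0 k n n∣k) (sym 0%n≡0))

  addZ-cancel : ∀ i j k → addZ n j k ≡ zeroZ n → addZ n (addZ n i j) k ≡ i
  addZ-cancel i j k eq = trans (addZ-assoc i j k) (trans (cong (addZ n i) eq) (trans (addZ-comm i (zeroZ n)) (addZ-identityˡ i)))

  addZ-inverseˡ : ∀ x → addZ n (negZ n x) x ≡ zeroZ n
  addZ-inverseˡ x = trans (addZ-comm (negZ n x) x) (addZ-inverseʳ x)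

  Zring : CommutativeRing 0ℓ 0ℓ
  Zring = record
    { isCommutativeRing = record
      { isRing = record
        { +-isAbelianGroup = record
          { isGroup = record
            { isMonoid = record
              { isSemigroup = record
                { isMagma = record { isEquivalence = isEquivalence ; ∙-cong = cong₂ (addZ n) }
                ; assoc = addZ-assoc }
              ; identity = addZ-identityˡ , λ x → trans (addZ-comm x (zeroZ n)) (addZ-identityˡ x) }
            ; inverse = addZ-inverseˡ , addZ-inverseʳ
            ; ⁻¹-cong = cong (negZ n) }
          ; comm = addZ-comm }
        ; *-cong = cong₂ (mulZ n)
        ; *-assoc = mulZ-assoc
        ; *-identity = mulZ-identityˡ , λ x → trans (mulZ-comm x (oneZ n)) (mulZ-identityˡ x)
        ; distrib = mulZ-distribˡ , λ x y z → trans (mulZ-comm (addZ n y z) x) (trans (mulZ-distribˡ x y z) (cong₂ (addZ n) (mulZ-comm x y) (mulZ-comm x z))) }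
      ; *-comm = mulZ-comm } }

  mod≡⇒∣∸ : ∀ {j k} → j ≤ k → j mod n ≡ k mod n → n ∣ k ℕ.∸ j
  mod≡⇒∣∸ {j} {k} j≤k eq = mod≡0⇒∣ (k ℕ.∸ j) (identityʳ-unique (j mod n) ((k ℕ.∸ j) mod n)
    (trans (sym (mod-+ j (k ℕ.∸ j))) (trans (cong (_mod n) (ℕ.m+[n∸m]≡n j≤k)) (sym eq))))
    where open Algebra.Properties.Group (CommutativeRing.+-group Zring) using (identityʳ-unique)

-- Linear algebra over the field with p elements

module AbelianGroupSolver (G : AbelianGroup 0ℓ 0ℓ) where
  open AbelianGroup G renaming (refl to ≈-refl; sym to ≈-sym; trans to ≈-trans)
  open Algebra.Properties.Monoid.Mult monoid using (×-homo-+; ×-homo-1) renaming (_×_ to _·_)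
  open Algebra.Properties.CommutativeSemigroup commutativeSemigroup using (interchange)
  open import Relation.Binary.Reasoning.Setoid setoid

  infixl 6 _:+_ _:-_
  infix 7 :⊖_
  data Expr (n : ℕ) : Set where
    var : Fin n → Expr n
    :0 : Expr n
    _:+_ : Expr n → Expr n → Expr n
    :⊖_ : Expr n → Expr n

  _:-_ : ∀ {n} → Expr n → Expr n → Expr n
  e :- f = e :+ (:⊖ f)

  x₀ : ∀ {n} → Expr (1 ℕ.+ n)
  x₀ = var zero
  x₁ : ∀ {n} → Expr (2 ℕ.+ n)
  x₁ = var (suc zero)
  x₂ : ∀ {n} → Expr (3 ℕ.+ n)
  x₂ = var (suc (suc zero))
  x₃ : ∀ {n} → Expr (4 ℕ.+ n)
  x₃ = var (suc (suc (suc zero)))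
  x₄ : ∀ {n} → Expr (5 ℕ.+ n)
  x₄ = var (suc (suc (suc (suc zero))))

  ⟦_⟧ : ∀ {n} → Expr n → Vec Carrier n → Carrier
  ⟦ var i ⟧ ρ = lookup ρ i
  ⟦ :0 ⟧ ρ = ε
  ⟦ e :+ f ⟧ ρ = ⟦ e ⟧ ρ ∙ ⟦ f ⟧ ρ
  ⟦ :⊖ e ⟧ ρ = ⟦ e ⟧ ρ ⁻¹

  unit : ∀ {n} → Fin n → Vec ℕ n
  unit zero = 1 ∷ replicate _ 0
  unit (suc i) = 0 ∷ unit i

  -- The two vectors hold the coefficients of the positive and of the negative occurrences.
  pos neg : ∀ {n} → Expr n → Vec ℕ n
  pos (var i) = unit i
  pos :0 = replicate _ 0
  pos (e :+ f) = zipWith ℕ._+_ (pos e) (pos f)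
  pos (:⊖ e) = neg e
  neg (var i) = replicate _ 0
  neg :0 = replicate _ 0
  neg (e :+ f) = zipWith ℕ._+_ (neg e) (neg f)
  neg (:⊖ e) = pos e

  lin : ∀ {n} → Vec ℕ n → Vec Carrier n → Carrier
  lin [] [] = ε
  lin (k ∷ ks) (x ∷ xs) = (k · x) ∙ lin ks xs

  lin-0 : ∀ {n} (ρ : Vec Carrier n) → lin (replicate n 0) ρ ≈ ε
  lin-0 [] = ≈-refl
  lin-0 (x ∷ ρ) = ≈-trans (identityˡ _) (lin-0 ρ)

  lin-unit : ∀ {n} (i : Fin n) ρ → lin (unit i) ρ ≈ lookup ρ i
  lin-unit zero (x ∷ ρ) = ≈-trans (∙-cong (×-homo-1 x) (lin-0 ρ)) (identityʳ x)
  lin-unit (suc i) (x ∷ ρ) = ≈-trans (identityˡ _) (lin-unit i ρ)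

  lin-+ : ∀ {n} (js ks : Vec ℕ n) ρ → lin (zipWith ℕ._+_ js ks) ρ ≈ lin js ρ ∙ lin ks ρ
  lin-+ [] [] [] = ≈-sym (identityˡ ε)
  lin-+ (j ∷ js) (k ∷ ks) (x ∷ ρ) = ≈-trans (∙-cong (×-homo-+ x j k) (lin-+ js ks ρ)) (interchange _ _ _ _)

  -- The negative occurrences stand on the left, so that inverses never have to be distributed over
  -- a linear combination.
  ⟦⟧-correct : ∀ {n} (e : Expr n) ρ → ⟦ e ⟧ ρ ∙ lin (neg e) ρ ≈ lin (pos e) ρ
  ⟦⟧-correct (var i) ρ = ≈-trans (∙-congˡ (lin-0 ρ)) (≈-trans (identityʳ _) (≈-sym (lin-unit i ρ)))
  ⟦⟧-correct :0 ρ = identityˡ _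
  ⟦⟧-correct (e :+ f) ρ = begin
    (⟦ e ⟧ ρ ∙ ⟦ f ⟧ ρ) ∙ lin (neg (e :+ f)) ρ  ≈⟨ ∙-congˡ (lin-+ (neg e) (neg f) ρ) ⟩
    (⟦ e ⟧ ρ ∙ ⟦ f ⟧ ρ) ∙ (lin (neg e) ρ ∙ lin (neg f) ρ)  ≈⟨ interchange _ _ _ _ ⟩
    (⟦ e ⟧ ρ ∙ lin (neg e) ρ) ∙ (⟦ f ⟧ ρ ∙ lin (neg f) ρ)  ≈⟨ ∙-cong (⟦⟧-correct e ρ) (⟦⟧-correct f ρ) ⟩
    lin (pos e) ρ ∙ lin (pos f) ρ  ≈⟨ lin-+ (pos e) (pos f) ρ ⟨
    lin (pos (e :+ f)) ρ  ∎
  ⟦⟧-correct (:⊖ e) ρ = begin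
    ⟦ e ⟧ ρ ⁻¹ ∙ lin (pos e) ρ  ≈⟨ ∙-congˡ (⟦⟧-correct e ρ) ⟨
    ⟦ e ⟧ ρ ⁻¹ ∙ (⟦ e ⟧ ρ ∙ lin (neg e) ρ)  ≈⟨ assoc _ _ _ ⟨
    (⟦ e ⟧ ρ ⁻¹ ∙ ⟦ e ⟧ ρ) ∙ lin (neg e) ρ  ≈⟨ ∙-congʳ (inverseˡ _) ⟩
    ε ∙ lin (neg e) ρ  ≈⟨ identityˡ _ ⟩
    lin (neg e) ρ  ∎

  -- Cross-adding the coefficient vectors compares the formal differences `pos` - `neg` of both
  -- sides within ℕ. For concrete expressions the two sums compute to the same numerals, so each
  -- call closes the premise with `refl`.
  solve : ∀ {n} (ρ : Vec Carrier n) (e f : Expr n) →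
    zipWith ℕ._+_ (pos e) (neg f) ≡ zipWith ℕ._+_ (pos f) (neg e) → ⟦ e ⟧ ρ ≈ ⟦ f ⟧ ρ
  solve ρ e f eq = ∙-cancelʳ _ _ _ (begin
    ⟦ e ⟧ ρ ∙ (lin (neg e) ρ ∙ lin (neg f) ρ)  ≈⟨ assoc _ _ _ ⟨
    (⟦ e ⟧ ρ ∙ lin (neg e) ρ) ∙ lin (neg f) ρ  ≈⟨ ∙-congʳ (⟦⟧-correct e ρ) ⟩
    lin (pos e) ρ ∙ lin (neg f) ρ  ≈⟨ lin-+ (pos e) (neg f) ρ ⟨
    lin (zipWith ℕ._+_ (pos e) (neg f)) ρ  ≡⟨ cong (λ ks → lin ks ρ) eq ⟩
    lin (zipWith ℕ._+_ (pos f) (neg e)) ρ  ≈⟨ lin-+ (pos f) (neg e) ρ ⟩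
    lin (pos f) ρ ∙ lin (neg e) ρ  ≈⟨ ∙-congʳ (⟦⟧-correct f ρ) ⟨
    (⟦ f ⟧ ρ ∙ lin (neg f) ρ) ∙ lin (neg e) ρ  ≈⟨ assoc _ _ _ ⟩
    ⟦ f ⟧ ρ ∙ (lin (neg f) ρ ∙ lin (neg e) ρ)  ≈⟨ ∙-congˡ (comm _ _) ⟩
    ⟦ f ⟧ ρ ∙ (lin (neg e) ρ ∙ lin (neg f) ρ)  ∎)
    where open Algebra.Properties.AbelianGroup G using (∙-cancelʳ)

module LinearAlgebra (p : ℕ) .{{_ : NonZero p}} where

  module Z = CommutativeRing (Zring p)
  module ZP = Algebra.Properties.Ring Z.ring
  open Algebra.Properties.CommutativeSemigroup Z.+-commutativeSemigroup using (interchange)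
  open ≡-Reasoning
  module ZA = Algebra.Properties.AbelianGroup Z.+-abelianGroup

  V : ℕ → Set
  V = Vec (Fin p)

  infixl 6 _⊕_ _⊝_
  infix 8 ⊖_
  infixr 7 _∙_

  opaque
    _⊕_ : ∀ {d} → V d → V d → V d
    _⊕_ = vecAdd p

    ⊖_ : ∀ {d} → V d → V d
    ⊖_ = map (negZ p)

    𝟘 : ∀ {d} → V d
    𝟘 {d} = zeroVec p d

    _∙_ : ∀ {d} → Fin p → V d → V d
    _∙_ = scal p

  _⊝_ : ∀ {d} → V d → V d → V d
  x ⊝ y = x ⊕ ⊖ y

  opaque
    unfolding _⊕_

    ⊕-isAbelianGroup : ∀ {d} → IsAbelianGroup _≡_ (_⊕_ {d}) 𝟘 ⊖_
    ⊕-isAbelianGroup = record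
      { isGroup = record
        { isMonoid = record
          { isSemigroup = record
            { isMagma = record { isEquivalence = isEquivalence ; ∙-cong = cong₂ _⊕_ }
            ; assoc = zipWith-assoc Z.+-assoc }
          ; identity = zipWith-identityˡ Z.+-identityˡ , zipWith-identityʳ Z.+-identityʳ }
        ; inverse = zipWith-inverseˡ Z.-‿inverseˡ , zipWith-inverseʳ Z.-‿inverseʳ
        ; ⁻¹-cong = cong ⊖_ }
      ; comm = zipWith-comm Z.+-comm }

  Vgroup : ℕ → AbelianGroup 0ℓ 0ℓ
  Vgroup d = record { Carrier = V d ; isAbelianGroup = ⊕-isAbelianGroup }

  module _ {d : ℕ} where
    open AbelianGroup (Vgroup d) public using ()
      renaming (assoc to ⊕-assoc; comm to ⊕-comm; identityˡ to ⊕-identityˡ; identityʳ to ⊕-identityʳ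
               ; inverseˡ to ⊖-inverseˡ; inverseʳ to ⊖-inverseʳ)
    open Algebra.Properties.AbelianGroup (Vgroup d) public using ()
      renaming (∙-cancelˡ to ⊕-cancelˡ; ∙-cancelʳ to ⊕-cancelʳ; ⁻¹-involutive to ⊖-involutive
               ; inverseˡ-unique to ⊖-uniqueˡ; ε⁻¹≈ε to ⊖𝟘; x∙y⁻¹≈ε⇒x≈y to ⊝≡𝟘⇒≡; ⁻¹-injective to ⊖-injective)
    open AbelianGroupSolver (Vgroup d) public using (solve; x₀; x₁; x₂; x₃; x₄; :0; _:+_; :⊖_; _:-_)

  _≟V_ : ∀ {d} (x y : V d) → Dec (x ≡ y)
  _≟V_ = ≡-dec F._≟_

  opaque
    unfolding _⊕_

    ∙-distribˡ : ∀ {d} c (x y : V d) → c ∙ (x ⊕ y) ≡ c ∙ x ⊕ c ∙ y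
    ∙-distribˡ c [] [] = refl
    ∙-distribˡ c (x ∷ xs) (y ∷ ys) = cong₂ _∷_ (Z.distribˡ c x y) (∙-distribˡ c xs ys)

    ∙-distribʳ : ∀ {d} c e (x : V d) → addZ p c e ∙ x ≡ c ∙ x ⊕ e ∙ x
    ∙-distribʳ c e [] = refl
    ∙-distribʳ c e (x ∷ xs) = cong₂ _∷_ (Z.distribʳ x c e) (∙-distribʳ c e xs)

    ∙-assoc : ∀ {d} c e (x : V d) → mulZ p c e ∙ x ≡ c ∙ (e ∙ x)
    ∙-assoc c e [] = refl
    ∙-assoc c e (x ∷ xs) = cong₂ _∷_ (Z.*-assoc c e x) (∙-assoc c e xs)

    ∙-identity : ∀ {d} (x : V d) → oneZ p ∙ x ≡ x
    ∙-identity [] = refl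
    ∙-identity (x ∷ xs) = cong₂ _∷_ (Z.*-identityˡ x) (∙-identity xs)

    ∙-zeroˡ : ∀ {d} (x : V d) → zeroZ p ∙ x ≡ 𝟘
    ∙-zeroˡ [] = refl
    ∙-zeroˡ (x ∷ xs) = cong₂ _∷_ (Z.zeroˡ x) (∙-zeroˡ xs)

    ∙-zeroʳ : ∀ {d} c → c ∙ 𝟘 {d} ≡ 𝟘
    ∙-zeroʳ {zero} c = refl
    ∙-zeroʳ {suc d} c = cong₂ _∷_ (Z.zeroʳ c) (∙-zeroʳ c)

  suc-∙ : ∀ {d} k (x : V d) → (suc k mod p) ∙ x ≡ x ⊕ (k mod p) ∙ x
  suc-∙ k x = trans (cong (_∙ x) (mod-+ p 1 k)) (trans (∙-distribʳ (oneZ p) (k mod p) x) (cong (_⊕ (k mod p) ∙ x) (∙-identity x)))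

  -- Linear maps enter only through additivity: over the prime field a scalar multiple is a repeated
  -- sum, which is how `additive-∙` obtains homogeneity.
  Additive : ∀ {m n} → (V m → V n) → Set
  Additive f = ∀ x y → f (x ⊕ y) ≡ f x ⊕ f y

  module _ {m n} {f : V m → V n} (f-+ : Additive f) where

    additive-𝟘 : f 𝟘 ≡ 𝟘
    additive-𝟘 = ⊕-cancelˡ (f 𝟘) _ _ (trans (sym (f-+ 𝟘 𝟘)) (trans (cong f (⊕-identityˡ 𝟘)) (sym (⊕-identityʳ (f 𝟘)))))

    additive-⊖ : ∀ x → f (⊖ x) ≡ ⊖ f x
    additive-⊖ x = ⊖-uniqueˡ (f (⊖ x)) (f x) (trans (sym (f-+ (⊖ x) x)) (trans (cong f (⊖-inverseˡ x)) additive-𝟘))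

    additive-∙ : ∀ c x → f (c ∙ x) ≡ c ∙ f x
    additive-∙ c x = subst (λ e → f (e ∙ x) ≡ e ∙ f x) (mod-toℕ p c) (go (toℕ c))
      where
      go : ∀ k → f ((k mod p) ∙ x) ≡ (k mod p) ∙ f x
      go zero = trans (cong f (∙-zeroˡ x)) (trans additive-𝟘 (sym (∙-zeroˡ (f x))))
      go (suc k) = begin
        f ((suc k mod p) ∙ x)  ≡⟨ cong f (suc-∙ k x) ⟩
        f (x ⊕ (k mod p) ∙ x)  ≡⟨ f-+ _ _ ⟩
        f x ⊕ f ((k mod p) ∙ x)  ≡⟨ cong (f x ⊕_) (go k) ⟩
        f x ⊕ (k mod p) ∙ f x  ≡⟨ suc-∙ k (f x) ⟨
        (suc k mod p) ∙ f x  ∎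

    additive-injective : (∀ x → f x ≡ 𝟘 → x ≡ 𝟘) → ∀ x y → f x ≡ f y → x ≡ y
    additive-injective ker x y eq = ⊝≡𝟘⇒≡ x y (ker (x ⊝ y) (trans (f-+ x (⊖ y))
      (trans (cong₂ _⊕_ eq (additive-⊖ y)) (⊖-inverseʳ (f y)))))

  ∙-⊖ : ∀ {d} c (x : V d) → c ∙ (⊖ x) ≡ ⊖ (c ∙ x)
  ∙-⊖ c = additive-⊖ (∙-distribˡ c)

  opaque
    unfolding _⊕_

    dot-+ʳ : ∀ {k} (w x y : V k) → dot p w (x ⊕ y) ≡ addZ p (dot p w x) (dot p w y)
    dot-+ʳ [] [] [] = sym (Z.+-identityˡ _)
    dot-+ʳ (w ∷ ws) (x ∷ xs) (y ∷ ys) = trans (cong₂ (addZ p) (Z.distribˡ w x y) (dot-+ʳ ws xs ys)) (interchange (mulZ p w x) (mulZ p w y) (dot p ws xs) (dot p ws ys))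

    dot-+ˡ : ∀ {k} (w x y : V k) → dot p (w ⊕ x) y ≡ addZ p (dot p w y) (dot p x y)
    dot-+ˡ [] [] [] = sym (Z.+-identityˡ _)
    dot-+ˡ (w ∷ ws) (x ∷ xs) (y ∷ ys) = trans (cong₂ (addZ p) (Z.distribʳ y w x) (dot-+ˡ ws xs ys)) (interchange (mulZ p w y) (mulZ p x y) (dot p ws ys) (dot p xs ys))

    dot-∙ˡ : ∀ {k} c (x y : V k) → dot p (c ∙ x) y ≡ mulZ p c (dot p x y)
    dot-∙ˡ c [] [] = sym (Z.zeroʳ c)
    dot-∙ˡ c (x ∷ xs) (y ∷ ys) = trans (cong₂ (addZ p) (Z.*-assoc c x y) (dot-∙ˡ c xs ys)) (sym (Z.distribˡ c _ _))

    dot-𝟘ˡ : ∀ {k} (x : V k) → dot p 𝟘 x ≡ zeroZ p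
    dot-𝟘ˡ [] = refl
    dot-𝟘ˡ (x ∷ xs) = trans (cong₂ (addZ p) (Z.zeroˡ x) (dot-𝟘ˡ xs)) (Z.+-identityˡ _)

    dot-𝟘ʳ : ∀ {k} (x : V k) → dot p x 𝟘 ≡ zeroZ p
    dot-𝟘ʳ [] = refl
    dot-𝟘ʳ (x ∷ xs) = trans (cong₂ (addZ p) (Z.zeroʳ x) (dot-𝟘ʳ xs)) (Z.+-identityˡ _)

    matVec-⊕ : ∀ {m n} (M : Mat p m n) → Additive (matVec p M)
    matVec-⊕ [] x y = refl
    matVec-⊕ (w ∷ M) x y = cong₂ _∷_ (dot-+ʳ w x y) (matVec-⊕ M x y)

    transpose-∷ : ∀ {m n} (w : V n) (M : Mat p m n) → transpose (w ∷ M) ≡ zipWith _∷_ w (transpose M)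
    transpose-∷ w M = go w (transpose M)
      where
      go : ∀ {m n} (w : V n) (N : Mat p n m) → ((replicate n _∷_ ⊛ w) ⊛ N) ≡ zipWith _∷_ w N
      go [] [] = refl
      go (x ∷ w) (y ∷ N) = cong ((x ∷ y) ∷_) (go w N)

    map-dot-∷ : ∀ {m n} c (row : V m) (w : V n) (N : Mat p n m) →
      map (dot p (c ∷ row)) (zipWith _∷_ w N) ≡ c ∙ w ⊕ map (dot p row) N
    map-dot-∷ c row [] [] = refl
    map-dot-∷ c row (x ∷ w) (y ∷ N) = cong (_ ∷_) (map-dot-∷ c row w N)

    -- Associativity of row, matrix and column. `matMul` takes its entries from the columns
    -- `transpose N`, and this is where they meet `matVec`; the induction strips one row of `N`.
    dot-transpose : ∀ {m n} (row : V m) (N : Mat p m n) x →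
      dot p (map (dot p row) (transpose N)) x ≡ dot p row (matVec p N x)
    dot-transpose {n = n} [] [] x = trans (cong (λ y → dot p y x) (map-replicate (dot p []) [] n)) (dot-𝟘ˡ x)
    dot-transpose (c ∷ row) (w ∷ N) x = begin
      dot p (map (dot p (c ∷ row)) (transpose (w ∷ N))) x
        ≡⟨ cong (λ T → dot p (map (dot p (c ∷ row)) T) x) (transpose-∷ w N) ⟩
      dot p (map (dot p (c ∷ row)) (zipWith _∷_ w (transpose N))) x
        ≡⟨ cong (λ y → dot p y x) (map-dot-∷ c row w (transpose N)) ⟩
      dot p (c ∙ w ⊕ map (dot p row) (transpose N)) x
        ≡⟨ dot-+ˡ (c ∙ w) (map (dot p row) (transpose N)) x ⟩
      addZ p (dot p (c ∙ w) x) (dot p (map (dot p row) (transpose N)) x)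
        ≡⟨ cong₂ (addZ p) (dot-∙ˡ c w x) (dot-transpose row N x) ⟩
      addZ p (mulZ p c (dot p w x)) (dot p row (matVec p N x)) ∎

    matVec-matMul : ∀ {m k n} (M : Mat p m k) (N : Mat p k n) x →
      matVec p (matMul p M N) x ≡ matVec p M (matVec p N x)
    matVec-matMul [] N x = refl
    matVec-matMul (w ∷ M) N x = cong₂ _∷_ (dot-transpose w N x) (matVec-matMul M N x)

    matVec-shift : ∀ {m n} (M : Mat p m n) c x → matVec p (map (zeroZ p ∷_) M) (c ∷ x) ≡ matVec p M x
    matVec-shift [] c x = refl
    matVec-shift (w ∷ M) c x = cong₂ _∷_ (trans (cong (λ e → addZ p e (dot p w x)) (Z.zeroˡ c)) (Z.+-identityˡ _)) (matVec-shift M c x)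

    idMat-suc : ∀ n → idMat p (suc n) ≡ (oneZ p ∷ 𝟘) ∷ map (zeroZ p ∷_) (idMat p n)
    idMat-suc n = cong₂ _∷_ (cong (oneZ p ∷_) (zeros n))
      (trans (tabulate-cong (λ i → cong (zeroZ p ∷_) (tabulate-cong (λ j → ≟-suc i j)))) (tabulate-∘ (zeroZ p ∷_) _))
      where
      zeros : ∀ n → tabulate {n = n} (λ _ → zeroZ p) ≡ 𝟘
      zeros zero = refl
      zeros (suc n) = cong (zeroZ p ∷_) (zeros n)
      ≟-suc : ∀ {n} (i j : Fin n) → (if ⌊ suc i F.≟ suc j ⌋ then oneZ p else zeroZ p) ≡ (if ⌊ i F.≟ j ⌋ then oneZ p else zeroZ p)
      ≟-suc i j with i F.≟ j
      ... | yes _ = refl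
      ... | no _ = refl

    matVec-idMat : ∀ {n} (x : V n) → matVec p (idMat p n) x ≡ x
    matVec-idMat [] = refl
    matVec-idMat {suc n} (c ∷ x) = trans (cong (λ M → matVec p M (c ∷ x)) (idMat-suc n))
      (cong₂ _∷_ (trans (cong₂ (addZ p) (Z.*-identityˡ c) (dot-𝟘ˡ x)) (Z.+-identityʳ c))
        (trans (matVec-shift (idMat p n) c x) (matVec-idMat x)))

    dot-ext : ∀ {n} (w x : V n) → (∀ y → dot p w y ≡ dot p x y) → w ≡ x
    dot-ext [] [] eq = refl
    dot-ext (a ∷ w) (b ∷ x) eq = cong₂ _∷_
      (trans (sym (first a w)) (trans (eq (oneZ p ∷ 𝟘)) (first b x)))
      (dot-ext w x (λ y → trans (sym (rest a w y)) (trans (eq (zeroZ p ∷ y)) (rest b x y))))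
      where
      first : ∀ {n} a (w : V n) → dot p (a ∷ w) (oneZ p ∷ 𝟘) ≡ a
      first a w = trans (cong₂ (addZ p) (Z.*-identityʳ a) (dot-𝟘ʳ w)) (Z.+-identityʳ a)
      rest : ∀ {n} a (w : V n) y → dot p (a ∷ w) (zeroZ p ∷ y) ≡ dot p w y
      rest a w y = trans (cong (λ e → addZ p e (dot p w y)) (Z.zeroʳ a)) (Z.+-identityˡ _)

    matVec-ext : ∀ {m n} (M N : Mat p m n) → (∀ x → matVec p M x ≡ matVec p N x) → M ≡ N
    matVec-ext [] [] eq = refl
    matVec-ext (w ∷ M) (x ∷ N) eq = cong₂ _∷_ (dot-ext w x (λ y → ∷-injectiveˡ (eq y))) (matVec-ext M N (λ y → ∷-injectiveʳ (eq y)))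

    matVec-∷ : ∀ {m n} (w : V m) (M : Mat p m n) c x → matVec p (zipWith _∷_ w M) (c ∷ x) ≡ c ∙ w ⊕ matVec p M x
    matVec-∷ [] [] c x = refl
    matVec-∷ (a ∷ w) (u ∷ M) c x = cong₂ _∷_ (cong (λ e → addZ p e (dot p u x)) (Z.*-comm a c)) (matVec-∷ w M c x)

    additive⇒matrix : ∀ {m n} (f : V n → V m) → Additive f → Σ (Mat p m n) λ M → ∀ x → matVec p M x ≡ f x
    additive⇒matrix {m} {zero} f f-+ = replicate m [] ,
      λ { [] → trans (map-replicate (λ row → dot p row []) [] m) (sym (additive-𝟘 {f = f} f-+)) }
    additive⇒matrix {m} {suc n} f f-+ =
      let M , eq = additive⇒matrix (λ x → f (zeroZ p ∷ x))
                     (λ x y → trans (cong (λ c → f (c ∷ (x ⊕ y))) (sym (Z.+-identityˡ (zeroZ p)))) (f-+ _ _))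
      in zipWith _∷_ (f (oneZ p ∷ 𝟘)) M , λ { (c ∷ x) → begin
        matVec p (zipWith _∷_ (f (oneZ p ∷ 𝟘)) M) (c ∷ x)  ≡⟨ matVec-∷ _ M c x ⟩
        c ∙ f (oneZ p ∷ 𝟘) ⊕ matVec p M x  ≡⟨ cong₂ _⊕_ (sym (additive-∙ f-+ c _)) (eq x) ⟩
        f (c ∙ (oneZ p ∷ 𝟘)) ⊕ f (zeroZ p ∷ x)  ≡⟨ f-+ _ _ ⟨
        f (c ∙ (oneZ p ∷ 𝟘) ⊕ (zeroZ p ∷ x))  ≡⟨ cong f (cong₂ _∷_ (trans (Z.+-identityʳ _) (Z.*-identityʳ c))
                                                                (trans (cong (_⊕ x) (∙-zeroʳ c)) (⊕-identityˡ x))) ⟩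
        f (c ∷ x)  ∎ }

  module Field (prime : Prime p) where

    1<p : 1 < p
    1<p = ℕ.nonTrivial⇒n>1 p {{prime⇒nonTrivial prime}}

    toℕ-∣⇒0 : ∀ c → p ∣ toℕ c → c ≡ zeroZ p
    toℕ-∣⇒0 c p∣c = trans (sym (mod-toℕ p c)) (∣⇒mod≡0 p (toℕ c) p∣c)

    mulZ-zero : ∀ c e → mulZ p c e ≡ zeroZ p → c ≡ zeroZ p ⊎ e ≡ zeroZ p
    mulZ-zero c e eq with euclidsLemma (toℕ c) (toℕ e) prime (mod≡0⇒∣ p (toℕ c ℕ.* toℕ e) eq)
    ... | inj₁ q = inj₁ (toℕ-∣⇒0 c q)
    ... | inj₂ q = inj₂ (toℕ-∣⇒0 e q)

    opaque
      -- Without zero divisors multiplication by `c` is injective, hence surjective on a finite set,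
      -- and so it takes the value 1.
      inverse : ∀ c → c ≢ zeroZ p → Σ (Fin p) λ e → mulZ p c e ≡ oneZ p
      inverse c c≢0 = injective⇒surjective ↔-refl (mulZ p c) inj (oneZ p)
        where
        inj : ∀ x y → mulZ p c x ≡ mulZ p c y → x ≡ y
        inj x y eq with mulZ-zero c (addZ p x (negZ p y)) (trans (Z.distribˡ c x (negZ p y))
                          (trans (cong₂ (addZ p) eq (sym (ZP.-‿distribʳ-* c y))) (Z.-‿inverseʳ _)))
        ... | inj₁ q = contradiction q c≢0
        ... | inj₂ q = ZA.x∙y⁻¹≈ε⇒x≈y x y q

    ∙-cancel : ∀ {d} c (x : V d) → c ≢ zeroZ p → c ∙ x ≡ 𝟘 → x ≡ 𝟘
    ∙-cancel c x c≢0 eq = let e , ce = inverse c c≢0 in begin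
      x  ≡⟨ ∙-identity x ⟨
      oneZ p ∙ x  ≡⟨ cong (_∙ x) (trans (sym ce) (Z.*-comm c e)) ⟩
      mulZ p e c ∙ x ≡⟨ ∙-assoc e c x ⟩
      e ∙ (c ∙ x)  ≡⟨ cong (e ∙_) eq ⟩
      e ∙ 𝟘  ≡⟨ ∙-zeroʳ e ⟩
      𝟘  ∎

    two∙ : ∀ {d} (x : V d) → (2 mod p) ∙ x ≡ x ⊕ x
    two∙ x = trans (suc-∙ 1 x) (cong (x ⊕_) (∙-identity x))

    module Odd (p≢2 : p ≢ 2) where

      2≢0 : 2 mod p ≢ zeroZ p
      2≢0 eq = p≢2 (ℕ.≤-antisym (∣⇒≤ (mod≡0⇒∣ p 2 eq)) 1<p)

      ½ : Fin p
      ½ = proj₁ (inverse (2 mod p) 2≢0)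

      ½-double : ∀ {d} (x : V d) → ½ ∙ x ⊕ ½ ∙ x ≡ x
      ½-double x = trans (sym (two∙ (½ ∙ x))) (trans (sym (∙-assoc (2 mod p) ½ x))
        (trans (cong (_∙ x) (proj₂ (inverse (2 mod p) 2≢0))) (∙-identity x)))

      double-cancel : ∀ {d} (x : V d) → x ⊕ x ≡ 𝟘 → x ≡ 𝟘
      double-cancel x eq = ∙-cancel (2 mod p) x 2≢0 (trans (two∙ x) eq)

-- The dihedral group and its representations

module Dihedral (r : ℕ) .{{_ : NonZero r}} where

  infixl 6 _+_ _-_
  infix 8 -_

  opaque
    _+_ : Fin r → Fin r → Fin r
    _+_ = addZ r

    -_ : Fin r → Fin r
    -_ = negZ r

    0# 1# : Fin r
    0# = zeroZ r
    1# = oneZ r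

    +-isAbelianGroup : IsAbelianGroup _≡_ _+_ 0# -_
    +-isAbelianGroup = CommutativeRing.+-isAbelianGroup (Zring r)

    +-def : ∀ i j → i + j ≡ addZ r i j
    +-def i j = refl

    1#-def : 1# ≡ oneZ r
    1#-def = refl

    0-mod : 0 mod r ≡ 0#
    0-mod = refl

    r-mod : r mod r ≡ 0#
    r-mod = n-mod r

    suc-mod : ∀ k → suc k mod r ≡ 1# + (k mod r)
    suc-mod = mod-+ r 1

    -- An endomorphism of ℤ/r in its second argument; the automorphisms of D built in `Remark` act
    -- on rotations in this way.
    times : Fin r → Fin r → Fin r
    times q k = mulZ r k q

    times-+ : ∀ q j k → times q (j + k) ≡ times q j + times q k
    times-+ q j k = CommutativeRing.distribʳ (Zring r) q j k

    times-1 : ∀ q → times q 1# ≡ q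
    times-1 = mulZ-identityˡ r

  _-_ : Fin r → Fin r → Fin r
  i - j = i + (- j)

  Zr : AbelianGroup 0ℓ 0ℓ
  Zr = record { isAbelianGroup = +-isAbelianGroup }

  open AbelianGroup Zr public using ()
    renaming (assoc to +-assoc; comm to +-comm; identityˡ to +-identityˡ; identityʳ to +-identityʳ
             ; inverseˡ to -‿inverseˡ; inverseʳ to -‿inverseʳ)
  open AbelianGroupSolver Zr public using ()
    renaming (solve to solveᵣ; x₀ to x₀ᵣ; x₁ to x₁ᵣ; x₂ to x₂ᵣ; :0 to :0ᵣ; _:+_ to _:+ᵣ_; :⊖_ to :⊖ᵣ_; _:-_ to _:-ᵣ_)

  times-0 : ∀ q → times q 0# ≡ 0#
  times-0 q = AG.identityʳ-unique (times q 0#) (times q 0#) (trans (sym (times-+ q 0# 0#)) (cong (times q) (+-identityˡ 0#)))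
    where module AG = Algebra.Properties.AbelianGroup Zr

  times-neg : ∀ q k → times q (- k) ≡ - times q k
  times-neg q k = AG.inverseˡ-unique (times q (- k)) (times q k)
    (trans (sym (times-+ q (- k) k)) (trans (cong (times q) (-‿inverseˡ k)) (times-0 q)))
    where module AG = Algebra.Properties.AbelianGroup Zr

  infixl 7 _·_

  opaque
    unfolding _+_

    _·_ : Dih r → Dih r → Dih r
    _·_ = dihMul r

    e : Dih r
    e = dihOne r

    rot· : ∀ i j b → (i , false) · (j , b) ≡ (i + j , b)
    rot· i j b = refl

    ref· : ∀ i j b → (i , true) · (j , b) ≡ (i - j , not b)
    ref· i j b = refl

    e-def : e ≡ (0# , false)
    e-def = refl

    e-dihOne : e ≡ dihOne r
    e-dihOne = refl

    ·-def : ∀ g h → g · h ≡ dihMul r g h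
    ·-def g h = refl

  dihInv : Dih r → Dih r
  dihInv (i , false) = - i , false
  dihInv (i , true) = i , true

  ·-assoc : ∀ g h k → (g · h) · k ≡ g · (h · k)
  ·-assoc (i , false) (j , false) (k , c) =
    trans (cong (_· (k , c)) (rot· i j false)) (trans (rot· (i + j) k c)
    (trans (cong (_, c) (+-assoc i j k))
    (trans (sym (rot· i (j + k) c)) (cong ((i , false) ·_) (sym (rot· j k c))))))
  ·-assoc (i , false) (j , true) (k , c) =
    trans (cong (_· (k , c)) (rot· i j true)) (trans (ref· (i + j) k c)
    (trans (cong (_, not c) (+-assoc i j (- k)))
    (trans (sym (rot· i (j - k) (not c))) (cong ((i , false) ·_) (sym (ref· j k c))))))
  ·-assoc (i , true) (j , false) (k , c) =
    trans (cong (_· (k , c)) (ref· i j false)) (trans (ref· (i - j) k c)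
    (trans (cong (_, not c) (solveᵣ (i ∷ j ∷ k ∷ []) ((x₀ᵣ :-ᵣ x₁ᵣ) :-ᵣ x₂ᵣ) (x₀ᵣ :-ᵣ (x₁ᵣ :+ᵣ x₂ᵣ)) refl))
    (trans (sym (ref· i (j + k) c)) (cong ((i , true) ·_) (sym (rot· j k c))))))
  ·-assoc (i , true) (j , true) (k , c) =
    trans (cong (_· (k , c)) (ref· i j true)) (trans (rot· (i - j) k c)
    (trans (cong₂ _,_ (solveᵣ (i ∷ j ∷ k ∷ []) ((x₀ᵣ :-ᵣ x₁ᵣ) :+ᵣ x₂ᵣ) (x₀ᵣ :-ᵣ (x₁ᵣ :-ᵣ x₂ᵣ)) refl) (sym (not-involutive c)))
    (trans (sym (ref· i (j - k) (not c))) (cong ((i , true) ·_) (sym (ref· j k c))))))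

  ·-identityˡ : ∀ g → e · g ≡ g
  ·-identityˡ (i , b) = trans (cong (_· (i , b)) e-def) (trans (rot· 0# i b) (cong (_, b) (+-identityˡ i)))

  ·-identityʳ : ∀ g → g · e ≡ g
  ·-identityʳ (i , false) = trans (cong ((i , false) ·_) e-def) (trans (rot· i 0# false) (cong (_, false) (+-identityʳ i)))
  ·-identityʳ (i , true) = trans (cong ((i , true) ·_) e-def) (trans (ref· i 0# false)
    (cong (_, true) (solveᵣ (i ∷ []) (x₀ᵣ :-ᵣ :0ᵣ) x₀ᵣ refl)))

  ref² : ∀ i → (i , true) · (i , true) ≡ e
  ref² i = trans (ref· i i true) (trans (cong (_, false) (-‿inverseʳ i)) (sym e-def))

  ·-inverseˡ : ∀ g → dihInv g · g ≡ e
  ·-inverseˡ (i , false) = trans (rot· (- i) i false) (trans (cong (_, false) (-‿inverseˡ i)) (sym e-def))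
  ·-inverseˡ (i , true) = ref² i

  ·-inverseʳ : ∀ g → g · dihInv g ≡ e
  ·-inverseʳ (i , false) = trans (rot· i (- i) false) (trans (cong (_, false) (-‿inverseʳ i)) (sym e-def))
  ·-inverseʳ (i , true) = ref² i

  τ β ρ : Dih r
  τ = 0# , true
  β = - 1# , true
  ρ = 1# , false

  τβ : τ · β ≡ ρ
  τβ = trans (ref· _ _ true) (cong (_, false) (solveᵣ (1# ∷ []) (:0ᵣ :-ᵣ (:⊖ᵣ x₀ᵣ)) (x₀ᵣ) refl))

  rot-suc : ∀ k → (suc k mod r , false) ≡ ρ · (k mod r , false)
  rot-suc k = trans (cong (_, false) (suc-mod k)) (sym (rot· _ _ false))

  rot·τ : ∀ i → (i , false) · τ ≡ (i , true)
  rot·τ i = trans (rot· i _ true) (cong (_, true) (+-identityʳ i))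

  ref·β : ∀ i → (i , true) · β ≡ (i + 1# , false)
  ref·β i = trans (ref· i _ true) (cong (_, false) (solveᵣ (i ∷ 1# ∷ []) (x₀ᵣ :-ᵣ (:⊖ᵣ x₁ᵣ)) (x₀ᵣ :+ᵣ x₁ᵣ) refl))

  pred-suc : ∀ i → (i + 1#) - 1# ≡ i
  pred-suc i = solveᵣ (i ∷ 1# ∷ []) ((x₀ᵣ :+ᵣ x₁ᵣ) :-ᵣ x₁ᵣ) x₀ᵣ refl

  suc-pred : ∀ i → (i - 1#) + 1# ≡ i
  suc-pred i = solveᵣ (i ∷ 1# ∷ []) ((x₀ᵣ :-ᵣ x₁ᵣ) :+ᵣ x₁ᵣ) x₀ᵣ refl

  -- Products alone reach everything: τ² is the identity, τβ = ρ has all rotations as its powers,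
  -- and a rotation times τ is an arbitrary reflection.
  dih-induction : (P : Dih r → Set) → P τ → P β → (∀ g h → P g → P h → P (g · h)) → ∀ g → P g
  dih-induction P Pτ Pβ P· = λ { (i , false) → Prot i ; (i , true) → subst P (rot·τ i) (P· _ _ (Prot i) Pτ) }
    where
    Pρ : P ρ
    Pρ = subst P τβ (P· _ _ Pτ Pβ)
    Pk : ∀ k → P (k mod r , false)
    Pk zero = subst P (trans (ref² _) (trans e-def (cong (_, false) (sym 0-mod)))) (P· _ _ Pτ Pτ)
    Pk (suc k) = subst P (sym (rot-suc k)) (P· _ _ Pρ (Pk k))
    Prot : ∀ i → P (i , false)
    Prot i = subst (λ j → P (j , false)) (mod-toℕ r i) (Pk (toℕ i))

-- Irreducible representations of the dihedral group: spans, Schur's lemma, enumeration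

module Reps (p r : ℕ) .{{_ : NonZero p}} .{{_ : NonZero r}} (prime : Prime p) where

  open LinearAlgebra p public
  open Field prime public
  open Dihedral r public
  open ≡-Reasoning

  -- Indexing by all of ℕ lets the span run over initial segments of one fixed sequence while the
  -- length varies.
  Family : ℕ → Set
  Family d = ℕ → V d

  -- The head of the coefficient vector belongs to the vector of highest index, so lengthening the
  -- segment conses a coefficient. The functional `ℓ` of the Praeger-Xu coordinates is this head.
  sp : ∀ {d} → Family d → ∀ m → V m → V d
  sp w zero [] = 𝟘
  sp w (suc m) (c ∷ cs) = c ∙ w m ⊕ sp w m cs

  InSpan : ∀ {d} → Family d → ℕ → V d → Set
  InSpan w m u = Σ (V m) λ c → sp w m c ≡ u

  opaque
    unfolding _⊕_

    ∷-⊕ : ∀ {m} c e (cs es : V m) → (c ∷ cs) ⊕ (e ∷ es) ≡ addZ p c e ∷ (cs ⊕ es)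
    ∷-⊕ c e cs es = refl

    ∷-∙ : ∀ {m} c e (es : V m) → c ∙ (e ∷ es) ≡ mulZ p c e ∷ (c ∙ es)
    ∷-∙ c e es = refl

    𝟘-suc : ∀ {m} → 𝟘 {suc m} ≡ zeroZ p ∷ 𝟘
    𝟘-suc = refl

    𝟘-unique : (x : V 0) → x ≡ 𝟘
    𝟘-unique [] = refl

  module _ {d} (w : Family d) where

    sp-0 : ∀ c → sp w 0 c ≡ 𝟘
    sp-0 [] = refl

    sp-⊕ : ∀ m (c e : V m) → sp w m (c ⊕ e) ≡ sp w m c ⊕ sp w m e
    sp-⊕ zero c e = trans (sp-0 (c ⊕ e)) (sym (trans (cong₂ _⊕_ (sp-0 c) (sp-0 e)) (⊕-identityˡ 𝟘)))
    sp-⊕ (suc m) (c ∷ cs) (e ∷ es) = begin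
      sp w (suc m) ((c ∷ cs) ⊕ (e ∷ es))  ≡⟨ cong (sp w (suc m)) (∷-⊕ c e cs es) ⟩
      addZ p c e ∙ w m ⊕ sp w m (cs ⊕ es)  ≡⟨ cong₂ _⊕_ (∙-distribʳ c e (w m)) (sp-⊕ m cs es) ⟩
      (c ∙ w m ⊕ e ∙ w m) ⊕ (sp w m cs ⊕ sp w m es)  ≡⟨ solve (c ∙ w m ∷ e ∙ w m ∷ sp w m cs ∷ sp w m es ∷ [])
                                                           ((x₀ :+ x₁) :+ (x₂ :+ x₃))
                                                           ((x₀ :+ x₂) :+ (x₁ :+ x₃)) refl ⟩
      (c ∙ w m ⊕ sp w m cs) ⊕ (e ∙ w m ⊕ sp w m es)  ∎

    sp-induction : ∀ m (P : V d → Set) → P 𝟘 → (∀ x y → P x → P y → P (x ⊕ y)) → (∀ c x → P x → P (c ∙ x)) →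
      (∀ i → i < m → P (w i)) → ∀ c → P (sp w m c)
    sp-induction zero P P0 P+ P∙ Pw [] = P0
    sp-induction (suc m) P P0 P+ P∙ Pw (c ∷ cs) =
      P+ _ _ (P∙ c _ (Pw m ℕ.≤-refl)) (sp-induction m P P0 P+ P∙ (λ i i<m → Pw i (ℕ.m≤n⇒m≤1+n i<m)) cs)

    InSpan-𝟘 : ∀ m → InSpan w m 𝟘
    InSpan-𝟘 m = 𝟘 , additive-𝟘 (sp-⊕ m)

    InSpan-⊕ : ∀ m x y → InSpan w m x → InSpan w m y → InSpan w m (x ⊕ y)
    InSpan-⊕ m x y (c , refl) (e , refl) = c ⊕ e , sp-⊕ m c e

    InSpan-∙ : ∀ m c x → InSpan w m x → InSpan w m (c ∙ x)
    InSpan-∙ m c x (e , refl) = c ∙ e , additive-∙ (sp-⊕ m) c e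

    InSpan-weaken : ∀ m x → InSpan w m x → InSpan w (suc m) x
    InSpan-weaken m x (c , refl) = zeroZ p ∷ c , trans (cong (_⊕ sp w m c) (∙-zeroˡ (w m))) (⊕-identityˡ _)

    InSpan-top : ∀ m → InSpan w (suc m) (w m)
    InSpan-top m = oneZ p ∷ 𝟘 , trans (cong₂ _⊕_ (∙-identity (w m)) (additive-𝟘 (sp-⊕ m))) (⊕-identityʳ _)

    InSpan-family : ∀ m i → i < m → InSpan w m (w i)
    InSpan-family (suc m) i (s≤s i≤m) with ℕ.m≤n⇒m<n∨m≡n i≤m
    ... | inj₁ i<m = InSpan-weaken m (w i) (InSpan-family m i i<m)
    ... | inj₂ refl = InSpan-top m

    InSpan? : ∀ m u → Dec (InSpan w m u)
    InSpan? m u = search (vec↔ p m) (λ c → sp w m c ≟V u)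

  closed-∙ : ∀ {d} (P : V d → Set) → P 𝟘 → (∀ x y → P x → P y → P (x ⊕ y)) → ∀ c x → P x → P (c ∙ x)
  closed-∙ P P0 P+ c x Px = subst (λ k → P (k ∙ x)) (mod-toℕ p c) (go (toℕ c))
    where
    go : ∀ k → P ((k mod p) ∙ x)
    go zero = subst P (sym (∙-zeroˡ x)) P0
    go (suc k) = subst P (sym (suc-∙ k x)) (P+ _ _ Px (go k))

  instance
    2r≢0 : NonZero (r ℕ.* 2)
    2r≢0 = ℕ.m*n≢0 r 2

  -- Reduction modulo 2r extends an enumeration of D to ℕ, which turns the orbit of a vector into a
  -- `Family`.
  enumDih : ℕ → Dih r
  enumDih k = Inverse.from (dih↔ r) (k mod (r ℕ.* 2))

  enumDih-surjective : ∀ g → ∃ λ k → k < r ℕ.* 2 × enumDih k ≡ g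
  enumDih-surjective g = toℕ i , toℕ<n i , trans (cong (Inverse.from (dih↔ r)) (mod-toℕ (r ℕ.* 2) i)) (from-to (dih↔ r) g)
    where i = Inverse.to (dih↔ r) g

  record Rep (d : ℕ) : Set where
    field
      act : Dih r → V d → V d
      act-⊕ : ∀ g → Additive (act g)
      act-· : ∀ g h x → act (g · h) x ≡ act g (act h x)
      act-e : ∀ x → act e x ≡ x

    act-𝟘 : ∀ g → act g 𝟘 ≡ 𝟘
    act-𝟘 g = additive-𝟘 (act-⊕ g)

    act-⊖ : ∀ g x → act g (⊖ x) ≡ ⊖ act g x
    act-⊖ g = additive-⊖ (act-⊕ g)

    act-⊝ : ∀ g x y → act g (x ⊝ y) ≡ act g x ⊝ act g y
    act-⊝ g x y = trans (act-⊕ g x (⊖ y)) (cong (act g x ⊕_) (act-⊖ g y))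

    orbit : V d → Family d
    orbit v k = act (enumDih k) v

  -- Irreducibility in its searchable form: no subspaces, only coefficient vectors.
  -- `irreducible⇒cyclic` and `cyclic⇒irreducible` tie `cyclic` to the definition in the statement.
  record Irr (d : ℕ) : Set₁ where
    field
      rep : Rep d
    open Rep rep public
    field
      nontrivial : Σ (V d) λ x → x ≢ 𝟘
      cyclic : ∀ v → v ≢ 𝟘 → ∀ u → InSpan (orbit v) (r ℕ.* 2) u

    -- This is how irreducibility is used from here on: a property stable under sums has to be
    -- checked only on the orbit of one nonzero vector.
    cyclic-induction : ∀ v → v ≢ 𝟘 → (P : V d → Set) → P 𝟘 → (∀ x y → P x → P y → P (x ⊕ y)) →
      (∀ g → P (act g v)) → ∀ u → P u
    cyclic-induction v v≢𝟘 P P0 P+ Pg u with cyclic v v≢𝟘 u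
    ... | c , refl = sp-induction (orbit v) (r ℕ.* 2) P P0 P+ (closed-∙ P P0 P+) (λ i _ → Pg (enumDih i)) c

  Equivariant : ∀ {d d′} → Rep d → Rep d′ → (V d → V d′) → Set
  Equivariant M M′ f = ∀ g x → f (Rep.act M g x) ≡ Rep.act M′ g (f x)

  -- A nonzero vector in the kernel would generate the source, `v` included, against `f v` ≠ 0; and
  -- `f v` generates the target. So `f` is bijective.
  module Schur {d d′} (M : Irr d) (M′ : Irr d′) (f : V d → V d′) (f-⊕ : Additive f)
               (f-act : Equivariant (Irr.rep M) (Irr.rep M′) f) (v : V d) (fv≢𝟘 : f v ≢ 𝟘) where
    private
      module M = Irr M
      module M′ = Irr M′

    kernel : ∀ x → f x ≡ 𝟘 → x ≡ 𝟘
    kernel x fx = decidable-stable (x ≟V 𝟘) λ x≢𝟘 → fv≢𝟘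
      (M.cyclic-induction x x≢𝟘 (λ u → f u ≡ 𝟘) (additive-𝟘 f-⊕)
        (λ a b p q → trans (f-⊕ a b) (trans (cong₂ _⊕_ p q) (⊕-identityˡ 𝟘)))
        (λ g → trans (f-act g x) (trans (cong (M′.act g) fx) (M′.act-𝟘 g))) v)

    injective : ∀ x y → f x ≡ f y → x ≡ y
    injective = additive-injective f-⊕ kernel

    surjective : ∀ y → ∃ λ x → f x ≡ y
    surjective = M′.cyclic-induction (f v) fv≢𝟘 (λ y → ∃ λ x → f x ≡ y) (𝟘 , additive-𝟘 f-⊕)
      (λ { _ _ (a , refl) (b , refl) → a ⊕ b , f-⊕ a b }) (λ g → M.act g v , f-act g v)

    inverse-⊕ : Additive (proj₁ ∘ surjective)
    inverse-⊕ x y = injective _ _ (trans (proj₂ (surjective (x ⊕ y)))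
      (sym (trans (f-⊕ _ _) (cong₂ _⊕_ (proj₂ (surjective x)) (proj₂ (surjective y))))))

  opaque
    unfolding _⊕_ _·_

    toRep : ∀ {d} (ψ : Dih r → Mat p d d) → IsRep p r d ψ → Rep d
    toRep ψ (hom , one) = record
      { act = λ g → matVec p (ψ g)
      ; act-⊕ = λ g → matVec-⊕ (ψ g)
      ; act-· = λ g h x → trans (cong (λ M → matVec p M x) (hom g h)) (matVec-matMul (ψ g) (ψ h) x)
      ; act-e = λ x → trans (cong (λ M → matVec p M x) one) (matVec-idMat x) }

    act-toRep : ∀ {d} (ψ : Dih r → Mat p d d) ψ-rep g x → Rep.act (toRep ψ ψ-rep) g x ≡ matVec p (ψ g) x
    act-toRep ψ ψ-rep g x = refl

    one≢0 : oneZ p ≢ zeroZ p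
    one≢0 eq = ℕ.<⇒≱ 1<p (∣⇒≤ (mod≡0⇒∣ p 1 eq))

    nontrivial-V : ∀ {d} → 1 ≤ d → Σ (V d) λ x → x ≢ 𝟘
    nontrivial-V (s≤s {n = n} _) = oneZ p ∷ zeroVec p n , λ eq → one≢0 (cong head eq)

    ψorbit : ∀ {d} → (Dih r → Mat p d d) → V d → Family d
    ψorbit ψ v k = matVec p (ψ (enumDih k)) v

    ψorbit-def : ∀ {d} (ψ : Dih r → Mat p d d) v k → ψorbit ψ v k ≡ matVec p (ψ (enumDih k)) v
    ψorbit-def ψ v k = refl

    scalar-matVec : ∀ c (x : V 1) → matVec p ((c ∷ []) ∷ []) x ≡ c ∙ x
    scalar-matVec c (x ∷ []) = cong (_∷ []) (Z.+-identityʳ (mulZ p c x))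

    cyclic⇒irreducible : ∀ {d} (ψ : Dih r → Mat p d d) → IsRep p r d ψ → 1 ≤ d →
      (∀ v → v ≢ 𝟘 → ∀ u → InSpan (ψorbit ψ v) (r ℕ.* 2) u) → IsIrreducible p r d ψ
    cyclic⇒irreducible ψ ψ-rep 1≤d cyc = 1≤d , ψ-rep , λ { (W , (W0 , W+ , W∙ , Wψ) , (v , Wv , v≢𝟘) , (u , ¬Wu)) →
      let c , eq = cyc v v≢𝟘 u in
      ¬Wu (subst W eq (sp-induction (ψorbit ψ v) (r ℕ.* 2) W W0 W+ W∙ (λ i _ → Wψ (enumDih i) v Wv) c)) }

    -- If some `u` lay outside the span of the orbit, that span would be a proper nonzero invariant
    -- subspace. Membership in a span is decidable, so the refutation turns into actual
    -- coefficients.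
    irreducible⇒cyclic : ∀ {d} (ψ : Dih r → Mat p d d) → IsIrreducible p r d ψ →
      ∀ v → v ≢ 𝟘 → ∀ u → InSpan (ψorbit ψ v) (r ℕ.* 2) u
    irreducible⇒cyclic {d} ψ (_ , ψ-rep , noW) v v≢𝟘 u = decidable-stable (InSpan? w (r ℕ.* 2) u) λ ¬q →
      noW (InSpan w (r ℕ.* 2) , (InSpan-𝟘 w _ , InSpan-⊕ w _ , InSpan-∙ w _ , closed) , (v , v∈ , v≢𝟘) , (u , ¬q))
      where
      open Rep (toRep ψ ψ-rep)
      w : Family d
      w = orbit v
      gv∈ : ∀ g → InSpan w (r ℕ.* 2) (act g v)
      gv∈ g with enumDih-surjective g
      ... | k , k< , refl = InSpan-family w _ k k<
      v∈ : InSpan w (r ℕ.* 2) v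
      v∈ = subst (InSpan w (r ℕ.* 2)) (act-e v) (gv∈ e)
      closed : ∀ g x → InSpan w (r ℕ.* 2) x → InSpan w (r ℕ.* 2) (act g x)
      closed g x (c , refl) = sp-induction w (r ℕ.* 2) (λ x → InSpan w (r ℕ.* 2) (act g x))
        (subst (InSpan w (r ℕ.* 2)) (sym (act-𝟘 g)) (InSpan-𝟘 w _))
        (λ x y Px Py → subst (InSpan w (r ℕ.* 2)) (sym (act-⊕ g x y)) (InSpan-⊕ w _ _ _ Px Py))
        (λ c x Px → subst (InSpan w (r ℕ.* 2)) (sym (additive-∙ (act-⊕ g) c x)) (InSpan-∙ w _ c _ Px))
        (λ i _ → subst (InSpan w (r ℕ.* 2)) (act-· g (enumDih i) v) (gv∈ _)) c

    toIrr-cyclic : ∀ {d} (ψ : Dih r → Mat p d d) (irr : IsIrreducible p r d ψ) →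
      ∀ v → v ≢ 𝟘 → ∀ u → InSpan (Rep.orbit (toRep ψ (proj₁ (proj₂ irr))) v) (r ℕ.* 2) u
    toIrr-cyclic = irreducible⇒cyclic

  toIrr : ∀ {d} (ψ : Dih r → Mat p d d) → IsIrreducible p r d ψ → Irr d
  toIrr ψ irr = record
    { rep = toRep ψ (proj₁ (proj₂ irr))
    ; nontrivial = nontrivial-V (proj₁ irr)
    ; cyclic = toIrr-cyclic ψ irr }

  irrOf : (X : IrrRep p r) → Irr (proj₁ X)
  irrOf (d , ψ , irr) = toIrr ψ irr

  opaque
    unfolding _⊕_ _·_ toRep

    equivariant⇒RepIso : (X Y : IrrRep p r) (f : V (proj₁ X) → V (proj₁ Y)) (g : V (proj₁ Y) → V (proj₁ X)) →
      Additive f → Additive g → (∀ x → g (f x) ≡ x) → (∀ y → f (g y) ≡ y) →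
      Equivariant (Irr.rep (irrOf X)) (Irr.rep (irrOf Y)) f → RepIso p r X Y
    equivariant⇒RepIso (d , ψ , _) (d′ , ψ′ , _) f g f-⊕ g-⊕ gf fg f-act =
      let A , A-f = additive⇒matrix f f-⊕
          B , B-g = additive⇒matrix g g-⊕
      in A , B
       , matVec-ext _ _ (λ y → begin
           matVec p (matMul p A B) y  ≡⟨ matVec-matMul A B y ⟩
           matVec p A (matVec p B y)  ≡⟨ trans (A-f _) (cong f (B-g y)) ⟩
           f (g y)  ≡⟨ fg y ⟩
           y  ≡⟨ matVec-idMat y ⟨
           matVec p (idMat p d′) y  ∎)
       , matVec-ext _ _ (λ x → begin
           matVec p (matMul p B A) x  ≡⟨ matVec-matMul B A x ⟩
           matVec p B (matVec p A x)  ≡⟨ trans (B-g _) (cong g (A-f x)) ⟩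
           g (f x)  ≡⟨ gf x ⟩
           x  ≡⟨ matVec-idMat x ⟨
           matVec p (idMat p d) x  ∎)
       , λ h → matVec-ext _ _ (λ x → begin
           matVec p (matMul p A (ψ h)) x  ≡⟨ matVec-matMul A (ψ h) x ⟩
           matVec p A (matVec p (ψ h) x)  ≡⟨ A-f _ ⟩
           f (matVec p (ψ h) x)  ≡⟨ f-act h x ⟩
           matVec p (ψ′ h) (f x)  ≡⟨ cong (matVec p (ψ′ h)) (A-f x) ⟨
           matVec p (ψ′ h) (matVec p A x)  ≡⟨ matVec-matMul (ψ′ h) A x ⟨
           matVec p (matMul p (ψ′ h) A) x  ∎)

    RepIso⇒equivariant : (X Y : IrrRep p r) → RepIso p r X Y →
      Σ (V (proj₁ X) → V (proj₁ Y)) λ f → Σ (V (proj₁ Y) → V (proj₁ X)) λ g →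
      Additive f × Additive g × (∀ x → g (f x) ≡ x) × (∀ y → f (g y) ≡ y) ×
      Equivariant (Irr.rep (irrOf X)) (Irr.rep (irrOf Y)) f
    RepIso⇒equivariant (d , ψ , _) (d′ , ψ′ , _) (A , B , AB , BA , A-act) =
      matVec p A , matVec p B , matVec-⊕ A , matVec-⊕ B ,
      (λ x → trans (sym (matVec-matMul B A x)) (trans (cong (λ M → matVec p M x) BA) (matVec-idMat x))) ,
      (λ x → trans (sym (matVec-matMul A B x)) (trans (cong (λ M → matVec p M x) AB) (matVec-idMat x))) ,
      λ h x → trans (sym (matVec-matMul A (ψ h) x)) (trans (cong (λ M → matVec p M x) (A-act h)) (matVec-matMul (ψ′ h) A x))

  schur⇒RepIso : (X Y : IrrRep p r) (f : V (proj₁ X) → V (proj₁ Y)) → Additive f →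
    Equivariant (Irr.rep (irrOf X)) (Irr.rep (irrOf Y)) f → (∃ λ v → f v ≢ 𝟘) → RepIso p r X Y
  schur⇒RepIso X Y f f-⊕ f-act (v , fv≢𝟘) = equivariant⇒RepIso X Y f (proj₁ ∘ surjective) f-⊕ inverse-⊕
    (λ x → injective _ _ (proj₂ (surjective (f x)))) (proj₂ ∘ surjective) f-act
    where open Schur (irrOf X) (irrOf Y) f f-⊕ f-act v fv≢𝟘

  RepIso-refl : ∀ {X} → RepIso p r X X
  RepIso-refl {X} = equivariant⇒RepIso X X id id (λ _ _ → refl) (λ _ _ → refl) (λ _ → refl) (λ _ → refl) (λ _ _ → refl)

  RepIso-sym : ∀ {X Y} → RepIso p r X Y → RepIso p r Y X
  RepIso-sym {X} {Y} i with RepIso⇒equivariant X Y i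
  ... | f , g , f-⊕ , g-⊕ , gf , fg , f-act = equivariant⇒RepIso Y X g f g-⊕ f-⊕ fg gf λ h y → begin
      g (MY.act h y)  ≡⟨ cong (g ∘ MY.act h) (fg y) ⟨
      g (MY.act h (f (g y)))  ≡⟨ cong g (f-act h (g y)) ⟨
      g (f (MX.act h (g y)))  ≡⟨ gf _ ⟩
      MX.act h (g y)  ∎
    where
    module MX = Irr (irrOf X)
    module MY = Irr (irrOf Y)

  RepIso-trans : ∀ {X Y Z} → RepIso p r X Y → RepIso p r Y Z → RepIso p r X Z
  RepIso-trans {X} {Y} {Z} i j with RepIso⇒equivariant X Y i | RepIso⇒equivariant Y Z j
  ... | f , f⁻ , f-⊕ , f⁻-⊕ , f⁻f , ff⁻ , f-act | g , g⁻ , g-⊕ , g⁻-⊕ , g⁻g , gg⁻ , g-act =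
    equivariant⇒RepIso X Z (g ∘ f) (f⁻ ∘ g⁻)
      (λ x y → trans (cong g (f-⊕ x y)) (g-⊕ _ _)) (λ x y → trans (cong f⁻ (g⁻-⊕ x y)) (f⁻-⊕ _ _))
      (λ x → trans (cong f⁻ (g⁻g (f x))) (f⁻f x)) (λ x → trans (cong g (ff⁻ (g⁻ x))) (gg⁻ x))
      (λ h x → trans (cong g (f-act h x)) (g-act h (f x)))

  pointwise⇒irreducible : ∀ {d} (ψ ψ′ : Dih r → Mat p d d) → (∀ g → ψ g ≡ ψ′ g) →
    IsIrreducible p r d ψ → IsIrreducible p r d ψ′
  pointwise⇒irreducible ψ ψ′ eq (1≤d , (hom , one) , noW) =
    1≤d ,
    ((λ g h → trans (sym (eq _)) (trans (hom g h) (cong₂ (matMul p) (eq g) (eq h)))) , trans (sym (eq _)) one) ,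
    λ { (W , (W0 , W+ , W∙ , Wψ) , rest) →
      noW (W , (W0 , W+ , W∙ , λ g v Wv → subst (λ M → W (matVec p M v)) (sym (eq g)) (Wψ g v Wv)) , rest) }

  pointwise⇒RepIso : ∀ {d} (ψ ψ′ : Dih r → Mat p d d) irr irr′ → (∀ g x → matVec p (ψ g) x ≡ matVec p (ψ′ g) x) →
    RepIso p r (d , ψ , irr) (d , ψ′ , irr′)
  pointwise⇒RepIso ψ ψ′ irr irr′ eq = equivariant⇒RepIso (_ , ψ , irr) (_ , ψ′ , irr′) id id
    (λ _ _ → refl) (λ _ _ → refl) (λ _ → refl) (λ _ → refl)
    (λ g x → trans (act-toRep ψ _ g x) (trans (eq g x) (sym (act-toRep ψ′ _ g x))))

  _≟M_ : ∀ {m n} (M N : Mat p m n) → Dec (M ≡ N)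
  _≟M_ = ≡-dec (≡-dec F._≟_)

  mat↔ : ∀ m n → Mat p m n ↔ Fin ((p ℕ.^ n) ℕ.^ m)
  mat↔ m n = vecOf↔ (vec↔ p n) m

  RepIso? : ∀ X Y → Dec (RepIso p r X Y)
  RepIso? (d , ψ , _) (d′ , ψ′ , _) = search (mat↔ d′ d) λ A → search (mat↔ d d′) λ B →
    (matMul p A B ≟M idMat p d′) ×-dec (matMul p B A ≟M idMat p d) ×-dec
    searchAll (dih↔ r) (λ g → matMul p A (ψ g) ≟M matMul p (ψ′ g) A)

  -- Invariant subspaces cannot be searched, but vectors and coefficients range over finite sets;
  -- hence the detour through the orbit criterion.
  irreducible? : ∀ {d} (ψ : Dih r → Mat p d d) → Dec (IsIrreducible p r d ψ)
  irreducible? {d} ψ = map′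
    (λ { (1≤d , ψ-rep , cyc) → cyclic⇒irreducible ψ ψ-rep 1≤d cyc })
    (λ irr → proj₁ irr , proj₁ (proj₂ irr) , irreducible⇒cyclic ψ irr)
    ((1 ℕ.≤? d)
     ×-dec (searchAll (dih↔ r) (λ g → searchAll (dih↔ r) λ h → ψ (dihMul r g h) ≟M matMul p (ψ g) (ψ h))
            ×-dec (ψ (dihOne r) ≟M idMat p d))
     ×-dec searchAll (vec↔ p d) λ v → ¬? (v ≟V 𝟘) →-dec searchAll (vec↔ p d) (InSpan? (ψorbit ψ v) (r ℕ.* 2)))

  -- Coefficients with respect to the orbit of a nonzero vector inject V into the vectors of length
  -- 2r. This bound makes the search for irreducibles finite.
  irr-dim : (X : IrrRep p r) → proj₁ X ≤ r ℕ.* 2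
  irr-dim X = vec-dim-≤ 1<p (λ u → proj₁ (cyclic v v≢𝟘 u))
    (λ x y eq → trans (sym (proj₂ (cyclic v v≢𝟘 x))) (trans (cong (sp (orbit v) (r ℕ.* 2)) eq) (proj₂ (cyclic v v≢𝟘 y))))
    where
    open Irr (irrOf X)
    v = proj₁ nontrivial
    v≢𝟘 = proj₂ nontrivial

  -- Finite tables stand in for functions on D in the search. A function and its table agree only
  -- pointwise, which is why irreducibility and isomorphism are carried along pointwise equality.
  tableRep : ∀ {d} → Vec (Mat p d d) (r ℕ.* 2) → Dih r → Mat p d d
  tableRep t g = lookup t (Inverse.to (dih↔ r) g)

  tableOf : ∀ {d} → (Dih r → Mat p d d) → Vec (Mat p d d) (r ℕ.* 2)
  tableOf ψ = tabulate (ψ ∘ Inverse.from (dih↔ r))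

  tableRep-tableOf : ∀ {d} (ψ : Dih r → Mat p d d) g → tableRep (tableOf ψ) g ≡ ψ g
  tableRep-tableOf ψ g = trans (lookup∘tabulate (ψ ∘ Inverse.from (dih↔ r)) (Inverse.to (dih↔ r) g)) (cong ψ (from-to (dih↔ r) g))

  collect : ∀ {a} {A : Set a} k (c : Fin k → Maybe A) → Σ (List A) λ xs → ∀ i x → c i ≡ just x → Any (x ≡_) xs
  collect zero c = List.[] , λ ()
  collect (suc k) c with collect k (c ∘ suc) | c zero in eq
  ... | xs , cov | nothing = xs , λ { zero x q → contradiction (trans (sym eq) q) λ () ; (suc i) x q → cov i x q }
  ... | xs , cov | just y = y List.∷ xs , λ { zero x q → here (sym (just-injective (trans (sym eq) q))) ; (suc i) x q → there (cov i x q) }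

  opaque
    -- Every table of 2r matrices is tested. The list may repeat isomorphic representations;
    -- `representatives` prunes it in `irr-count`.
    irrOfDim : ∀ d → Σ (List (IrrRep p r)) λ Xs → ∀ X → proj₁ X ≡ d → Any (RepIso p r X) Xs
    irrOfDim d = proj₁ collected , λ { (.d , ψ , irr) refl → covered ψ irr }
      where
      K : ℕ
      K = ((p ℕ.^ d) ℕ.^ d) ℕ.^ (r ℕ.* 2)
      table↔ : Vec (Mat p d d) (r ℕ.* 2) ↔ Fin K
      table↔ = vecOf↔ (mat↔ d d) (r ℕ.* 2)
      candidate : (ψ : Dih r → Mat p d d) → Dec (IsIrreducible p r d ψ) → Maybe (IrrRep p r)
      candidate ψ (yes irr) = just (d , ψ , irr)
      candidate ψ (no _) = nothing
      candidates : Fin K → Maybe (IrrRep p r)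
      candidates i = let ψ = tableRep (Inverse.from table↔ i) in candidate ψ (irreducible? ψ)
      collected : Σ (List (IrrRep p r)) λ Xs → ∀ i X → candidates i ≡ just X → Any (X ≡_) Xs
      collected = collect K candidates
      table-eq : ∀ ψ g → tableRep (Inverse.from table↔ (Inverse.to table↔ (tableOf ψ))) g ≡ ψ g
      table-eq ψ g = trans (cong (λ t → tableRep t g) (from-to table↔ (tableOf ψ))) (tableRep-tableOf ψ g)
      covered : ∀ ψ irr → Any (RepIso p r (d , ψ , irr)) (proj₁ collected)
      covered ψ irr with irreducible? (tableRep (Inverse.from table↔ (Inverse.to table↔ (tableOf ψ)))) in eq
      ... | yes irr′ = Any.map (λ { refl → pointwise⇒RepIso ψ _ irr irr′ (λ g x → cong (λ M → matVec p M x) (sym (table-eq ψ g))) })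
                         (proj₂ collected (Inverse.to table↔ (tableOf ψ)) _ (cong (candidate _) eq))
      ... | no ¬irr = contradiction (pointwise⇒irreducible ψ _ (sym ∘ table-eq ψ) irr) ¬irr

  irrUpToDim : ∀ m → Σ (List (IrrRep p r)) λ Xs → ∀ X → proj₁ X < m → Any (RepIso p r X) Xs
  irrUpToDim zero = List.[] , λ _ ()
  irrUpToDim (suc m) = proj₁ (irrOfDim m) ++ proj₁ (irrUpToDim m) , cov
    where
    cov : ∀ X → proj₁ X < suc m → Any (RepIso p r X) (proj₁ (irrOfDim m) ++ proj₁ (irrUpToDim m))
    cov X (s≤s d≤m) with ℕ.m≤n⇒m<n∨m≡n d≤m
    ... | inj₁ d<m = ++⁺ʳ (proj₁ (irrOfDim m)) (proj₂ (irrUpToDim m) X d<m)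
    ... | inj₂ d≡m = ++⁺ˡ (proj₂ (irrOfDim m) X d≡m)

  irr-count : Σ ℕ λ N → HasCount (IrrRep p r) (RepIso p r) N
  irr-count =
    let Xs , cov = irrUpToDim (suc (r ℕ.* 2))
        N , f , inj , sur = representatives (RepIso p r) (λ {X} → RepIso-refl {X}) (λ {X} {Y} → RepIso-sym {X} {Y}) RepIso? _ (List.lookup Xs)
    in N , f , inj , λ X →
      let any = cov X (s≤s (irr-dim X))
          j , q = sur (Any.index any)
      in j , RepIso-trans {X} {List.lookup Xs (Any.index any)} {f j} (lookup-index any) q

-- Vectors adapted to the generators τ and β

module Vectors (p r : ℕ) .{{_ : NonZero p}} .{{_ : NonZero r}} (prime : Prime p) (p≢2 : p ≢ 2) where

  open Reps p r prime public
  open Odd p≢2 public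
  open ≡-Reasoning

  module Marked {d} (M : Irr d) where
    open Irr M

    Sign : Set
    Sign = ∀ x → act τ x ≡ ⊖ x × act β x ≡ ⊖ x

    Exceptional : Set
    Exceptional = ∀ x → act τ x ≡ ⊖ x × act β x ≡ x

    Adapted : V d → Set
    Adapted v = act τ v ≡ v ⊎ Sign

    Good : V d → Set
    Good v = v ≢ 𝟘 × Adapted v

    involutive : ∀ i x → act (i , true) (act (i , true) x) ≡ x
    involutive i x = trans (sym (act-· _ _ x)) (trans (cong (λ g → act g x) (ref² i)) (act-e x))

    Fixes : Dih r → V d → Set
    Fixes g x = x ≢ 𝟘 × act g x ≡ x

    fixes? : ∀ g → Dec (∃ (Fixes g))
    fixes? g = search (vec↔ p d) λ x → ¬? (x ≟V 𝟘) ×-dec (act g x ≟V x)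

    -- For a reflection g the vector gx + x is fixed by g, so it vanishes when g has no nonzero
    -- fixed vector.
    fixedPointFree⇒minus : ∀ i → ¬ ∃ (Fixes (i , true)) → ∀ x → act (i , true) x ≡ ⊖ x
    fixedPointFree⇒minus i none x = ⊖-uniqueˡ _ _ (decidable-stable ((act (i , true) x ⊕ x) ≟V 𝟘) λ y≢𝟘 →
      none (act (i , true) x ⊕ x , y≢𝟘 ,
        trans (act-⊕ _ _ x) (trans (cong (_⊕ act (i , true) x) (involutive i x)) (⊕-comm _ _))))

    ρ-def : ∀ x → act ρ x ≡ act τ (act β x)
    ρ-def x = trans (cong (λ g → act g x) (sym τβ)) (act-· τ β x)

    module _ {x : V d} (x≢𝟘 : x ≢ 𝟘) where

      -- Every element of D multiplies `x` by ±1, because both generators do. The two eigenvector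
      -- equations therefore hold on the whole orbit of `x`, and the orbit spans.
      τ-minus-β-fixed⇒exceptional : act τ x ≡ ⊖ x → act β x ≡ x → Exceptional
      τ-minus-β-fixed⇒exceptional τx βx u =
        cyclic-induction x x≢𝟘 (λ u → act τ u ≡ ⊖ u) (trans (act-𝟘 τ) (sym ⊖𝟘))
          (λ a b p q → trans (act-⊕ τ a b) (trans (cong₂ _⊕_ p q) (solve (a ∷ b ∷ []) ((:⊖ x₀) :+ (:⊖ x₁)) (:⊖ (x₀ :+ x₁)) refl)))
          (λ g → on± τ g ⊖_ τx (trans (act-⊖ τ x) (cong ⊖_ τx))) u ,
        cyclic-induction x x≢𝟘 (λ u → act β u ≡ u) (act-𝟘 β)
          (λ a b p q → trans (act-⊕ β a b) (cong₂ _⊕_ p q))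
          (λ g → on± β g id βx (trans (act-⊖ β x) (cong ⊖_ βx))) u
        where
        ± : ∀ g → act g x ≡ x ⊎ act g x ≡ ⊖ x
        ± = dih-induction (λ g → act g x ≡ x ⊎ act g x ≡ ⊖ x) (inj₂ τx) (inj₁ βx) λ
          { g h (inj₁ p) (inj₁ q) → inj₁ (trans (act-· g h x) (trans (cong (act g) q) p))
          ; g h (inj₂ p) (inj₁ q) → inj₂ (trans (act-· g h x) (trans (cong (act g) q) p))
          ; g h (inj₁ p) (inj₂ q) → inj₂ (trans (act-· g h x) (trans (cong (act g) q) (trans (act-⊖ g x) (cong ⊖_ p))))
          ; g h (inj₂ p) (inj₂ q) → inj₁ (trans (act-· g h x) (trans (cong (act g) q) (trans (act-⊖ g x) (trans (cong ⊖_ p) (⊖-involutive x))))) }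
        on± : ∀ h g (s : V d → V d) → act h x ≡ s x → act h (⊖ x) ≡ s (⊖ x) → act h (act g x) ≡ s (act g x)
        on± h g s p q with ± g
        ... | inj₁ eq = trans (cong (act h) eq) (trans p (cong s (sym eq)))
        ... | inj₂ eq = trans (cong (act h) eq) (trans q (cong s (sym eq)))

      τβ-fixed⇒trivial : act τ x ≡ x → act β x ≡ x → ∀ g u → act g u ≡ u
      τβ-fixed⇒trivial τx βx g = cyclic-induction x x≢𝟘 (λ u → act g u ≡ u) (act-𝟘 g)
          (λ a b p q → trans (act-⊕ g a b) (cong₂ _⊕_ p q))
          (λ h → trans (sym (act-· g h x)) (trans (fixed (g · h)) (sym (fixed h))))
        where
        fixed : ∀ g → act g x ≡ x
        fixed = dih-induction (λ g → act g x ≡ x) τx βx (λ g h p q → trans (act-· g h x) (trans (cong (act g) q) p))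

      -- The fixed vectors of ρ are stable under D: rotations commute with ρ, and a reflection g
      -- satisfies ρgρ = g, whence ρ(gx) = ρgρx = gx.
      ρ-fixed⇒ρ-trivial : act ρ x ≡ x → ∀ u → act ρ u ≡ u
      ρ-fixed⇒ρ-trivial ρx = cyclic-induction x x≢𝟘 (λ u → act ρ u ≡ u) (act-𝟘 ρ)
          (λ a b p q → trans (act-⊕ ρ a b) (cong₂ _⊕_ p q))
          λ { (i , false) → begin
                act ρ (act (i , false) x)  ≡⟨ act-· _ _ x ⟨
                act (ρ · (i , false)) x  ≡⟨ cong (λ g → act g x) (trans (rot· _ _ _) (trans (cong (_, false) (+-comm _ _)) (sym (rot· _ _ _)))) ⟩
                act ((i , false) · ρ) x  ≡⟨ act-· _ _ x ⟩
                act (i , false) (act ρ x)  ≡⟨ cong (act (i , false)) ρx ⟩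
                act (i , false) x  ∎
            ; (i , true) → begin
                act ρ (act (i , true) x)  ≡⟨ cong (act ρ ∘ act (i , true)) ρx ⟨
                act ρ (act (i , true) (act ρ x))  ≡⟨ trans (cong (act ρ) (sym (act-· _ _ x))) (sym (act-· _ _ x)) ⟩
                act (ρ · ((i , true) · ρ)) x  ≡⟨ cong (λ g → act g x) (trans (cong (ρ ·_) (ref· _ _ _)) (trans (rot· _ _ _)
                                                       (cong (_, true) (solveᵣ (1# ∷ i ∷ []) (x₀ᵣ :+ᵣ (x₁ᵣ :-ᵣ x₀ᵣ)) x₁ᵣ refl)))) ⟩
                act (i , true) x  ∎ }

    ⊖-⊕ : Additive {d} ⊖_
    ⊖-⊕ x y = solve (x ∷ y ∷ []) (:⊖ (x₀ :+ x₁)) ((:⊖ x₀) :+ (:⊖ x₁)) refl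

    good⊎exceptional : ∃ Good ⊎ Exceptional
    good⊎exceptional with fixes? τ
    ... | yes (v , v≢𝟘 , τv) = inj₁ (v , v≢𝟘 , inj₁ τv)
    ... | no ¬τ with fixes? β
    ...   | yes (x , x≢𝟘 , βx) = inj₂ (τ-minus-β-fixed⇒exceptional x≢𝟘 (fixedPointFree⇒minus _ ¬τ x) βx)
    ...   | no ¬β = inj₁ (proj₁ nontrivial , proj₂ nontrivial , inj₂ λ x → fixedPointFree⇒minus _ ¬τ x , fixedPointFree⇒minus _ ¬β x)

    minus-fixed⇒𝟘 : (x : V d) → x ≡ ⊖ x → x ≡ 𝟘
    minus-fixed⇒𝟘 x eq = double-cancel x (trans (cong (x ⊕_) eq) (⊖-inverseʳ x))

    good⇒¬exceptional : ∀ v → Good v → ¬ Exceptional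
    good⇒¬exceptional v (v≢𝟘 , inj₁ τv) exc = v≢𝟘 (minus-fixed⇒𝟘 v (trans (sym τv) (proj₁ (exc v))))
    good⇒¬exceptional v (v≢𝟘 , inj₂ sgn) exc = v≢𝟘 (minus-fixed⇒𝟘 v (trans (sym (proj₂ (exc v))) (proj₂ (sgn v))))

    -- The centraliser of the action is transitive on the good vectors: if v and v′ are both τ-fixed (or both negated)
    -- and v′ = Σ cᵢ ρⁱ v, then 2 v′ = Σ cᵢ (ρⁱ + ρ⁻ⁱ) v, where ρⁱ + ρ⁻ⁱ commutes with the whole group.
    module Centraliser (v : V d) (v≢𝟘 : v ≢ 𝟘) (s : V d → V d) (s-⊕ : Additive s) (s-act : ∀ g x → s (act g x) ≡ act g (s x))
                       (s-s : ∀ x → s (s x) ≡ x) (τv : act τ v ≡ s v) where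

      -- The map `s` ∘ τ fixes `v` and sends ρⁱ`v` to ρ⁻ⁱ`v`, so the target is the symmetrisation of
      -- `u`. If τ`u` = `s` `u` it is 2`u`, and halving gives `transitive`.
      Reached : V d → Set
      Reached u = Σ (V d → V d) λ θ → Additive θ × Equivariant rep rep θ × θ v ≡ u ⊕ s (act τ u)

      θ-rot : Fin r → V d → V d
      θ-rot i x = act (i , false) x ⊕ act (- i , false) x

      θ-rot-⊕ : ∀ i → Additive (θ-rot i)
      θ-rot-⊕ i x y = trans (cong₂ _⊕_ (act-⊕ _ x y) (act-⊕ _ x y))
        (solve (act (i , false) x ∷ act (i , false) y ∷ act (- i , false) x ∷ act (- i , false) y ∷ [])
          ((x₀ :+ x₁) :+ (x₂ :+ x₃)) ((x₀ :+ x₂) :+ (x₁ :+ x₃)) refl)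

      commute : ∀ g h g′ h′ x → g · h ≡ g′ · h′ → act g (act h x) ≡ act g′ (act h′ x)
      commute g h g′ h′ x eq = trans (sym (act-· g h x)) (trans (cong (λ k → act k x) eq) (act-· g′ h′ x))

      θ-rot-act : ∀ i → Equivariant rep rep (θ-rot i)
      θ-rot-act i (j , false) x = trans (cong₂ _⊕_ (commute _ _ _ _ x (comm i)) (commute _ _ _ _ x (comm (- i)))) (sym (act-⊕ _ _ _))
        where
        comm : ∀ i → (i , false) · (j , false) ≡ (j , false) · (i , false)
        comm i = trans (rot· i j false) (trans (cong (_, false) (+-comm i j)) (sym (rot· j i false)))
      θ-rot-act i (j , true) x = trans (cong₂ _⊕_ (commute _ _ _ _ x (comm i)) (commute _ _ _ _ x comm′)) (trans (⊕-comm _ _) (sym (act-⊕ _ _ _)))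
        where
        comm : ∀ i → (i , false) · (j , true) ≡ (j , true) · (- i , false)
        comm i = trans (rot· i j true) (trans (cong (_, true) (solveᵣ (i ∷ j ∷ []) (x₀ᵣ :+ᵣ x₁ᵣ) (x₁ᵣ :-ᵣ (:⊖ᵣ x₀ᵣ)) refl)) (sym (ref· j (- i) false)))
        comm′ : (- i , false) · (j , true) ≡ (j , true) · (i , false)
        comm′ = trans (rot· (- i) j true) (trans (cong (_, true) (+-comm (- i) j)) (sym (ref· j i false)))

      s-𝟘 : s 𝟘 ≡ 𝟘
      s-𝟘 = additive-𝟘 s-⊕

      reached-rot : ∀ i → Reached (act (i , false) v)
      reached-rot i = θ-rot i , θ-rot-⊕ i , θ-rot-act i , cong (act (i , false) v ⊕_) (sym (begin
        s (act τ (act (i , false) v))  ≡⟨ cong s (commute τ (i , false) (- i , false) τ v eq) ⟩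
        s (act (- i , false) (act τ v))  ≡⟨ cong (s ∘ act (- i , false)) τv ⟩
        s (act (- i , false) (s v))  ≡⟨ cong s (s-act _ v) ⟨
        s (s (act (- i , false) v))  ≡⟨ s-s _ ⟩
        act (- i , false) v  ∎))
        where
        eq : τ · (i , false) ≡ (- i , false) · τ
        eq = trans (ref· _ _ _) (trans (cong (_, true) (+-identityˡ (- i))) (sym (rot·τ _)))

      reached-s : ∀ u → Reached u → Reached (s u)
      reached-s u (θ , θ-⊕ , θ-act , θv) = s ∘ θ , (λ x y → trans (cong s (θ-⊕ x y)) (s-⊕ _ _)) ,
        (λ g x → trans (cong s (θ-act g x)) (s-act g _)) ,
        trans (cong s θv) (trans (s-⊕ _ _) (cong (λ y → s u ⊕ s y) (s-act τ u)))

      reached : ∀ u → Reached u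
      reached = cyclic-induction v v≢𝟘 Reached
        ((λ _ → 𝟘) , (λ _ _ → sym (⊕-identityˡ 𝟘)) , (λ g _ → sym (act-𝟘 g)) ,
          sym (trans (⊕-identityˡ _) (trans (cong s (act-𝟘 τ)) s-𝟘)))
        (λ { a b (θ , θ-⊕ , θ-act , θv) (η , η-⊕ , η-act , ηv) →
          (λ x → θ x ⊕ η x) ,
          (λ x y → trans (cong₂ _⊕_ (θ-⊕ x y) (η-⊕ x y)) (solve (θ x ∷ θ y ∷ η x ∷ η y ∷ [])
            ((x₀ :+ x₁) :+ (x₂ :+ x₃)) ((x₀ :+ x₂) :+ (x₁ :+ x₃)) refl)) ,
          (λ g x → trans (cong₂ _⊕_ (θ-act g x) (η-act g x)) (sym (act-⊕ g _ _))) ,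
          trans (cong₂ _⊕_ θv ηv) (trans (solve (a ∷ s (act τ a) ∷ b ∷ s (act τ b) ∷ [])
            ((x₀ :+ x₁) :+ (x₂ :+ x₃)) ((x₀ :+ x₂) :+ (x₁ :+ x₃)) refl)
            (cong ((a ⊕ b) ⊕_) (sym (trans (cong s (act-⊕ τ a b)) (s-⊕ _ _))))) })
        (λ { (i , false) → reached-rot i
           ; (i , true) → subst Reached (trans (s-act _ v) (trans (cong (act (i , false)) (sym τv)) (trans (sym (act-· _ _ v)) (cong (λ g → act g v) (rot·τ i)))))
                            (reached-s _ (reached-rot i)) })

      transitive : ∀ v′ → act τ v′ ≡ s v′ → Σ (V d → V d) λ θ → Additive θ × Equivariant rep rep θ × θ v ≡ v′
      transitive v′ τv′ with reached v′
      ... | θ , θ-⊕ , θ-act , θv = (λ x → ½ ∙ θ x) ,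
        (λ x y → trans (cong (½ ∙_) (θ-⊕ x y)) (∙-distribˡ ½ _ _)) ,
        (λ g x → trans (cong (½ ∙_) (θ-act g x)) (sym (additive-∙ (act-⊕ g) ½ (θ x)))) ,
        (begin
          ½ ∙ θ v  ≡⟨ cong (½ ∙_) θv ⟩
          ½ ∙ (v′ ⊕ s (act τ v′))  ≡⟨ cong (λ y → ½ ∙ (v′ ⊕ y)) (trans (cong s τv′) (s-s v′)) ⟩
          ½ ∙ (v′ ⊕ v′)  ≡⟨ ∙-distribˡ ½ v′ v′ ⟩
          ½ ∙ v′ ⊕ ½ ∙ v′  ≡⟨ ½-double v′ ⟩
          v′  ∎)

    opaque
      good-transitive : ∀ v v′ → Good v → Good v′ → Σ (V d → V d) λ θ → Additive θ × Equivariant rep rep θ × θ v ≡ v′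
      good-transitive v v′ (v≢𝟘 , av) (_ , av′) with av | av′
      ... | inj₁ τv | inj₁ τv′ = Centraliser.transitive v v≢𝟘 id (λ _ _ → refl) (λ _ _ → refl) (λ _ → refl) τv v′ τv′
      -- `Sign` speaks of the whole representation, so once it holds τ negates both vectors, however
      -- the other one was found to be adapted.
      ... | inj₂ sgn | _ = Centraliser.transitive v v≢𝟘 ⊖_ ⊖-⊕ (λ g x → sym (act-⊖ g x)) ⊖-involutive (proj₁ (sgn v)) v′ (proj₁ (sgn v′))
      ... | inj₁ _ | inj₂ sgn = Centraliser.transitive v v≢𝟘 ⊖_ ⊖-⊕ (λ g x → sym (act-⊖ g x)) ⊖-involutive (proj₁ (sgn v)) v′ (proj₁ (sgn v′))

    v₋ : V d → V d
    v₋ a = ½ ∙ (a ⊝ act τ a)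

    -- The aim is u - τu = `v₋ a` and u - βu = `w` at once. Adding τ of the second equation to the
    -- first gives u - ρu = `v₋ a` + τ`w`, one equation that determines u. Conversely, let `t` and
    -- `s` be the defects of the two equations. They satisfy `t` = -τ`s`, and τ negates `t`, so `s`
    -- = `t`; as β negates `s`, the vector `t` is fixed by ρ and hence zero.
    module FixedPointFreeRotation (1-ρ-kernel : ∀ x → x ⊝ act ρ x ≡ 𝟘 → x ≡ 𝟘) (a w u : V d) (βw : act β w ≡ ⊖ w)
                                  (u-eq : u ⊝ act ρ u ≡ v₋ a ⊕ act τ w) where
      s t : V d
      t = u ⊝ act τ u ⊝ v₋ a
      s = u ⊝ act β u ⊝ w

      τv₋ : act τ (v₋ a) ≡ ⊖ v₋ a
      τv₋ = begin
        act τ (½ ∙ (a ⊝ act τ a))  ≡⟨ additive-∙ (act-⊕ τ) ½ _ ⟩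
        ½ ∙ act τ (a ⊝ act τ a)  ≡⟨ cong (½ ∙_) (trans (act-⊝ τ a (act τ a)) (cong (act τ a ⊝_) (involutive _ a))) ⟩
        ½ ∙ (act τ a ⊝ a)  ≡⟨ cong (½ ∙_) (solve (act τ a ∷ a ∷ []) (x₀ :- x₁) (:⊖ (x₁ :- x₀)) refl) ⟩
        ½ ∙ (⊖ (a ⊝ act τ a))  ≡⟨ ∙-⊖ ½ _ ⟩
        ⊖ v₋ a  ∎
      minus : ∀ i c → act (i , true) c ≡ ⊖ c → act (i , true) (u ⊝ act (i , true) u ⊝ c) ≡ ⊖ (u ⊝ act (i , true) u ⊝ c)
      minus i c eq = begin
        act g (u ⊝ act g u ⊝ c)  ≡⟨ act-⊝ g _ c ⟩
        act g (u ⊝ act g u) ⊝ act g c  ≡⟨ cong₂ _⊝_ (trans (act-⊝ g u _) (cong (act g u ⊝_) (involutive i u))) eq ⟩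
        act g u ⊝ u ⊝ (⊖ c)  ≡⟨ solve (u ∷ act g u ∷ c ∷ []) (x₁ :- x₀ :- (:⊖ x₂)) (:⊖ (x₀ :- x₁ :- x₂)) refl ⟩
        ⊖ (u ⊝ act g u ⊝ c)  ∎
        where g = (i , true)
      t+τs : t ⊕ act τ s ≡ 𝟘
      t+τs = begin
        t ⊕ act τ s  ≡⟨ cong (t ⊕_) (trans (act-⊝ τ _ w) (cong (_⊝ act τ w) (act-⊝ τ u _))) ⟩
        t ⊕ (act τ u ⊝ act τ (act β u) ⊝ act τ w)  ≡⟨ solve (u ∷ act τ u ∷ v₋ a ∷ act τ (act β u) ∷ act τ w ∷ [])
                                                                       ((x₀ :- x₁ :- x₂) :+ (x₁ :- x₃ :- x₄)) ((x₀ :- x₃) :- (x₂ :+ x₄)) refl ⟩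
        (u ⊝ act τ (act β u)) ⊝ (v₋ a ⊕ act τ w)  ≡⟨ cong (λ c → (u ⊝ c) ⊝ (v₋ a ⊕ act τ w)) (sym (ρ-def u)) ⟩
        (u ⊝ act ρ u) ⊝ (v₋ a ⊕ act τ w)  ≡⟨ cong (_⊝ (v₋ a ⊕ act τ w)) (u-eq) ⟩
        (v₋ a ⊕ act τ w) ⊝ (v₋ a ⊕ act τ w)  ≡⟨ ⊖-inverseʳ _ ⟩
        𝟘  ∎
      t≡ : t ≡ ⊖ act τ s
      t≡ = ⊖-uniqueˡ _ _ t+τs
      s≡t : s ≡ t
      s≡t = ⊖-injective (begin
        ⊖ s  ≡⟨ cong ⊖_ (involutive _ s) ⟨
        ⊖ act τ (act τ s)  ≡⟨ act-⊖ τ _ ⟨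
        act τ (⊖ act τ s)  ≡⟨ cong (act τ) t≡ ⟨
        act τ t  ≡⟨ minus _ (v₋ a) τv₋ ⟩
        ⊖ t  ∎)
      t≡𝟘 : t ≡ 𝟘
      t≡𝟘 = 1-ρ-kernel t (trans (cong (t ⊝_) (begin
        act ρ t  ≡⟨ ρ-def t ⟩
        act τ (act β t)  ≡⟨ cong (act τ ∘ act β) s≡t ⟨
        act τ (act β s)  ≡⟨ cong (act τ) (minus _ w βw) ⟩
        act τ (⊖ s)  ≡⟨ act-⊖ τ s ⟩
        ⊖ act τ s  ≡⟨ t≡ ⟨
        t  ∎)) (⊖-inverseʳ t))
      v₊ : a ⊝ (u ⊝ act τ u) ≡ a ⊝ v₋ a
      v₊ = cong (a ⊝_) (⊝≡𝟘⇒≡ _ _ t≡𝟘)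
      τv₊ : act τ (a ⊝ v₋ a) ≡ a ⊝ v₋ a
      τv₊ = begin
        act τ (a ⊝ v₋ a)  ≡⟨ trans (act-⊝ τ a (v₋ a)) (cong (act τ a ⊝_) τv₋) ⟩
        act τ a ⊝ (⊖ v₋ a)  ≡⟨ solve (act τ a ∷ v₋ a ∷ []) (x₀ :- (:⊖ x₁)) (x₀ :+ (x₁ :+ x₁) :- x₁) refl ⟩
        act τ a ⊕ (v₋ a ⊕ v₋ a) ⊝ v₋ a  ≡⟨ cong (λ c → act τ a ⊕ c ⊝ v₋ a) (½-double _) ⟩
        act τ a ⊕ (a ⊝ act τ a) ⊝ v₋ a  ≡⟨ solve (act τ a ∷ a ∷ v₋ a ∷ []) (x₀ :+ (x₁ :- x₀) :- x₂) (x₁ :- x₂) refl ⟩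
        a ⊝ v₋ a  ∎

    -- Conjugating by u moves the involution (w , β) into the complement {𝟘} × D and (a , τ) to (v , τ) with v adapted.
    straighten : ∀ a w → act β w ≡ ⊖ w → Σ (V d) λ u → u ⊝ act β u ≡ w × Adapted (a ⊝ (u ⊝ act τ u))
    straighten a w βw with fixes? ρ
    -- A vector fixed by ρ makes ρ act trivially, so τ and β act alike. If τ fixes a nonzero vector,
    -- the whole action is trivial, `w` = -`w` vanishes and u = 0 serves; otherwise both act as -1
    -- and u is half of `w`.
    ... | yes (x , x≢𝟘 , ρx) with fixes? τ
    ...   | yes (y , y≢𝟘 , τy) = 𝟘 , trans (cong (𝟘 ⊝_) (act-𝟘 β)) (trans (⊖-inverseʳ 𝟘) (sym (minus-fixed⇒𝟘 w (trans (sym (trivial β w)) βw)))) , inj₁ (trivial τ _)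
      where
      trivial : ∀ g u → act g u ≡ u
      trivial = τβ-fixed⇒trivial y≢𝟘 τy (trans (sym (involutive _ _)) (trans (cong (act τ) (trans (sym (ρ-def y)) (ρ-fixed⇒ρ-trivial x≢𝟘 ρx y))) τy))
    ...   | no ¬τ = ½ ∙ w , trans (cong (½ ∙ w ⊝_) (β≡⊖ (½ ∙ w))) (trans (cong (½ ∙ w ⊕_) (⊖-involutive _)) (½-double w)) ,
                    inj₂ (λ x → τ≡⊖ x , β≡⊖ x)
      where
      τ≡⊖ : ∀ x → act τ x ≡ ⊖ x
      τ≡⊖ = fixedPointFree⇒minus _ ¬τ
      β≡⊖ : ∀ x → act β x ≡ ⊖ x
      β≡⊖ y = trans (sym (involutive _ _)) (trans (cong (act τ) (trans (sym (ρ-def y)) (ρ-fixed⇒ρ-trivial x≢𝟘 ρx y))) (τ≡⊖ y))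
    straighten a w βw | no ¬ρ = u , ⊝≡𝟘⇒≡ _ _ (trans s≡t t≡𝟘) , inj₁ (trans (cong (act τ) v₊) (trans τv₊ (sym v₊)))
      where
      1-ρ : V d → V d
      1-ρ x = x ⊝ act ρ x
      1-ρ-⊕ : Additive 1-ρ
      1-ρ-⊕ x y = trans (cong ((x ⊕ y) ⊝_) (act-⊕ ρ x y)) (solve (x ∷ y ∷ act ρ x ∷ act ρ y ∷ []) ((x₀ :+ x₁) :- (x₂ :+ x₃)) ((x₀ :- x₂) :+ (x₁ :- x₃)) refl)
      1-ρ-kernel : ∀ x → 1-ρ x ≡ 𝟘 → x ≡ 𝟘
      1-ρ-kernel x eq = decidable-stable (x ≟V 𝟘) λ x≢𝟘 → ¬ρ (x , x≢𝟘 , sym (⊝≡𝟘⇒≡ _ _ eq))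
      solution : ∃ λ u → 1-ρ u ≡ v₋ a ⊕ act τ w
      solution = injective⇒surjective (vec↔ p d) 1-ρ (additive-injective 1-ρ-⊕ 1-ρ-kernel) (v₋ a ⊕ act τ w)
      u : V d
      u = proj₁ solution
      open FixedPointFreeRotation 1-ρ-kernel a w u βw (proj₂ solution)

-- Cayley maps and the group V ⋊ D

module GroupMap {G : Set} (_⋆_ : G → G → G) (ε : G) (inv : G → G) (isGroup : IsGroup _≡_ _⋆_ ε inv) where

  open IsGroup isGroup using (assoc; identityˡ; identityʳ; inverseˡ; inverseʳ)
  group : Group 0ℓ 0ℓ
  group = record { isGroup = isGroup }

  open Algebra.Properties.Group group using (∙-cancelˡ; ∙-cancelʳ; identityʳ-unique)
  open ≡-Reasoning

  pow : G → ℕ → G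
  pow a zero = ε
  pow a (suc k) = pow a k ⋆ a

  -- Positive words that grow on the right: appending a letter is a right multiplication, which in
  -- the Cayley map is one step of `Reach`.
  data Generated (a b : G) : G → Set where
    one : Generated a b ε
    _▸a : ∀ {g} → Generated a b g → Generated a b (g ⋆ a)
    _▸b : ∀ {g} → Generated a b g → Generated a b (g ⋆ b)

  module _ {a b : G} where

    generated-a : Generated a b a
    generated-a = subst (Generated a b) (identityˡ a) (one ▸a)

    generated-b : Generated a b b
    generated-b = subst (Generated a b) (identityˡ b) (one ▸b)

    generated-⋆ : ∀ {g h} → Generated a b g → Generated a b h → Generated a b (g ⋆ h)
    generated-⋆ {g} p one = subst (Generated a b) (sym (identityʳ g)) p
    generated-⋆ {g} p (q ▸a) = subst (Generated a b) (assoc g _ a) (generated-⋆ p q ▸a)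
    generated-⋆ {g} p (q ▸b) = subst (Generated a b) (assoc g _ b) (generated-⋆ p q ▸b)

    generated-pow : ∀ {g} → Generated a b g → ∀ k → Generated a b (pow g k)
    generated-pow p zero = one
    generated-pow p (suc k) = generated-⋆ (generated-pow p k) p

  module CayleyMap {n : ℕ} (code : G ↔ Fin n) (a b : G) (generates : ∀ g → Generated a b g) where

    enc : G → Fin n
    enc = Inverse.to code

    dec : Fin n → G
    dec = Inverse.from code

    dec-enc : ∀ g → dec (enc g) ≡ g
    dec-enc = from-to code

    enc-dec : ∀ x → enc (dec x) ≡ x
    enc-dec = to-from code

    rightMul : G → Permutation′ n
    rightMul g = permutation (λ x → enc (dec x ⋆ g)) (λ x → enc (dec x ⋆ inv g))
      (λ x → undo (inv g) g (inverseˡ g) x) (λ x → undo g (inv g) (inverseʳ g) x)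
      where
      undo : ∀ g h → g ⋆ h ≡ ε → ∀ x → enc (dec (enc (dec x ⋆ g)) ⋆ h) ≡ x
      undo g h gh x = begin
        enc (dec (enc (dec x ⋆ g)) ⋆ h)  ≡⟨ cong (λ k → enc (k ⋆ h)) (dec-enc _) ⟩
        enc ((dec x ⋆ g) ⋆ h)  ≡⟨ cong enc (trans (assoc _ g h) (trans (cong (dec x ⋆_) gh) (identityʳ _))) ⟩
        enc (dec x)  ≡⟨ enc-dec x ⟩
        x  ∎

    R L : Permutation′ n
    R = rightMul a
    L = rightMul b

    rightMul-enc : ∀ g h → rightMul g ⟨$⟩ʳ enc h ≡ enc (h ⋆ g)
    rightMul-enc g h = cong (λ k → enc (k ⋆ g)) (dec-enc h)

    reach-enc : ∀ x {g} → Generated a b g → Reach R L x (enc (dec x ⋆ g))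
    reach-enc x one = subst (Reach R L x) (sym (trans (cong enc (identityʳ _)) (enc-dec x))) here
    reach-enc x (q ▸a) = subst (Reach R L x) (trans (rightMul-enc a _) (cong enc (assoc _ _ a))) (stepR (reach-enc x q))
    reach-enc x (q ▸b) = subst (Reach R L x) (trans (rightMul-enc b _) (cong enc (assoc _ _ b))) (stepL (reach-enc x q))

    isMap : b ⋆ b ≡ ε → b ≢ ε → IsMap n R L
    isMap bb b≢ε =
      (λ x → begin
        enc (dec (enc (dec x ⋆ b)) ⋆ b)  ≡⟨ rightMul-enc b _ ⟩
        enc ((dec x ⋆ b) ⋆ b)  ≡⟨ cong enc (trans (assoc _ b b) (trans (cong (dec x ⋆_) bb) (identityʳ _))) ⟩
        enc (dec x)  ≡⟨ enc-dec x ⟩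
        x  ∎) ,
      (λ x eq → b≢ε (identityʳ-unique (dec x) b (trans (sym (dec-enc _)) (cong dec eq)))) ,
      λ x y → subst (Reach R L x)
        (trans (cong enc (trans (sym (assoc _ _ _)) (trans (cong (_⋆ dec y) (inverseʳ (dec x))) (identityˡ _)))) (enc-dec y))
        (reach-enc x (generates (inv (dec x) ⋆ dec y)))

    leftMul : G → Fin n → Fin n
    leftMul g x = enc (g ⋆ dec x)

    leftMul-⋆ : ∀ g h x → leftMul (g ⋆ h) x ≡ leftMul g (leftMul h x)
    leftMul-⋆ g h x = cong enc (trans (assoc g h _) (cong (g ⋆_) (sym (dec-enc _))))

    leftMul-isAut : ∀ g → IsAut n R L (leftMul g)
    leftMul-isAut g = commutes a , commutes b , leftMul (inv g) ,
      (λ x → undo (inv g) g (inverseˡ g) x) , (λ x → undo g (inv g) (inverseʳ g) x)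
      where
      commutes : ∀ h x → leftMul g (rightMul h ⟨$⟩ʳ x) ≡ rightMul h ⟨$⟩ʳ leftMul g x
      commutes h x = trans (cong (λ k → enc (g ⋆ k)) (dec-enc _)) (trans (cong enc (sym (assoc _ _ _))) (sym (rightMul-enc h _)))
      undo : ∀ g h → g ⋆ h ≡ ε → ∀ x → leftMul g (leftMul h x) ≡ x
      undo g h gh x = trans (sym (leftMul-⋆ g h x)) (trans (cong enc (trans (cong (_⋆ dec x) gh) (identityˡ _))) (enc-dec x))

    isRotary : IsRotary n R L
    isRotary x y = leftMul (dec y ⋆ inv (dec x)) , leftMul-isAut _ ,
      trans (cong enc (trans (assoc _ _ _) (trans (cong (dec y ⋆_) (inverseˡ _)) (identityʳ _)))) (enc-dec y)

    leftMul-injective : ∀ g h → (∀ x → leftMul g x ≡ leftMul h x) → g ≡ h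
    leftMul-injective g h eq = ∙-cancelʳ (dec (enc ε)) g h (to-injective code (eq (enc ε)))

    -- An automorphism commutes with right multiplication by both generators, so its value at the
    -- identity, `g₀`, determines it along every word.
    isAut⇒leftMul : ∀ f → IsAut n R L f → Σ G λ g → ∀ x → leftMul g x ≡ f x
    isAut⇒leftMul f (fR , fL , _) = dec (f (enc ε)) , λ x → trans (go (generates (dec x))) (cong f (enc-dec x))
      where
      g₀ = dec (f (enc ε))
      step : ∀ c h → (∀ x → f (rightMul c ⟨$⟩ʳ x) ≡ rightMul c ⟨$⟩ʳ f x) → enc (g₀ ⋆ h) ≡ f (enc h) → enc (g₀ ⋆ (h ⋆ c)) ≡ f (enc (h ⋆ c))
      step c h fc eq = begin
        enc (g₀ ⋆ (h ⋆ c))  ≡⟨ cong enc (assoc g₀ h c) ⟨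
        enc ((g₀ ⋆ h) ⋆ c)  ≡⟨ rightMul-enc c _ ⟨
        rightMul c ⟨$⟩ʳ enc (g₀ ⋆ h)  ≡⟨ cong (rightMul c ⟨$⟩ʳ_) eq ⟩
        rightMul c ⟨$⟩ʳ f (enc h)  ≡⟨ fc _ ⟨
        f (rightMul c ⟨$⟩ʳ enc h)  ≡⟨ cong f (rightMul-enc c h) ⟩
        f (enc (h ⋆ c))  ∎
      go : ∀ {h} → Generated a b h → enc (g₀ ⋆ h) ≡ f (enc h)
      go one = trans (cong enc (identityʳ g₀)) (enc-dec _)
      go (_▸a {h} q) = step a h fR (go q)
      go (_▸b {h} q) = step b h fL (go q)

    Rpow-dec : ∀ k x → Rpow R k x ≡ enc (dec x ⋆ pow a k)
    Rpow-dec zero x = sym (trans (cong enc (identityʳ _)) (enc-dec x))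
    Rpow-dec (suc k) x = trans (cong (R ⟨$⟩ʳ_) (Rpow-dec k x)) (trans (rightMul-enc a _) (cong enc (assoc _ _ a)))

    -- Vertices of the Cayley map are the cosets of the powers of `a`. So `src` must be constant on
    -- them, which is checked on `a` alone, and must separate them; as in `SameVertex`, only forward
    -- powers occur.
    underlyingIso : (Γ : DGraph) (φ : G → Arc Γ) (φ⁻ : Arc Γ → G) → (∀ g → φ⁻ (φ g) ≡ g) → (∀ c → φ (φ⁻ c) ≡ c) →
      (∀ g → φ (g ⋆ b) ≡ rev Γ (φ g)) →
      (∀ g h → src Γ (φ g) ≡ src Γ (φ h) → ∃ λ k → g ⋆ pow a k ≡ h) →
      (∀ g → src Γ (φ (g ⋆ a)) ≡ src Γ (φ g)) →
      (∀ v → ∃ λ c → src Γ c ≡ v) → UnderlyingIso n R L Γ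
    underlyingIso Γ φ φ⁻ φ⁻φ φφ⁻ φb same inv-a onto =
      φ ∘ dec , (enc ∘ φ⁻ , (λ x → trans (cong enc (φ⁻φ _)) (enc-dec x)) , (λ c → trans (cong φ (dec-enc _)) (φφ⁻ c))) ,
      (λ x → trans (cong φ (dec-enc _)) (φb _)) ,
      (λ x y eq → let k , q = same _ _ eq in k , trans (Rpow-dec k x) (trans (cong enc q) (enc-dec y))) ,
      (λ { x .(Rpow R k x) (k , refl) → sym (trans (cong (src Γ ∘ φ) (trans (cong dec (Rpow-dec k x)) (dec-enc _))) (src-pow k _)) }) ,
      λ v → let c , q = onto v in enc (φ⁻ c) , trans (cong (src Γ) (trans (cong φ (dec-enc _)) (φφ⁻ c))) q
      where
      src-pow : ∀ k g → src Γ (φ (g ⋆ pow a k)) ≡ src Γ (φ g)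
      src-pow zero g = cong (src Γ ∘ φ) (identityʳ g)
      src-pow (suc k) g = trans (cong (src Γ ∘ φ) (sym (assoc g _ a))) (trans (inv-a _) (src-pow k g))

-- The group V ⋊ D and its generation by an adapted pair

module Semidirect (p r : ℕ) .{{_ : NonZero p}} .{{_ : NonZero r}} (prime : Prime p) (p≢2 : p ≢ 2) where

  open Vectors p r prime p≢2 public
  open ≡-Reasoning

  negOne∙ : ∀ {d} (x : V d) → negZ p (oneZ p) ∙ x ≡ ⊖ x
  negOne∙ x = ⊖-uniqueˡ _ x (begin
    negZ p (oneZ p) ∙ x ⊕ x  ≡⟨ cong (negZ p (oneZ p) ∙ x ⊕_) (∙-identity x) ⟨
    negZ p (oneZ p) ∙ x ⊕ oneZ p ∙ x  ≡⟨ ∙-distribʳ (negZ p (oneZ p)) (oneZ p) x ⟨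
    addZ p (negZ p (oneZ p)) (oneZ p) ∙ x  ≡⟨ cong (_∙ x) (Z.-‿inverseˡ (oneZ p)) ⟩
    zeroZ p ∙ x  ≡⟨ ∙-zeroˡ x ⟩
    𝟘  ∎)

  module SD-Group {d} (M : Rep d) where
    open Rep M

    infixl 7 _⋆_

    _⋆_ : SD p r d → SD p r d → SD p r d
    (v , g) ⋆ (w , h) = v ⊕ act g w , g · h

    ε : SD p r d
    ε = 𝟘 , e

    inv : SD p r d → SD p r d
    inv (v , g) = ⊖ act (dihInv g) v , dihInv g

    ⋆-assoc : ∀ a b c → (a ⋆ b) ⋆ c ≡ a ⋆ (b ⋆ c)
    ⋆-assoc (v , g) (w , h) (x , k) = cong₂ _,_
      (trans (⊕-assoc v _ _) (cong (v ⊕_) (trans (cong (act g w ⊕_) (act-· g h x)) (sym (act-⊕ g _ _)))))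
      (·-assoc g h k)

    ⋆-isGroup : IsGroup _≡_ _⋆_ ε inv
    ⋆-isGroup = record
      { isMonoid = record
        { isSemigroup = record
          { isMagma = record { isEquivalence = isEquivalence ; ∙-cong = cong₂ _⋆_ }
          ; assoc = ⋆-assoc }
        ; identity = (λ { (v , g) → cong₂ _,_ (trans (⊕-identityˡ _) (act-e v)) (·-identityˡ g) })
                   , (λ { (v , g) → cong₂ _,_ (trans (cong (v ⊕_) (act-𝟘 g)) (⊕-identityʳ v)) (·-identityʳ g) }) }
      ; inverse = (λ { (v , g) → cong₂ _,_ (⊖-inverseˡ _) (·-inverseˡ g) })
                , (λ { (v , g) → cong₂ _,_ (trans (cong (v ⊕_) (trans (act-⊖ g _) (cong ⊖_
                     (trans (sym (act-· g _ v)) (trans (cong (λ h → act h v) (·-inverseʳ g)) (act-e v)))))) (⊖-inverseʳ v)) (·-inverseʳ g) })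
      ; ⁻¹-cong = cong inv }

    open IsGroup ⋆-isGroup public using (identityˡ; identityʳ; inverseˡ; inverseʳ)
    open GroupMap _⋆_ ε inv ⋆-isGroup public

  opaque
    unfolding _⊕_ _·_ toRep

    sdMul-def : ∀ {d} (ψ : Dih r → Mat p d d) (irr : IsIrreducible p r d ψ) a b →
      sdMul p r d ψ a b ≡ SD-Group._⋆_ (Irr.rep (toIrr ψ irr)) a b
    sdMul-def ψ irr a b = refl

  module Generation {d} (M : Irr d) (p∤r : ¬ (p ∣ r)) where
    open Irr M
    open SD-Group rep public
    open Marked M public

    ⟪_⟫ : V d → SD p r d → Set
    ⟪ v ⟫ = Generated (v , τ) (𝟘 , β)

    module _ {v : V d} where

      Translation : V d → Set
      Translation x = ⟪ v ⟫ (x , e)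

      translation-⊕ : ∀ x y → Translation x → Translation y → Translation (x ⊕ y)
      translation-⊕ x y p q = subst ⟪ v ⟫ (cong₂ _,_ (cong (x ⊕_) (act-e y)) (·-identityˡ e)) (generated-⋆ p q)

      translation-∙ : ∀ c x → Translation x → Translation (c ∙ x)
      translation-∙ = closed-∙ Translation one translation-⊕

      -- Multiplying (v, τ) by the translation -v leaves (0, τ), so the complement D is generated.
      -- Conjugating v by D then gives its orbit, which spans V.
      translation⇒generates : v ≢ 𝟘 → Translation v → ∀ a → ⟪ v ⟫ a
      translation⇒generates v≢𝟘 Tv (x , g) = subst ⟪ v ⟫
          (cong₂ _,_ (trans (cong (x ⊕_) (act-𝟘 e)) (⊕-identityʳ x)) (·-identityˡ g))
          (generated-⋆ (cyclic-induction v v≢𝟘 Translation one translation-⊕ (λ h → T-act h v Tv) x) (complement g))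
        where
        gen-τ : ⟪ v ⟫ (𝟘 , τ)
        gen-τ = subst ⟪ v ⟫ (cong₂ _,_ (trans (cong₂ _⊕_ (negOne∙ v) (act-e v)) (⊖-inverseˡ v)) (·-identityˡ τ))
          (generated-⋆ (translation-∙ (negZ p (oneZ p)) v Tv) generated-a)
        complement : ∀ g → ⟪ v ⟫ (𝟘 , g)
        complement = dih-induction (λ g → ⟪ v ⟫ (𝟘 , g)) gen-τ generated-b
          (λ g h p q → subst ⟪ v ⟫ (cong (_, g · h) (trans (⊕-identityˡ _) (act-𝟘 g))) (generated-⋆ p q))
        T-act : ∀ g x → Translation x → Translation (act g x)
        T-act g x Tx = subst ⟪ v ⟫
          (cong₂ _,_ (trans (cong₂ _⊕_ (⊕-identityˡ _) (act-𝟘 (g · e))) (⊕-identityʳ _))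
                     (trans (cong (_· dihInv g) (·-identityʳ g)) (·-inverseʳ g)))
          (generated-⋆ (generated-⋆ (complement g) Tx) (complement (dihInv g)))

      sign-ρ : Sign → ∀ x → act ρ x ≡ x
      sign-ρ sgn x = trans (ρ-def x) (trans (proj₁ (sgn _)) (trans (cong ⊖_ (proj₂ (sgn x))) (⊖-involutive x)))

      sign-rot : Sign → ∀ k x → act (k mod r , false) x ≡ x
      sign-rot sgn zero x = trans (cong (λ i → act (i , false) x) 0-mod) (trans (cong (λ g → act g x) (sym e-def)) (act-e x))
      sign-rot sgn (suc k) x = trans (cong (λ g → act g x) (rot-suc k)) (trans (act-· ρ _ x) (trans (cong (act ρ) (sign-rot sgn k x)) (sign-ρ sgn x)))

      ab : (v , τ) ⋆ (𝟘 , β) ≡ (v , ρ)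
      ab = cong₂ _,_ (trans (cong (v ⊕_) (act-𝟘 τ)) (⊕-identityʳ v)) τβ

      sign-pow : Sign → ∀ k → pow (v , ρ) k ≡ ((k mod p) ∙ v , (k mod r , false))
      sign-pow sgn zero = cong₂ _,_ (sym (∙-zeroˡ v)) (trans e-def (cong (_, false) (sym 0-mod)))
      sign-pow sgn (suc k) = trans (cong (_⋆ (v , ρ)) (sign-pow sgn k)) (cong₂ _,_
        (trans (cong ((k mod p) ∙ v ⊕_) (sign-rot sgn k v)) (trans (⊕-comm _ v) (sym (suc-∙ k v))))
        (trans (rot· _ _ false) (cong (_, false) (trans (+-comm _ _) (sym (suc-mod k))))))

      -- If τv = v, the square of (v, τ) is the translation 2v. If τ and β act as -1, then ρ acts
      -- trivially and the r-th power of (v, ρ) = (v, τ)(0, β) is the translation rv. Both 2 and r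
      -- are invertible modulo p.
      good⇒translation : Adapted v → Translation v
      good⇒translation (inj₁ τv) = subst Translation (trans (∙-distribˡ ½ v v) (½-double v)) (translation-∙ ½ (v ⊕ v)
        (subst ⟪ v ⟫ (cong₂ _,_ (cong (v ⊕_) τv) (ref² _)) (generated-⋆ generated-a generated-a)))
      good⇒translation (inj₂ sgn) = subst Translation
        (trans (sym (∙-assoc (proj₁ r⁻¹) (r mod p) v)) (trans (cong (_∙ v) (trans (Z.*-comm (proj₁ r⁻¹) (r mod p)) (proj₂ r⁻¹))) (∙-identity v)))
        (translation-∙ (proj₁ r⁻¹) ((r mod p) ∙ v)
          (subst ⟪ v ⟫ (trans (sign-pow sgn r) (cong ((r mod p) ∙ v ,_) (trans (cong (_, false) r-mod) (sym e-def))))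
            (generated-pow (subst ⟪ v ⟫ ab (generated-⋆ generated-a generated-b)) r)))
        where
        r⁻¹ : Σ (Fin p) λ c → mulZ p (r mod p) c ≡ oneZ p
        r⁻¹ = inverse (r mod p) (λ eq → p∤r (mod≡0⇒∣ p r eq))

      good⇒generates : Good v → ∀ a → ⟪ v ⟫ a
      good⇒generates (v≢𝟘 , adapted) = translation⇒generates v≢𝟘 (good⇒translation adapted)

-- The Praeger–Xu graph underlying a Cayley map of V ⋊ D

module PraegerXu (p r : ℕ) .{{_ : NonZero p}} .{{_ : NonZero r}} (prime : Prime p) (p≢2 : p ≢ 2) (p∤r : ¬ (p ∣ r)) where

  open Semidirect p r prime p≢2 public
  open ≡-Reasoning

  module Basis {d} (M : Irr d) (v : V d) (v≢𝟘 : v ≢ 𝟘) (τv : Irr.act M τ v ≡ v) where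
    open Irr M

    σ : V d → V d
    σ = act (- 1# , false)

    σ^ : ℕ → V d → V d
    σ^ zero x = x
    σ^ (suc k) x = σ (σ^ k x)

    w : Family d
    w i = σ^ i v

    σ^-⊕ : ∀ k → Additive (σ^ k)
    σ^-⊕ zero x y = refl
    σ^-⊕ (suc k) x y = trans (cong σ (σ^-⊕ k x y)) (act-⊕ _ _ _)

    σ^-w : ∀ k i → σ^ k (w i) ≡ w (k ℕ.+ i)
    σ^-w zero i = refl
    σ^-w (suc k) i = cong σ (σ^-w k i)

    σ^-act : ∀ k x → σ^ k x ≡ act (- (k mod r) , false) x
    σ^-act zero x = sym (trans (cong (λ g → act g x) (trans (cong (_, false) (trans (cong -_ 0-mod) (solveᵣ [] (:⊖ᵣ :0ᵣ) :0ᵣ refl))) (sym e-def))) (act-e x))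
    σ^-act (suc k) x = trans (cong σ (σ^-act k x)) (trans (sym (act-· _ _ x)) (cong (λ g → act g x)
      (trans (rot· _ _ false) (cong (_, false) (trans (solveᵣ (1# ∷ (k mod r) ∷ []) ((:⊖ᵣ x₀ᵣ) :-ᵣ x₁ᵣ) (:⊖ᵣ (x₀ᵣ :+ᵣ x₁ᵣ)) refl) (cong -_ (sym (suc-mod k))))))))

    Independent : ℕ → Set
    Independent m = ∀ c → sp w m c ≡ 𝟘 → c ≡ 𝟘

    independent-suc : ∀ m → Independent m → ¬ InSpan w m (w m) → Independent (suc m)
    independent-suc m ind w∉ (c ∷ cs) eq with c F.≟ zeroZ p
    ... | yes refl = trans (cong (zeroZ p ∷_) (ind cs (trans (sym (trans (cong (_⊕ sp w m cs) (∙-zeroˡ (w m))) (⊕-identityˡ _))) eq))) (sym 𝟘-suc)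
    ... | no c≢0 = contradiction (subst (InSpan w m) wm (InSpan-∙ w m c⁻¹ _ (InSpan-∙ w m (negZ p (oneZ p)) _ (cs , refl)))) w∉
      where
      c⁻¹ : Fin p
      c⁻¹ = proj₁ (inverse c c≢0)
      wm : c⁻¹ ∙ (negZ p (oneZ p) ∙ sp w m cs) ≡ w m
      wm = begin
        c⁻¹ ∙ (negZ p (oneZ p) ∙ sp w m cs)  ≡⟨ cong (c⁻¹ ∙_) (negOne∙ _) ⟩
        c⁻¹ ∙ (⊖ sp w m cs)  ≡⟨ cong (c⁻¹ ∙_) (⊖-uniqueˡ _ _ eq) ⟨
        c⁻¹ ∙ (c ∙ w m)  ≡⟨ ∙-assoc c⁻¹ c (w m) ⟨
        mulZ p c⁻¹ c ∙ w m  ≡⟨ cong (_∙ w m) (trans (Z.*-comm c⁻¹ c) (proj₂ (inverse c c≢0))) ⟩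
        oneZ p ∙ w m  ≡⟨ ∙-identity _ ⟩
        w m  ∎

    Closed : ℕ → Set
    Closed m = Independent m × InSpan w m (w m)

    -- The sequence is followed until a vector falls into the span of its predecessors. Since d + 1
    -- independent vectors cannot exist, asking for k = d + 1 forces this to happen.
    firstDependence : ∀ k → Independent k ⊎ ∃ Closed
    firstDependence zero = inj₁ (λ c _ → 𝟘-unique c)
    firstDependence (suc k) with firstDependence k
    ... | inj₂ q = inj₂ q
    ... | inj₁ ind with InSpan? w k (w k)
    ...   | yes w∈ = inj₂ (k , ind , w∈)
    ...   | no w∉ = inj₁ (independent-suc k ind w∉)

    independent-≤ : ∀ m → Independent m → m ≤ d
    independent-≤ m ind = vec-dim-≤ 1<p (sp w m) (additive-injective (sp-⊕ w m) ind)

    closed-σ : ∀ m → InSpan w m (w m) → ∀ x → InSpan w m x → InSpan w m (σ x)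
    closed-σ m w∈ _ (c , refl) = sp-induction w m (InSpan w m ∘ σ)
      (subst (InSpan w m) (sym (act-𝟘 _)) (InSpan-𝟘 w m))
      (λ x y p q → subst (InSpan w m) (sym (act-⊕ _ x y)) (InSpan-⊕ w m _ _ p q))
      (λ c x p → subst (InSpan w m) (sym (additive-∙ (act-⊕ _) c x)) (InSpan-∙ w m c _ p))
      next c
      where
      next : ∀ i → i < m → InSpan w m (w (suc i))
      next i i<m with ℕ.m≤n⇒m<n∨m≡n i<m
      ... | inj₁ 1+i<m = InSpan-family w m (suc i) 1+i<m
      ... | inj₂ refl = w∈

    -- Because τv = v, a reflection moves `v` to where a rotation does, and every rotation is a
    -- power of σ, under which the span is stable.
    closed⇒spans : ∀ m → InSpan w m (w m) → ∀ u → InSpan w m u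
    closed⇒spans m w∈ = cyclic-induction v v≢𝟘 (InSpan w m) (InSpan-𝟘 w m) (InSpan-⊕ w m) λ
      { (i , false) → rot i
      ; (i , true) → subst (InSpan w m) (trans (cong (act (i , false)) (sym τv)) (trans (sym (act-· _ _ v)) (cong (λ g → act g v) (rot·τ i)))) (rot i) }
      where
      v∈ : ∀ m → InSpan w m (w m) → InSpan w m v
      v∈ zero q = q
      v∈ (suc m) _ = InSpan-family w (suc m) 0 (s≤s z≤n)
      iter : ∀ k → InSpan w m (σ^ k v)
      iter zero = v∈ m w∈
      iter (suc k) = closed-σ m w∈ _ (iter k)
      rot : ∀ i → InSpan w m (act (i , false) v)
      rot i = subst (InSpan w m) (trans (σ^-act (toℕ (- i)) v)
        (cong (λ j → act (j , false) v) (trans (cong -_ (mod-toℕ r (- i))) (solveᵣ (i ∷ []) (:⊖ᵣ (:⊖ᵣ x₀ᵣ)) x₀ᵣ refl)))) (iter (toℕ (- i)))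

    basis : Independent d × (∀ u → InSpan w d u)
    basis with firstDependence (suc d)
    ... | inj₁ ind = contradiction (independent-≤ (suc d) ind) ℕ.1+n≰n
    ... | inj₂ (m , ind , w∈) = subst (λ m → Independent m × (∀ u → InSpan w m u))
      (ℕ.≤-antisym (independent-≤ m ind) (vec-dim-≤ 1<p (proj₁ ∘ spans)
        (λ x y eq → trans (sym (proj₂ (spans x))) (trans (cong (sp w m) eq) (proj₂ (spans y))))))
      (ind , spans)
      where
      spans : ∀ u → InSpan w m u
      spans = closed⇒spans m w∈

  module Coordinates {s} (M : Irr (suc s)) (v : V (suc s)) (v≢𝟘 : v ≢ 𝟘) (τv : Irr.act M τ v ≡ v) where
    open Irr M
    open Basis M v v≢𝟘 τv public

    opaque
      coords : V (suc s) → V (suc s)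
      coords u = proj₁ (proj₂ basis u)

      sp-coords : ∀ u → sp w (suc s) (coords u) ≡ u
      sp-coords u = proj₂ (proj₂ basis u)

    coords-unique : ∀ c u → sp w (suc s) c ≡ u → coords u ≡ c
    coords-unique c u eq = additive-injective (sp-⊕ w (suc s)) (proj₁ basis) _ _ (trans (sp-coords u) (sym eq))

    opaque
      ℓ : V (suc s) → Fin p
      ℓ u = head (coords u)

      ℓ-sp : ∀ c cs → ℓ (sp w (suc s) (c ∷ cs)) ≡ c
      ℓ-sp c cs = cong head (coords-unique (c ∷ cs) _ refl)

    ℓ-split : ∀ u → Σ (V s) λ cs → u ≡ sp w (suc s) (ℓ u ∷ cs)
    ℓ-split u with coords u | sp-coords u
    ... | c ∷ cs | refl = cs , cong (λ e → sp w (suc s) (e ∷ cs)) (sym (ℓ-sp c cs))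

    ℓ-⊕ : ∀ x y → ℓ (x ⊕ y) ≡ addZ p (ℓ x) (ℓ y)
    ℓ-⊕ x y =
      let cs , x≡ = ℓ-split x
          es , y≡ = ℓ-split y
      in trans (cong ℓ (trans (cong₂ _⊕_ x≡ y≡) (trans (sym (sp-⊕ w (suc s) _ _)) (cong (sp w (suc s)) (∷-⊕ _ _ cs es))))) (ℓ-sp _ _)

    ℓ-∙ : ∀ c x → ℓ (c ∙ x) ≡ mulZ p c (ℓ x)
    ℓ-∙ c x =
      let cs , x≡ = ℓ-split x
      in trans (cong ℓ (trans (cong (c ∙_) x≡) (trans (sym (additive-∙ (sp-⊕ w (suc s)) c _)) (cong (sp w (suc s)) (∷-∙ _ _ cs))))) (ℓ-sp _ _)

    ℓ-low : ∀ x → InSpan w s x → ℓ x ≡ zeroZ p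
    ℓ-low _ (cs , refl) = trans (cong ℓ (sym (trans (cong (_⊕ sp w s cs) (∙-zeroˡ (w s))) (⊕-identityˡ _)))) (ℓ-sp (zeroZ p) cs)

    ℓ-𝟘 : ℓ 𝟘 ≡ zeroZ p
    ℓ-𝟘 = ℓ-low 𝟘 (InSpan-𝟘 w s)

    ℓ-w : ∀ i → i < s → ℓ (w i) ≡ zeroZ p
    ℓ-w i i<s = ℓ-low (w i) (InSpan-family w s i i<s)

    ℓ-top : ℓ (w s) ≡ oneZ p
    ℓ-top = trans (cong ℓ (sym (trans (cong₂ _⊕_ (∙-identity (w s)) (additive-𝟘 (sp-⊕ w s))) (⊕-identityʳ _)))) (ℓ-sp (oneZ p) 𝟘)

    Coord : ∀ n → V (suc s) → V n
    Coord zero x = []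
    Coord (suc n) x = ℓ x ∷ Coord n (σ x)

    Coord-⊕ : ∀ n → Additive (Coord n)
    Coord-⊕ zero x y = trans (𝟘-unique _) (sym (𝟘-unique _))
    Coord-⊕ (suc n) x y = trans (cong₂ _∷_ (ℓ-⊕ x y) (trans (cong (Coord n) (act-⊕ _ x y)) (Coord-⊕ n _ _))) (sym (∷-⊕ _ _ _ _))

    init-Coord : ∀ n x → init (Coord (suc n) x) ≡ Coord n x
    init-Coord zero x = refl
    init-Coord (suc n) x = cong (ℓ x ∷_) (init-Coord n (σ x))

    Coord-w : ∀ n i → n ℕ.+ i ≤ s → Coord n (w i) ≡ 𝟘
    Coord-w zero i _ = 𝟘-unique _
    Coord-w (suc n) i le = trans (cong₂ _∷_ (ℓ-w i (ℕ.≤-trans (s≤s (ℕ.m≤n+m i n)) le)) (Coord-w n (suc i) (subst (_≤ s) (sym (ℕ.+-suc n i)) le))) (sym 𝟘-suc)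

    ℓ-σ^-sp : ∀ m k cs → k ℕ.+ m ≤ s → ℓ (σ^ k (sp w m cs)) ≡ zeroZ p
    ℓ-σ^-sp zero k [] le = trans (cong ℓ (additive-𝟘 (σ^-⊕ k))) ℓ-𝟘
    ℓ-σ^-sp (suc m) k (c ∷ cs) le = begin
      ℓ (σ^ k (c ∙ w m ⊕ sp w m cs))  ≡⟨ cong ℓ (σ^-⊕ k _ _) ⟩
      ℓ (σ^ k (c ∙ w m) ⊕ σ^ k (sp w m cs))  ≡⟨ ℓ-⊕ _ _ ⟩
      addZ p (ℓ (σ^ k (c ∙ w m))) (ℓ (σ^ k (sp w m cs)))  ≡⟨ cong₂ (addZ p) lowest (ℓ-σ^-sp m k cs (ℕ.≤-trans (ℕ.+-monoʳ-≤ k (ℕ.n≤1+n m)) le)) ⟩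
      addZ p (zeroZ p) (zeroZ p)  ≡⟨ Z.+-identityˡ (zeroZ p) ⟩
      zeroZ p  ∎
      where
      lowest : ℓ (σ^ k (c ∙ w m)) ≡ zeroZ p
      lowest = trans (cong ℓ (additive-∙ (σ^-⊕ k) c (w m))) (trans (ℓ-∙ c _) (trans (cong (mulZ p c)
        (trans (cong ℓ (σ^-w k m)) (ℓ-w (k ℕ.+ m) (subst (_≤ s) (ℕ.+-suc k m) le)))) (Z.zeroʳ c)))

    -- σ shifts the basis by one place, so `ℓ` ∘ σᵏ reads the coefficient of w(s - k), provided that
    -- no vector of higher index is present to be shifted past w(s). The Praeger-Xu coordinates are
    -- thus triangular in the basis.
    ℓ-σ^-top : ∀ m k c cs → k ℕ.+ m ≡ s → ℓ (σ^ k (sp w (suc m) (c ∷ cs))) ≡ c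
    ℓ-σ^-top m k c cs eq = begin
      ℓ (σ^ k (c ∙ w m ⊕ sp w m cs))  ≡⟨ cong ℓ (σ^-⊕ k _ _) ⟩
      ℓ (σ^ k (c ∙ w m) ⊕ σ^ k (sp w m cs))  ≡⟨ ℓ-⊕ _ _ ⟩
      addZ p (ℓ (σ^ k (c ∙ w m))) (ℓ (σ^ k (sp w m cs)))  ≡⟨ cong₂ (addZ p) highest (ℓ-σ^-sp m k cs (ℕ.≤-reflexive eq)) ⟩
      addZ p c (zeroZ p)  ≡⟨ Z.+-identityʳ c ⟩
      c  ∎
      where
      highest : ℓ (σ^ k (c ∙ w m)) ≡ c
      highest = trans (cong ℓ (additive-∙ (σ^-⊕ k) c (w m))) (trans (ℓ-∙ c _) (trans (cong (mulZ p c)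
        (trans (cong ℓ (σ^-w k m)) (trans (cong (ℓ ∘ w) eq) ℓ-top))) (Z.*-identityʳ c)))

    -- Triangular elimination: the first vanishing coordinate kills the highest coefficient, and
    -- then the next coordinate, with one more σ, reads the coefficient below it.
    Coord-kernel : ∀ n q k c → k ℕ.+ (n ℕ.+ q) ≡ suc s → Coord n (σ^ k (sp w (n ℕ.+ q) c)) ≡ 𝟘 → InSpan w q (sp w (n ℕ.+ q) c)
    Coord-kernel zero q k c _ _ = c , refl
    Coord-kernel (suc n) q k (c ∷ cs) eq zer = subst (InSpan w q) (sym drop)
      (Coord-kernel n q (suc k) cs eq′ (trans (cong (λ x → Coord n (σ (σ^ k x))) (sym drop)) (∷-injectiveʳ zer′)))
      where
      eq′ : suc k ℕ.+ (n ℕ.+ q) ≡ suc s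
      eq′ = trans (sym (ℕ.+-suc k (n ℕ.+ q))) eq
      zer′ : Coord (suc n) (σ^ k (sp w (suc n ℕ.+ q) (c ∷ cs))) ≡ zeroZ p ∷ 𝟘
      zer′ = trans zer 𝟘-suc
      c≡0 : c ≡ zeroZ p
      c≡0 = trans (sym (ℓ-σ^-top (n ℕ.+ q) k c cs (ℕ.suc-injective eq′))) (∷-injectiveˡ zer′)
      drop : sp w (suc n ℕ.+ q) (c ∷ cs) ≡ sp w (n ℕ.+ q) cs
      drop = trans (cong (λ e → e ∙ w (n ℕ.+ q) ⊕ sp w (n ℕ.+ q) cs) c≡0) (trans (cong (_⊕ sp w (n ℕ.+ q) cs) (∙-zeroˡ _)) (⊕-identityˡ _))

    kernelIn : ∀ n q → n ℕ.+ q ≡ suc s → ∀ x → Coord n x ≡ 𝟘 → InSpan w q x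
    kernelIn n q eq x zer = subst (InSpan w q) spx (Coord-kernel n q 0 c eq (trans (cong (Coord n) spx) zer))
      where
      c : V (n ℕ.+ q)
      c = subst V (sym eq) (coords x)
      sp-subst : ∀ {m} (eq : m ≡ suc s) (e : V (suc s)) → sp w m (subst V (sym eq) e) ≡ sp w (suc s) e
      sp-subst refl e = refl
      spx : sp w (n ℕ.+ q) c ≡ x
      spx = trans (sp-subst eq (coords x)) (sp-coords x)

    Coord-injective : ∀ x y → Coord (suc s) x ≡ Coord (suc s) y → x ≡ y
    Coord-injective = additive-injective (Coord-⊕ (suc s)) λ x zer →
      let c , eq = kernelIn (suc s) 0 (ℕ.+-identityʳ (suc s)) x zer in trans (sym eq) (sp-0 w c)

    -- All but one of the coordinates vanish only on the span of w(0) = `v`. This is the line along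
    -- which rotation about a vertex of layer 0 moves the vector part.
    Coord-fibre : ∀ x y → Coord s x ≡ Coord s y → Σ (Fin p) λ c → y ≡ x ⊕ c ∙ v
    Coord-fibre x y eq with kernelIn s 1 (ℕ.+-comm s 1) (y ⊝ x) (trans (Coord-⊕ s y (⊖ x)) (trans (cong₂ _⊕_ (sym eq) (additive-⊖ (Coord-⊕ s) x)) (⊖-inverseʳ _)))
    ... | c ∷ [] , eq′ = c , trans (solve (x ∷ y ∷ []) x₁ (x₀ :+ (x₁ :- x₀)) refl) (cong (x ⊕_) (trans (sym eq′) (⊕-identityʳ _)))

    opaque
      uncoord : V (suc s) → V (suc s)
      uncoord c = proj₁ (injective⇒surjective (vec↔ p (suc s)) (Coord (suc s)) Coord-injective c)

      Coord-uncoord : ∀ c → Coord (suc s) (uncoord c) ≡ c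
      Coord-uncoord c = proj₂ (injective⇒surjective (vec↔ p (suc s)) (Coord (suc s)) Coord-injective c)

    uncoord-Coord : ∀ x → uncoord (Coord (suc s) x) ≡ x
    uncoord-Coord x = Coord-injective _ _ (Coord-uncoord _)

  +1-def : ∀ i → addZ r i (oneZ r) ≡ i + 1#
  +1-def i = sym (trans (+-def i 1#) (cong (addZ r i) 1#-def))

  module PXIso {s} (M : Irr (suc s)) (v : V (suc s)) (v≢𝟘 : v ≢ 𝟘) (τv : Irr.act M τ v ≡ v) where
    open Irr M
    open Coordinates M v v≢𝟘 τv
    open Generation M p∤r

    G : Set
    G = SD p r (suc s)

    back : Fin r → V (suc s) → V (suc s)
    back i = act (- i , false)

    forth : Fin r → V (suc s) → V (suc s)
    forth i = act (i , false)

    back-forth : ∀ i x → back i (forth i x) ≡ x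
    back-forth i x = trans (sym (act-· _ _ x)) (trans (cong (λ g → act g x) (trans (rot· _ _ _) (trans (cong (_, false) (-‿inverseˡ i)) (sym e-def)))) (act-e x))

    forth-back : ∀ i x → forth i (back i x) ≡ x
    forth-back i x = trans (sym (act-· _ _ x)) (trans (cong (λ g → act g x) (trans (rot· _ _ _) (trans (cong (_, false) (-‿inverseʳ i)) (sym e-def)))) (act-e x))

    act-v : ∀ i b → act (i , b) v ≡ forth i v
    act-v i false = refl
    act-v i true = trans (cong (λ g → act g v) (sym (rot·τ i))) (trans (act-· _ _ v) (cong (forth i) τv))

    Γ : DGraph
    Γ = PXGraph p r s

    -- Right multiplication by (0, β) exchanges (x, ρʲτ) with (x, ρʲ⁺¹), so these two darts form one
    -- edge from layer j to layer j + 1. The reflection is its arc out of layer j; the rotation is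
    -- the reverse arc, whence the index j - 1 in the second clause.
    φ : G → Arc Γ
    φ (x , (j , true)) = j , Coord (suc s) (back j x) , true
    φ (x , (j , false)) = j - 1# , Coord (suc s) (back (j - 1#) x) , false

    φ⁻ : Arc Γ → G
    φ⁻ (i , c , true) = forth i (uncoord c) , (i , true)
    φ⁻ (i , c , false) = forth i (uncoord c) , (i + 1# , false)

    φ⁻φ : ∀ g → φ⁻ (φ g) ≡ g
    φ⁻φ (x , (j , true)) = cong (_, (j , true)) (trans (cong (forth j) (uncoord-Coord _)) (forth-back j x))
    φ⁻φ (x , (j , false)) = cong₂ _,_ (trans (cong (forth (j - 1#)) (uncoord-Coord _)) (forth-back (j - 1#) x)) (cong (_, false) (suc-pred j))

    φφ⁻ : ∀ c → φ (φ⁻ c) ≡ c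
    φφ⁻ (i , c , true) = cong (λ y → i , y , true) (trans (cong (Coord (suc s)) (back-forth i _)) (Coord-uncoord c))
    φφ⁻ (i , c , false) = cong₂ (λ j y → j , y , false) (pred-suc i)
      (trans (cong (λ j → Coord (suc s) (back j (forth i (uncoord c)))) (pred-suc i)) (trans (cong (Coord (suc s)) (back-forth i _)) (Coord-uncoord c)))

    ⋆β : ∀ x g → (x , g) ⋆ (𝟘 , β) ≡ (x , g · β)
    ⋆β x g = cong (_, g · β) (trans (cong (x ⊕_) (act-𝟘 g)) (⊕-identityʳ x))

    φ-β : ∀ g → φ (g ⋆ (𝟘 , β)) ≡ rev Γ (φ g)
    φ-β (x , (j , true)) = trans (cong φ (trans (⋆β x _) (cong (x ,_) (ref·β j)))) (cong (λ i → i , Coord (suc s) (back i x) , false) (pred-suc j))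
    φ-β (x , (j , false)) = cong φ (trans (⋆β x _) (cong (x ,_) (rot· j _ true)))

    vert : G → Vert Γ
    vert (x , (j , _)) = j , Coord s (back j x)

    src-φ : ∀ g → src Γ (φ g) ≡ vert g
    src-φ (x , (j , true)) = cong (j ,_) (init-Coord s _)
    src-φ (x , (j , false)) = cong₂ _,_ (trans (+1-def (j - 1#)) (suc-pred j)) (cong (Coord s) (trans (sym (act-· _ _ x)) (cong (λ g → act g x)
      (trans (rot· _ _ _) (cong (_, false) (solveᵣ (j ∷ 1# ∷ []) ((:⊖ᵣ x₁ᵣ) :-ᵣ (x₀ᵣ :-ᵣ x₁ᵣ)) (:⊖ᵣ x₀ᵣ) refl))))))

    ·τ : ∀ j b → (j , b) · τ ≡ (j , not b)
    ·τ j false = rot·τ j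
    ·τ j true = trans (ref· j _ true) (cong (_, false) (solveᵣ (j ∷ []) (x₀ᵣ :-ᵣ :0ᵣ) x₀ᵣ refl))

    ⋆α : ∀ x j b → (x , (j , b)) ⋆ (v , τ) ≡ (x ⊕ forth j v , (j , not b))
    ⋆α x j b = cong₂ _,_ (cong (x ⊕_) (act-v j b)) (·τ j b)

    vert-α : ∀ g → vert (g ⋆ (v , τ)) ≡ vert g
    vert-α (x , (j , b)) = trans (cong vert (⋆α x j b)) (cong (j ,_) (begin
      Coord s (back j (x ⊕ forth j v))  ≡⟨ cong (Coord s) (trans (act-⊕ _ _ _) (cong (back j x ⊕_) (back-forth j v))) ⟩
      Coord s (back j x ⊕ v)  ≡⟨ Coord-⊕ s _ _ ⟩
      Coord s (back j x) ⊕ Coord s v  ≡⟨ cong (Coord s (back j x) ⊕_) (Coord-w s 0 (ℕ.≤-reflexive (ℕ.+-identityʳ s))) ⟩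
      Coord s (back j x) ⊕ 𝟘  ≡⟨ ⊕-identityʳ _ ⟩
      Coord s (back j x)  ∎))

    _∼_ : G → G → Set
    g ∼ h = ∃ λ k → g ⋆ pow (v , τ) k ≡ h

    ∼-refl : ∀ {g h} → g ≡ h → g ∼ h
    ∼-refl eq = 0 , trans (identityʳ _) eq

    ∼-step : ∀ {g h} → g ∼ h → g ∼ (h ⋆ (v , τ))
    ∼-step (k , refl) = suc k , sym (⋆-assoc _ _ _)

    ∼-trans : ∀ {g h k} → g ∼ h → h ∼ k → g ∼ k
    ∼-trans {g} {h} p (zero , eq) = subst (g ∼_) (trans (sym (identityʳ h)) eq) p
    ∼-trans {g} {h} p (suc k , refl) = subst (g ∼_) (⋆-assoc _ _ _) (∼-step (∼-trans p (k , refl)))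

    -- Even powers of (v , τ) already reach every multiple of v, since p is odd.
    ∼-even : ∀ x j b k → (x , (j , b)) ∼ (x ⊕ (k mod p) ∙ (forth j v ⊕ forth j v) , (j , b))
    ∼-even x j b zero = ∼-refl (cong (_, (j , b)) (sym (trans (cong (x ⊕_) (∙-zeroˡ _)) (⊕-identityʳ x))))
    ∼-even x j b (suc k) = subst ((x , (j , b)) ∼_) eq (∼-step (∼-step (∼-even x j b k)))
      where
      y y₂ : V (suc s)
      y = forth j v
      y₂ = y ⊕ y
      eq : ((x ⊕ (k mod p) ∙ y₂ , (j , b)) ⋆ (v , τ)) ⋆ (v , τ) ≡ (x ⊕ (suc k mod p) ∙ y₂ , (j , b))
      eq = trans (cong (_⋆ (v , τ)) (⋆α _ j b)) (trans (⋆α _ j (not b)) (cong₂ _,_ (begin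
        x ⊕ (k mod p) ∙ y₂ ⊕ y ⊕ y  ≡⟨ solve (x ∷ (k mod p) ∙ y₂ ∷ y ∷ []) (x₀ :+ x₁ :+ x₂ :+ x₂) (x₀ :+ ((x₂ :+ x₂) :+ x₁)) refl ⟩
        x ⊕ (y₂ ⊕ (k mod p) ∙ y₂)  ≡⟨ cong (x ⊕_) (suc-∙ k y₂) ⟨
        x ⊕ (suc k mod p) ∙ y₂  ∎) (cong (j ,_) (not-involutive b))))

    ∼-same : ∀ x y j b → Coord s (back j x) ≡ Coord s (back j y) → (x , (j , b)) ∼ (y , (j , b))
    ∼-same x y j b eq with Coord-fibre _ _ eq
    ... | c , y≡ = subst (λ z → (x , (j , b)) ∼ (z , (j , b))) (sym (begin
      y  ≡⟨ forth-back j y ⟨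
      forth j (back j y)  ≡⟨ cong (forth j) y≡ ⟩
      forth j (back j x ⊕ c ∙ v)  ≡⟨ trans (act-⊕ _ _ _) (cong₂ _⊕_ (forth-back j x) (additive-∙ (act-⊕ _) c v)) ⟩
      x ⊕ c ∙ forth j v  ≡⟨ cong (x ⊕_) (trans (sym (½-double _)) (trans (sym (∙-distribˡ ½ _ _)) (trans (cong (½ ∙_) (sym (∙-distribˡ c _ _))) (sym (∙-assoc ½ c _))))) ⟩
      x ⊕ mulZ p ½ c ∙ (forth j v ⊕ forth j v)  ≡⟨ cong (λ e → x ⊕ e ∙ (forth j v ⊕ forth j v)) (mod-toℕ p (mulZ p ½ c)) ⟨
      x ⊕ (toℕ (mulZ p ½ c) mod p) ∙ (forth j v ⊕ forth j v)  ∎)) (∼-even x j b (toℕ (mulZ p ½ c)))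

    ∼-vert : ∀ g h → vert g ≡ vert h → g ∼ h
    ∼-vert (x , (j , b)) (y , (i , c)) eq with ,-injective eq
    ... | refl , eq′ with b Bool.≟ c
    ...   | yes refl = ∼-same x y j b eq′
    -- One step by (v, τ) flips the flag without leaving the vertex; this reduces to equal flags.
    ...   | no b≢c = ∼-trans (∼-step (∼-refl refl)) (subst (_∼ (y , (j , c))) (sym (trans (⋆α x j b) (cong (λ b′ → x ⊕ forth j v , (j , b′)) (sym (¬-not (b≢c ∘ sym))))))
                       (∼-same _ y j c (trans (cong proj₂ (trans (cong vert (sym (⋆α x j b))) (vert-α (x , (j , b))))) eq′)))

    px-underlyingIso : ∀ {n} (code : G ↔ Fin n) (gen : ∀ g → Generated (v , τ) (𝟘 , β) g) →
      UnderlyingIso n (CayleyMap.R code (v , τ) (𝟘 , β) gen) (CayleyMap.L code (v , τ) (𝟘 , β) gen) Γ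
    px-underlyingIso code gen = CayleyMap.underlyingIso code (v , τ) (𝟘 , β) gen Γ φ φ⁻ φ⁻φ φφ⁻ φ-β
      (λ g h eq → ∼-vert g h (trans (sym (src-φ g)) (trans eq (src-φ h))))
      (λ g → trans (src-φ _) (trans (vert-α g) (sym (src-φ g))))
      λ { (i , y) → (i , y ∷ʳ zeroZ p , true) , cong (i ,_) (init-∷ʳ (zeroZ p) y) }

-- The cycle underlying the map of the sign representation

module Maps (p r : ℕ) .{{_ : NonZero p}} .{{_ : NonZero r}} (prime : Prime p) (p≢2 : p ≢ 2) (p∤r : ¬ (p ∣ r)) where

  open PraegerXu p r prime p≢2 p∤r public
  open ≡-Reasoning

  instance
    pr≢0 : NonZero (p ℕ.* r)
    pr≢0 = ℕ.m*n≢0 p r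

  -- Write k - j = qr. As p divides qr but not r, it divides q, so pr divides k - j, which is
  -- smaller than pr.
  chinese-≤ : ∀ j k → j ≤ k → k < p ℕ.* r → j mod p ≡ k mod p → j mod r ≡ k mod r → j ≡ k
  chinese-≤ j k j≤k k<pr eqp eqr with mod≡⇒∣∸ r j≤k eqr
  ... | divides q k∸j with euclidsLemma q r prime (subst (p ∣_) k∸j (mod≡⇒∣∸ p j≤k eqp))
  ...   | inj₂ p∣r = contradiction p∣r p∤r
  ...   | inj₁ p∣q with k ℕ.∸ j in eq
  ...     | zero = ℕ.≤-antisym j≤k (ℕ.m∸n≡0⇒m≤n eq)
  ...     | suc m = contradiction (∣⇒≤ (subst (p ℕ.* r ∣_) (sym k∸j) (*-monoˡ-∣ r p∣q)))
                      (ℕ.<⇒≱ (ℕ.≤-<-trans (subst (_≤ k) eq (ℕ.m∸n≤m k j)) k<pr))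

  chinese : ∀ j k → j < p ℕ.* r → k < p ℕ.* r → j mod p ≡ k mod p → j mod r ≡ k mod r → j ≡ k
  chinese j k j< k< eqp eqr with ℕ.≤-total j k
  ... | inj₁ j≤k = chinese-≤ j k j≤k k< eqp eqr
  ... | inj₂ k≤j = sym (chinese-≤ k j k≤j j< (sym eqp) (sym eqr))

  %pr-mod-p : ∀ k → (k % (p ℕ.* r)) mod p ≡ k mod p
  %pr-mod-p k = mod-cong p (sym (trans (cong (_% p) (trans (m≡m%n+[m/n]*n k (p ℕ.* r))
    (cong (k % (p ℕ.* r) ℕ.+_) (trans (cong (k / (p ℕ.* r) ℕ.*_) (ℕ.*-comm p r)) (sym (ℕ.*-assoc (k / (p ℕ.* r)) r p))))))
    ([m+kn]%n≡m%n (k % (p ℕ.* r)) (k / (p ℕ.* r) ℕ.* r) p)))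

  %pr-mod-r : ∀ k → (k % (p ℕ.* r)) mod r ≡ k mod r
  %pr-mod-r k = mod-cong r (sym (trans (cong (_% r) (trans (m≡m%n+[m/n]*n k (p ℕ.* r))
    (cong (k % (p ℕ.* r) ℕ.+_) (sym (ℕ.*-assoc (k / (p ℕ.* r)) p r)))))
    ([m+kn]%n≡m%n (k % (p ℕ.* r)) (k / (p ℕ.* r) ℕ.* p) r)))

  ∙-injectiveˡ : ∀ {d} (v : V d) → v ≢ 𝟘 → ∀ c e → c ∙ v ≡ e ∙ v → c ≡ e
  ∙-injectiveˡ v v≢𝟘 c e eq with addZ p c (negZ p e) F.≟ zeroZ p
  ... | yes q = ZA.x∙y⁻¹≈ε⇒x≈y c e q
  ... | no q = contradiction (∙-cancel _ v q (begin
      addZ p c (negZ p e) ∙ v  ≡⟨ ∙-distribʳ c (negZ p e) v ⟩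
      c ∙ v ⊕ negZ p e ∙ v  ≡⟨ cong (_⊕ negZ p e ∙ v) eq ⟩
      e ∙ v ⊕ negZ p e ∙ v  ≡⟨ ∙-distribʳ e (negZ p e) v ⟨
      addZ p e (negZ p e) ∙ v  ≡⟨ cong (_∙ v) (Z.-‿inverseʳ e) ⟩
      zeroZ p ∙ v  ≡⟨ ∙-zeroˡ v ⟩
      𝟘  ∎)) v≢𝟘

  module CycleIso {d} (M : Irr d) (v : V d) (v≢𝟘 : v ≢ 𝟘) (sgn : Marked.Sign M) where
    open Irr M
    open Generation M p∤r
    open Algebra.Properties.Group group using (∙-cancelʳ)

    N : ℕ
    N = p ℕ.* r

    G : Set
    G = SD p r d

    α z c : G
    α = v , τ
    z = 𝟘 , β
    c = v , ρ

    αz : α ⋆ z ≡ c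
    αz = ab

    αα : α ⋆ α ≡ ε
    αα = cong₂ _,_ (trans (cong (v ⊕_) (proj₁ (sgn v))) (⊖-inverseʳ v)) (ref² _)

    zz : z ⋆ z ≡ ε
    zz = cong₂ _,_ (trans (⊕-identityˡ _) (act-𝟘 β)) (ref² _)

    pow-% : ∀ k → pow c (k % N) ≡ pow c k
    pow-% k = trans (sign-pow sgn _) (trans (cong₂ (λ i j → i ∙ v , (j , false)) (%pr-mod-p k) (%pr-mod-r k)) (sym (sign-pow sgn k)))

    -- Here α is an involution and a vertex is a pair {g, gα}. The powers of c represent the
    -- vertices: the j-th power is (jv, ρʲ), and by the Chinese remainder argument these are
    -- distinct for j < pr.
    vtx : Fin N → G
    vtx j = pow c (toℕ j)

    vtx-mod : ∀ k → vtx (k mod N) ≡ pow c k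
    vtx-mod k = trans (cong (pow c) (toℕ-mod N k)) (pow-% k)

    vtx-injective : ∀ i j → vtx i ≡ vtx j → i ≡ j
    vtx-injective i j eq = toℕ-injective (chinese _ _ (toℕ<n i) (toℕ<n j)
      (∙-injectiveˡ v v≢𝟘 _ _ (cong proj₁ eq′)) (cong (proj₁ ∘ proj₂) eq′))
      where
      eq′ : ((toℕ i mod p) ∙ v , (toℕ i mod r , false)) ≡ ((toℕ j mod p) ∙ v , (toℕ j mod r , false))
      eq′ = trans (sym (sign-pow sgn _)) (trans eq (sign-pow sgn _))

    α^ : Bool → G
    α^ true = α
    α^ false = ε

    Γ : DGraph
    Γ = CycleGraph N

    -- The bijection is built from arcs to darts, where it has a formula: (j, `true`) goes to cʲα
    -- and (j, `false`) to cʲ⁺¹. Reversal is then the relation αz = c. The other direction is read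
    -- off from generation.
    φ⁻ : Arc Γ → G
    φ⁻ a = vtx (src Γ a) ⋆ α^ (proj₂ a)

    flag : G → Bool
    flag = proj₂ ∘ proj₂

    flag-vtx : ∀ j b → flag (vtx j ⋆ α^ b) ≡ b
    flag-vtx j true = trans (cong (λ g → flag (g ⋆ α)) (sign-pow sgn (toℕ j))) (cong proj₂ (rot·τ (toℕ j mod r)))
    flag-vtx j false = cong flag (trans (identityʳ (vtx j)) (sign-pow sgn (toℕ j)))

    vtx⋆-injective : ∀ i j b b′ → vtx i ⋆ α^ b ≡ vtx j ⋆ α^ b′ → i ≡ j × b ≡ b′
    vtx⋆-injective i j b b′ eq with trans (sym (flag-vtx i b)) (trans (cong flag eq) (flag-vtx j b′))
    ... | refl = vtx-injective i j (∙-cancelʳ (α^ b) (vtx i) (vtx j) eq) , refl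

    α^-not : ∀ b → α^ b ⋆ α ≡ α^ (not b)
    α^-not true = αα
    α^-not false = identityˡ α

    φ⁻-z : ∀ a → φ⁻ a ⋆ z ≡ φ⁻ (rev Γ a)
    φ⁻-z (j , true) = begin
      (vtx j ⋆ α) ⋆ z  ≡⟨ ⋆-assoc (vtx j) α z ⟩
      vtx j ⋆ (α ⋆ z)  ≡⟨ cong (vtx j ⋆_) αz ⟩
      pow c (suc (toℕ j))  ≡⟨ vtx-mod (suc (toℕ j)) ⟨
      vtx (suc (toℕ j) mod N)  ≡⟨ cong vtx suc-j ⟩
      vtx (addZ N j (oneZ N))  ≡⟨ identityʳ _ ⟨
      vtx (addZ N j (oneZ N)) ⋆ ε  ∎
      where
      suc-j : suc (toℕ j) mod N ≡ addZ N j (oneZ N)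
      suc-j = trans (mod-+ N 1 (toℕ j)) (trans (cong (addZ N (oneZ N)) (mod-toℕ N j)) (addZ-comm N (oneZ N) j))
    φ⁻-z (j , false) = ∙-cancelʳ z _ _ (begin
      (φ⁻ (j , false) ⋆ z) ⋆ z  ≡⟨ ⋆-assoc (φ⁻ (j , false)) z z ⟩
      φ⁻ (j , false) ⋆ (z ⋆ z)  ≡⟨ cong (φ⁻ (j , false) ⋆_) zz ⟩
      φ⁻ (j , false) ⋆ ε  ≡⟨ identityʳ _ ⟩
      φ⁻ (j , false)  ≡⟨ φ⁻-z (j , true) ⟨
      φ⁻ (j , true) ⋆ z  ∎)

    arcAt : Fin N → Bool → Arc Γ
    arcAt j true = j , true
    arcAt j false = addZ N j (negZ N (oneZ N)) , false

    src-arcAt : ∀ j b → src Γ (arcAt j b) ≡ j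
    src-arcAt j true = refl
    src-arcAt j false = addZ-cancel N j (negZ N (oneZ N)) (oneZ N) (addZ-inverseˡ N (oneZ N))

    φ⁻-arcAt : ∀ j b → φ⁻ (arcAt j b) ≡ vtx j ⋆ α^ b
    φ⁻-arcAt j true = refl
    φ⁻-arcAt j false = cong (λ i → vtx i ⋆ ε) (src-arcAt j false)

    φ⁻-α : ∀ a → φ⁻ a ⋆ α ≡ φ⁻ (arcAt (src Γ a) (not (proj₂ a)))
    φ⁻-α a = trans (⋆-assoc (vtx (src Γ a)) (α^ (proj₂ a)) α) (trans (cong (vtx (src Γ a) ⋆_) (α^-not (proj₂ a))) (sym (φ⁻-arcAt (src Γ a) (not (proj₂ a)))))

    opaque
      φ⁻-surjective : ∀ g → ∃ λ a → φ⁻ a ≡ g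
      φ⁻-surjective g = go (good⇒generates {v} (v≢𝟘 , inj₂ sgn) g)
        where
        go : ∀ {g} → ⟪ v ⟫ g → ∃ λ a → φ⁻ a ≡ g
        go one = arcAt (0 mod N) false , trans (φ⁻-arcAt (0 mod N) false) (trans (identityʳ _) (vtx-mod 0))
        go (q ▸a) with go q
        ... | a , refl = arcAt (src Γ a) (not (proj₂ a)) , sym (φ⁻-α a)
        go (q ▸b) with go q
        ... | a , refl = rev Γ a , sym (φ⁻-z a)

    src-injective : ∀ (i j : Fin N) (b : Bool) → src Γ (i , b) ≡ src Γ (j , b) → i ≡ j
    src-injective i j true eq = eq
    src-injective i j false eq = Algebra.Properties.Group.∙-cancelʳ (CommutativeRing.+-group (Zring N)) (oneZ N) i j eq

    φ⁻-injective : ∀ a a′ → φ⁻ a ≡ φ⁻ a′ → a ≡ a′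
    φ⁻-injective (i , b) (j , b′) eq with vtx⋆-injective (src Γ (i , b)) (src Γ (j , b′)) b b′ eq
    ... | q , refl = cong (_, b) (src-injective i j b q)

    φ : G → Arc Γ
    φ = proj₁ ∘ φ⁻-surjective

    φ⁻φ : ∀ g → φ⁻ (φ g) ≡ g
    φ⁻φ = proj₂ ∘ φ⁻-surjective

    φφ⁻ : ∀ a → φ (φ⁻ a) ≡ a
    φφ⁻ a = φ⁻-injective (φ (φ⁻ a)) a (φ⁻φ (φ⁻ a))

    φ-z : ∀ g → φ (g ⋆ z) ≡ rev Γ (φ g)
    φ-z g = φ⁻-injective (φ (g ⋆ z)) (rev Γ (φ g)) (trans (φ⁻φ (g ⋆ z)) (trans (cong (_⋆ z) (sym (φ⁻φ g))) (φ⁻-z (φ g))))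

    src-φ-α : ∀ g → src Γ (φ (g ⋆ α)) ≡ src Γ (φ g)
    src-φ-α g = trans (cong (src Γ) (φ⁻-injective (φ (g ⋆ α)) (arcAt (src Γ (φ g)) b)
        (trans (φ⁻φ (g ⋆ α)) (trans (cong (_⋆ α) (sym (φ⁻φ g))) (φ⁻-α (φ g))))))
      (src-arcAt (src Γ (φ g)) b)
      where
      b : Bool
      b = not (proj₂ (φ g))

    same : ∀ a a′ → src Γ a ≡ src Γ a′ → ∃ λ k → φ⁻ a ⋆ pow α k ≡ φ⁻ a′
    same a a′ eq with proj₂ a Bool.≟ proj₂ a′
    ... | yes q = 0 , trans (identityʳ (φ⁻ a)) (cong₂ (λ j b → vtx j ⋆ α^ b) eq q)
    ... | no q = 1 , trans (cong (φ⁻ a ⋆_) (identityˡ α)) (trans (⋆-assoc (vtx (src Γ a)) (α^ (proj₂ a)) α) (cong₂ (λ j g → vtx j ⋆ g) eq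
                   (trans (α^-not (proj₂ a)) (cong α^ (sym (¬-not (q ∘ sym)))))))

    cycle-underlyingIso : ∀ {n} (code : G ↔ Fin n) (gen : ∀ g → Generated (v , τ) (𝟘 , β) g) →
      UnderlyingIso n (CayleyMap.R code (v , τ) (𝟘 , β) gen) (CayleyMap.L code (v , τ) (𝟘 , β) gen) Γ
    cycle-underlyingIso code gen = CayleyMap.underlyingIso code (v , τ) (𝟘 , β) gen Γ φ φ⁻ φ⁻φ
      φφ⁻
      φ-z
      (λ g h eq → let k , q = same (φ g) (φ h) eq in k , trans (cong (_⋆ pow α k) (sym (φ⁻φ g))) (trans q (φ⁻φ h)))
      src-φ-α
      (λ j → (j , true) , refl)

  module MapOf (X : IrrRep p r) (v : V (proj₁ X)) (good : Marked.Good (irrOf X) v) where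

    d : ℕ
    d = proj₁ X

    open Irr (irrOf X) using (act-𝟘)
    open Generation (irrOf X) p∤r

    open CayleyMap (sd↔ p r d) (v , τ) (𝟘 , β) (good⇒generates good) public

    β≢ε : (𝟘 , β) ≢ ε
    β≢ε eq with trans (cong proj₂ eq) e-def
    ... | ()

    ββ : (𝟘 , β) ⋆ (𝟘 , β) ≡ ε
    ββ = cong₂ _,_ (trans (⊕-identityˡ _) (act-𝟘 β)) (ref² _)

    autIso : AutIsoSD p r (p ℕ.^ d ℕ.* (r ℕ.* 2)) R L d (proj₁ (proj₂ X))
    autIso = leftMul , leftMul-isAut , (λ a b x → trans (cong (λ g → leftMul g x) (sdMul-def _ (proj₂ (proj₂ X)) a b)) (leftMul-⋆ a b x)) ,
      leftMul-injective , isAut⇒leftMul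

  augPX-true : ∀ s → AugPX p r s true ≡ PXGraph p r s
  augPX-true zero = refl
  augPX-true (suc s) = refl

  -- In the τ-fixed case s = d - 1; there δ matters only for s = 0 and has to be `true`, the cycle
  -- with multiple edges. The sign case gives the simple cycle of length pr.
  mapOf-graph : (X : IrrRep p r) (v : V (proj₁ X)) (good : Marked.Good (irrOf X) v) →
    Σ ℕ λ s → Σ Bool λ δ → UnderlyingIso _ (MapOf.R X v good) (MapOf.L X v good) (AugPX p r s δ)
  mapOf-graph (suc s , ψ , irr) v good@(v≢𝟘 , inj₁ τv) = s , true ,
    subst (UnderlyingIso _ (MapOf.R (suc s , ψ , irr) v good) (MapOf.L (suc s , ψ , irr) v good)) (sym (augPX-true s))
      (PXIso.px-underlyingIso (toIrr ψ irr) v v≢𝟘 τv (sd↔ p r (suc s)) (Generation.good⇒generates (toIrr ψ irr) p∤r good))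
  mapOf-graph (zero , ψ , irr) v good@(v≢𝟘 , inj₁ τv) = contradiction (𝟘-unique v) v≢𝟘
  mapOf-graph X v good@(v≢𝟘 , inj₂ sgn) = 0 , false , CycleIso.cycle-underlyingIso (irrOf X) v v≢𝟘 sgn (sd↔ p r (proj₁ X))
    (Generation.good⇒generates (irrOf X) p∤r good)

  mapOf : (X : IrrRep p r) (v : V (proj₁ X)) → Marked.Good (irrOf X) v → IrrRotAugPXMap p r
  mapOf X v good = _ , R , L , isMap ββ β≢ε , isRotary , mapOf-graph X v good , d , proj₁ (proj₂ X) , proj₂ (proj₂ X) , autIso
    where open MapOf X v good

-- Isomorphic maps come from isomorphic representations

module Isomorphisms (p r : ℕ) .{{_ : NonZero p}} .{{_ : NonZero r}} (prime : Prime p) (p≢2 : p ≢ 2) (p∤r : ¬ (p ∣ r)) where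

  open Maps p r prime p≢2 p∤r public
  open ≡-Reasoning

  coprime-r-p : Coprime r p
  coprime-r-p {i} (i∣r , i∣p) with prime⇒irreducible prime i∣p
  ... | inj₁ i≡1 = i≡1
  ... | inj₂ refl = contradiction i∣r p∤r

  dihPow : Dih r → ℕ → Dih r
  dihPow g zero = e
  dihPow g (suc k) = dihPow g k · g

  dihPow-rot : ∀ i k → dihPow (i , false) k ≡ ((k ℕ.* toℕ i) mod r , false)
  dihPow-rot i zero = trans e-def (cong (_, false) (sym 0-mod))
  dihPow-rot i (suc k) = trans (cong (_· (i , false)) (dihPow-rot i k)) (trans (rot· _ _ false) (cong (_, false) (begin
    ((k ℕ.* toℕ i) mod r) + i  ≡⟨ cong (((k ℕ.* toℕ i) mod r) +_) (mod-toℕ r i) ⟨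
    ((k ℕ.* toℕ i) mod r) + (toℕ i mod r)  ≡⟨ +-comm _ _ ⟩
    (toℕ i mod r) + ((k ℕ.* toℕ i) mod r)  ≡⟨ +-def _ _ ⟩
    addZ r (toℕ i mod r) ((k ℕ.* toℕ i) mod r)  ≡⟨ mod-+ r (toℕ i) (k ℕ.* toℕ i) ⟨
    (suc k ℕ.* toℕ i) mod r  ∎)))

  mod≡0#⇒∣ : ∀ k → (k mod r , false) ≡ e → r ∣ k
  mod≡0#⇒∣ k eq = mod≡0⇒∣ r k (trans (cong proj₁ (trans eq e-def)) (sym 0-mod))

  rot-p-torsion : ∀ i → dihPow (i , false) p ≡ e → (i , false) ≡ e
  rot-p-torsion i eq = trans (cong (_, false) (trans (sym (mod-toℕ r i)) (trans (∣⇒mod≡0 r (toℕ i) r∣i) 0-mod))) (sym e-def)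
    where
    r∣i : r ∣ toℕ i
    r∣i = coprime-divisor coprime-r-p (mod≡0#⇒∣ (p ℕ.* toℕ i) (trans (sym (dihPow-rot i p)) eq))

  dih-square-rot : ∀ g → ∃ λ i → g · g ≡ (i , false)
  dih-square-rot (i , false) = _ , rot· i i false
  dih-square-rot (i , true) = _ , ref· i i true

  module SD-Pow {d} (M : Rep d) where
    open Rep M
    open SD-Group M

    proj₂-pow : ∀ g k → proj₂ (pow g k) ≡ dihPow (proj₂ g) k
    proj₂-pow g zero = refl
    proj₂-pow g (suc k) = cong (_· proj₂ g) (proj₂-pow g k)

    translation-⋆ : ∀ x y → (x , e) ⋆ (y , e) ≡ (x ⊕ y , e)
    translation-⋆ x y = cong₂ _,_ (cong (x ⊕_) (act-e y)) (·-identityˡ e)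

    translation-pow : ∀ x k → pow (x , e) k ≡ ((k mod p) ∙ x , e)
    translation-pow x zero = cong (_, e) (sym (∙-zeroˡ x))
    translation-pow x (suc k) = trans (cong (_⋆ (x , e)) (translation-pow x k)) (trans (translation-⋆ _ x) (cong (_, e)
      (trans (⊕-comm _ x) (sym (suc-∙ k x)))))

    translation-pow-p : ∀ x → pow (x , e) p ≡ ε
    translation-pow-p x = trans (translation-pow x p) (cong (_, e) (trans (cong (_∙ x) (n-mod p)) (∙-zeroˡ x)))

  -- The image of (v, τ) may be any (x, τ), not just the pair from which the second map was built:
  -- an isomorphism that reverses the orientation sends α to an inverse, whose vector part is
  -- different.
  module Homomorphism {d d′} (M : Irr d) (M′ : Irr d′) (v : V d) (good : Marked.Good M v)
    (F : SD p r d → SD p r d′)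
    (F-ε : F (SD-Group.ε (Irr.rep M)) ≡ SD-Group.ε (Irr.rep M′)) (x : V d′)
    (F-α : ∀ g → F (SD-Group._⋆_ (Irr.rep M) g (v , τ)) ≡ SD-Group._⋆_ (Irr.rep M′) (F g) (x , τ))
    (F-z : ∀ g → F (SD-Group._⋆_ (Irr.rep M) g (𝟘 , β)) ≡ SD-Group._⋆_ (Irr.rep M′) (F g) (𝟘 , β))
    (F-injective : ∀ g h → F g ≡ F h → g ≡ h) where

    private
      module A where
        open Irr M public
        open Generation M p∤r public
        open SD-Pow rep public
      module B where
        open Irr M′ public
        open SD-Group rep public
        open SD-Pow rep public

    F-⋆ : ∀ g h → F (g A.⋆ h) ≡ F g B.⋆ F h
    F-⋆ g h = go (A.good⇒generates good h)
      where
      step : ∀ {c c′} h → (∀ g → F (g A.⋆ c) ≡ F g B.⋆ c′) → F (g A.⋆ h) ≡ F g B.⋆ F h → F (g A.⋆ (h A.⋆ c)) ≡ F g B.⋆ F (h A.⋆ c)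
      step {c} {c′} h F-c eq = begin
        F (g A.⋆ (h A.⋆ c))  ≡⟨ cong F (A.⋆-assoc g h c) ⟨
        F ((g A.⋆ h) A.⋆ c)  ≡⟨ F-c _ ⟩
        F (g A.⋆ h) B.⋆ c′  ≡⟨ cong (B._⋆ c′) eq ⟩
        (F g B.⋆ F h) B.⋆ c′  ≡⟨ B.⋆-assoc (F g) (F h) c′ ⟩
        F g B.⋆ (F h B.⋆ c′)  ≡⟨ cong (F g B.⋆_) (F-c h) ⟨
        F g B.⋆ F (h A.⋆ c)  ∎
      go : ∀ {h} → A.⟪ v ⟫ h → F (g A.⋆ h) ≡ F g B.⋆ F h
      go A.one = trans (cong F (A.identityʳ g)) (sym (trans (cong (F g B.⋆_) F-ε) (B.identityʳ (F g))))
      go (A._▸a {h} q) = step h F-α (go q)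
      go (A._▸b {h} q) = step h F-z (go q)

    F-pow : ∀ g k → F (A.pow g k) ≡ B.pow (F g) k
    F-pow g zero = F-ε
    F-pow g (suc k) = trans (F-⋆ _ g) (cong (B._⋆ F g) (F-pow g k))

    -- Translations have odd order prime to r: being squares they map to rotations, which are then trivial.
    proj₂-translation : ∀ x → proj₂ (F (x , e)) ≡ e
    proj₂-translation x with dih-square-rot (proj₂ (F (½ ∙ x , e)))
    ... | i , sq = trans isRot (rot-p-torsion i (trans (cong (λ g → dihPow g p) (sym isRot)) (trans (sym (B.proj₂-pow _ p))
          (cong proj₂ (trans (sym (F-pow (x , e) p)) (trans (cong F (A.translation-pow-p x)) F-ε))))))
      where
      isRot : proj₂ (F (x , e)) ≡ (i , false)
      isRot = trans (cong (proj₂ ∘ F) (sym (trans (A.translation-⋆ _ _) (cong (_, e) (½-double x)))))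
        (trans (cong proj₂ (F-⋆ (½ ∙ x , e) (½ ∙ x , e))) sq)

    f : V d → V d′
    f x = proj₁ (F (x , e))

    F-translation : ∀ x → F (x , e) ≡ (f x , e)
    F-translation x = cong (f x ,_) (proj₂-translation x)

    f-⊕ : Additive f
    f-⊕ x y = cong proj₁ (begin
      F (x ⊕ y , e)  ≡⟨ cong F (A.translation-⋆ x y) ⟨
      F ((x , e) A.⋆ (y , e))  ≡⟨ F-⋆ _ _ ⟩
      F (x , e) B.⋆ F (y , e)  ≡⟨ cong₂ B._⋆_ (F-translation x) (F-translation y) ⟩
      (f x , e) B.⋆ (f y , e)  ≡⟨ B.translation-⋆ _ _ ⟩
      (f x ⊕ f y , e)  ∎)

    -- Apply `F` to (gx, e)(y, g) = (y, g)(x, e). The vector y is left free because the image in D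
    -- is known at first only for (v, τ) and (0, β), and the former does not lie in the complement.
    f-act-of : ∀ y g → proj₂ (F (y , g)) ≡ g → ∀ x → f (A.act g x) ≡ B.act g (f x)
    f-act-of y g eq x = ⊕-cancelʳ y′ _ _ (cong proj₁ (begin
      (f (A.act g x) ⊕ y′ , g)  ≡⟨ cong₂ _,_ (cong (f (A.act g x) ⊕_) (B.act-e y′)) (·-identityˡ g) ⟨
      (f (A.act g x) , e) B.⋆ (y′ , g)  ≡⟨ cong₂ B._⋆_ (F-translation _) Fyg ⟨
      F (A.act g x , e) B.⋆ F (y , g)  ≡⟨ F-⋆ _ _ ⟨
      F ((A.act g x , e) A.⋆ (y , g))  ≡⟨ cong F (cong₂ _,_ (trans (cong (A.act g x ⊕_) (A.act-e y)) (⊕-comm _ y)) (trans (·-identityˡ g) (sym (·-identityʳ g)))) ⟩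
      F ((y , g) A.⋆ (x , e))  ≡⟨ F-⋆ _ _ ⟩
      F (y , g) B.⋆ F (x , e)  ≡⟨ cong₂ B._⋆_ Fyg (F-translation x) ⟩
      (y′ , g) B.⋆ (f x , e)  ≡⟨ cong₂ _,_ (⊕-comm y′ _) (·-identityʳ g) ⟩
      (B.act g (f x) ⊕ y′ , g)  ∎))
      where
      y′ = proj₁ (F (y , g))
      Fyg : F (y , g) ≡ (y′ , g)
      Fyg = cong (y′ ,_) eq

    f-act : Equivariant (Irr.rep M) (Irr.rep M′) f
    f-act = dih-induction (λ g → ∀ x → f (A.act g x) ≡ B.act g (f x))
      (f-act-of v τ (image (v , τ) (x , τ) F-α)) (f-act-of 𝟘 β (image (𝟘 , β) (𝟘 , β) F-z))
      (λ g h p q x → trans (cong f (A.act-· g h x)) (trans (p _) (trans (cong (B.act g) (q x)) (sym (B.act-· g h _)))))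
      where
      image : ∀ a b → (∀ g → F (g A.⋆ a) ≡ F g B.⋆ b) → proj₂ (F a) ≡ proj₂ b
      image a b step = cong proj₂ (trans (cong F (sym (A.identityˡ a))) (trans (step A.ε) (trans (cong (B._⋆ b) F-ε) (B.identityˡ b))))

    f-nonzero : f v ≢ 𝟘
    f-nonzero fv = proj₁ good (cong proj₁ (F-injective (v , e) A.ε (trans (F-translation v) (trans (cong (_, e) fv) (sym F-ε)))))

  MapIso⇒RepIso : (X Y : IrrRep p r) (v : V (proj₁ X)) (w : V (proj₁ Y)) →
    (gv : Marked.Good (irrOf X) v) (gw : Marked.Good (irrOf Y) w) →
    MapIso p r (mapOf X v gv) (mapOf Y w gw) → RepIso p r X Y
  MapIso⇒RepIso X Y v w gv gw (h , h⁻ , h⁻h , _ , hL , hR) = fromStep hR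
    where
    module A where
      open SD-Group (Irr.rep (irrOf X)) public
      open MapOf X v gv public
    module B where
      open SD-Group (Irr.rep (irrOf Y)) public
      open MapOf Y w gw public
      open Algebra.Properties.Group group public using (∙-cancelˡ)
    F₀ : SD p r (proj₁ X) → SD p r (proj₁ Y)
    F₀ g = B.dec (h (A.enc g))
    F : SD p r (proj₁ X) → SD p r (proj₁ Y)
    -- Left multiplication is an automorphism of the target map; this one normalises the bijection
    -- to preserve the identity.
    F g = B.inv (F₀ A.ε) B.⋆ F₀ g
    F-injective : ∀ g k → F g ≡ F k → g ≡ k
    F-injective g k eq = trans (sym (A.dec-enc g)) (trans (cong A.dec (trans (sym (h⁻h _)) (trans (cong h⁻
      (trans (sym (B.enc-dec _)) (trans (cong B.enc (B.∙-cancelˡ (B.inv (F₀ A.ε)) (F₀ g) (F₀ k) eq)) (B.enc-dec _)))) (h⁻h _)))) (A.dec-enc k))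
    F-step : ∀ a b → (∀ x → h (A.rightMul a ⟨$⟩ʳ x) ≡ B.enc (B.dec (h x) B.⋆ b)) → ∀ g → F (g A.⋆ a) ≡ F g B.⋆ b
    F-step a b step g = trans (cong (B.inv (F₀ A.ε) B.⋆_) F₀-step) (sym (B.⋆-assoc (B.inv (F₀ A.ε)) (F₀ g) b))
      where
      F₀-step : F₀ (g A.⋆ a) ≡ F₀ g B.⋆ b
      F₀-step = trans (cong (B.dec ∘ h) (sym (A.rightMul-enc a g))) (trans (cong B.dec (step (A.enc g))) (B.dec-enc _))
    result : (x : V (proj₁ Y)) → (∀ g → F (g A.⋆ (v , τ)) ≡ F g B.⋆ (x , τ)) → RepIso p r X Y
    result x F-α = schur⇒RepIso X Y H.f H.f-⊕ H.f-act (v , H.f-nonzero)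
      where module H = Homomorphism (irrOf X) (irrOf Y) v gv F (B.inverseˡ (F₀ A.ε)) x F-α (F-step (𝟘 , β) (𝟘 , β) hL) F-injective
    fromStep : (∀ x → h (A.R ⟨$⟩ʳ x) ≡ B.R ⟨$⟩ʳ (h x)) ⊎ (∀ x → h (A.R ⟨$⟩ʳ x) ≡ B.R ⟨$⟩ˡ (h x)) → RepIso p r X Y
    fromStep (inj₁ q) = result w (F-step (v , τ) (w , τ) q)
    -- Reversed orientation: the rotation becomes right multiplication by the inverse of (w, τ),
    -- again a vector paired with τ.
    fromStep (inj₂ q) = result (proj₁ (B.inv (w , τ))) (F-step (v , τ) (B.inv (w , τ)) q)

-- Reading the generators off an arbitrary map

module Orbit {n : ℕ} (R : Permutation′ n) where

  R-injective : ∀ x y → R ⟨$⟩ʳ x ≡ R ⟨$⟩ʳ y → x ≡ y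
  R-injective x y eq = trans (sym (permutation-inverseˡ R)) (trans (cong (R ⟨$⟩ˡ_) eq) (permutation-inverseˡ R))

  Rpow-+ : ∀ j k x → Rpow R (j ℕ.+ k) x ≡ Rpow R j (Rpow R k x)
  Rpow-+ zero k x = refl
  Rpow-+ (suc j) k x = cong (R ⟨$⟩ʳ_) (Rpow-+ j k x)

  Rpow-injective : ∀ k x y → Rpow R k x ≡ Rpow R k y → x ≡ y
  Rpow-injective zero x y eq = eq
  Rpow-injective (suc k) x y eq = Rpow-injective k x y (R-injective _ _ eq)

  Rpow-* : ∀ q k x → Rpow R k x ≡ x → Rpow R (q ℕ.* k) x ≡ x
  Rpow-* zero k x eq = refl
  Rpow-* (suc q) k x eq = trans (Rpow-+ k (q ℕ.* k) x) (trans (cong (Rpow R k) (Rpow-* q k x eq)) eq)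

  Rpow-% : ∀ k .{{_ : NonZero k}} l x → Rpow R k x ≡ x → Rpow R (l % k) x ≡ Rpow R l x
  Rpow-% k l x eq = sym (trans (cong (λ j → Rpow R j x) (m≡m%n+[m/n]*n l k))
    (trans (Rpow-+ (l % k) (l / k ℕ.* k) x) (cong (Rpow R (l % k)) (Rpow-* (l / k) k x eq))))

  -- An orbit with m elements has period m: some k with 0 < k ≤ m is a period by the pigeonhole principle,
  -- and then the orbit has at most k elements.
  orbit-period : ∀ m x (E : Fin m → Fin n) → (∀ i j → E i ≡ E j → i ≡ j) → (∀ i → SameVertex R x (E i)) →
    (∀ y → SameVertex R x y → ∃ λ i → E i ≡ y) → Rpow R m x ≡ x
  orbit-period m x E E-inj E-orbit E-complete =
    subst (λ k → Rpow R k x ≡ x) (ℕ.≤-antisym k≤m (injective⇒≤ {f = residue} (λ {i} {j} → residue-inj i j))) period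
    where
    index : ∀ l → ∃ λ i → E i ≡ Rpow R l x
    index l = E-complete (Rpow R l x) (l , refl)
    collision = pigeonhole {m} {suc m} ℕ.≤-refl (λ i → proj₁ (index (toℕ i)))
    i j k : ℕ
    i = toℕ (proj₁ collision)
    j = toℕ (proj₁ (proj₂ collision))
    k = j ℕ.∸ i
    i<j : i < j
    i<j = proj₁ (proj₂ (proj₂ collision))
    k≤m : k ≤ m
    k≤m = ℕ.≤-trans (ℕ.m∸n≤m j i) (ℕ.≤-pred (toℕ<n (proj₁ (proj₂ collision))))
    same : Rpow R i x ≡ Rpow R j x
    same = trans (sym (proj₂ (index i))) (trans (cong E (proj₂ (proj₂ (proj₂ collision)))) (proj₂ (index j)))
    period : Rpow R k x ≡ x
    period = Rpow-injective i _ _ (trans (sym (Rpow-+ i k x)) (trans (cong (λ l → Rpow R l x) (ℕ.m+[n∸m]≡n (ℕ.<⇒≤ i<j))) (sym same)))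
    instance
      k≢0 : NonZero k
      k≢0 = ℕ.>-nonZero (ℕ.m<n⇒0<n∸m i<j)
    residue : Fin m → Fin k
    residue t = proj₁ (E-orbit t) mod k
    residue-E : ∀ t → Rpow R (toℕ (residue t)) x ≡ E t
    residue-E t = trans (cong (λ l → Rpow R l x) (toℕ-mod k _)) (trans (Rpow-% k _ x period) (proj₂ (E-orbit t)))
    residue-inj : ∀ s t → residue s ≡ residue t → s ≡ t
    residue-inj s t eq = E-inj s t (trans (sym (residue-E s)) (trans (cong (λ l → Rpow R (toℕ l) x) eq) (residue-E t)))

-- Valencies of augmented Praeger-Xu graphs and involutions generating the dihedral group

module Recognition (p r : ℕ) .{{_ : NonZero p}} .{{_ : NonZero r}} (prime : Prime p) (p≢2 : p ≢ 2) (p∤r : ¬ (p ∣ r)) (3≤r : 3 ≤ r) where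

  open Isomorphisms p r prime p≢2 p∤r public
  open ≡-Reasoning

  -- Regularity of valency m in enumerated form. Vertices being orbits of the rotation, it bounds
  -- the order of the rotation; `someArc` later supplies a base dart.
  record Fibres (Γ : DGraph) (m : ℕ) : Set where
    field
      someArc : Arc Γ
      fibre : Vert Γ → Fin m → Arc Γ
      fibre-injective : ∀ u i j → fibre u i ≡ fibre u j → i ≡ j
      fibre-src : ∀ u i → src Γ (fibre u i) ≡ u
      fibre-complete : ∀ a → ∃ λ i → fibre (src Γ a) i ≡ a

  fibresVia : ∀ {Γ} {I : Set} {m} → I ↔ Fin m → Arc Γ → (fibre : Vert Γ → I → Arc Γ) →
    (∀ u i j → fibre u i ≡ fibre u j → i ≡ j) → (∀ u i → src Γ (fibre u i) ≡ u) →
    (∀ a → ∃ λ i → fibre (src Γ a) i ≡ a) → Fibres Γ m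
  fibresVia e a fibre inj sr com = record
    { someArc = a
    ; fibre = λ u i → fibre u (Inverse.from e i)
    ; fibre-injective = λ u i j eq → to-injective (↔-sym e) (inj u _ _ eq)
    ; fibre-src = λ u i → sr u _
    ; fibre-complete = λ a → let i , eq = com a in Inverse.to e i , trans (cong (fibre _) (from-to e i)) eq }

  fibre-period : ∀ {n R L Γ m} → Fibres Γ m → UnderlyingIso n R L Γ → ∀ x → Rpow R m x ≡ x
  fibre-period {R = R} {Γ = Γ} {m} fib (φ , (φ⁻ , φ⁻φ , φφ⁻) , _ , src⇒same , same⇒src , _) x = Orbit.orbit-period R m x
    (φ⁻ ∘ fibre u)
    (λ i j eq → fibre-injective u i j (trans (sym (φφ⁻ _)) (trans (cong φ eq) (φφ⁻ _))))
    (λ i → src⇒same x _ (sym (trans (cong (src Γ) (φφ⁻ _)) (fibre-src u i))))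
    (λ y sv → let i , eq = fibre-complete (φ y) in
      i , trans (cong φ⁻ (trans (cong (λ t → fibre t i) (same⇒src x y sv)) eq)) (φ⁻φ y))
    where
    open Fibres fib
    u : Vert Γ
    u = src Γ (φ x)

  px-fibres : ∀ s → Fibres (PXGraph p r s) (p ℕ.* 2)
  px-fibres s = fibresVia (dih↔ p) (0 mod r , replicate (suc s) (zeroZ p) , true) fib inj sr com
    where
    Γ : DGraph
    Γ = PXGraph p r s
    fib : Vert Γ → Fin p × Bool → Arc Γ
    fib (i , x) (y , true) = i , x ∷ʳ y , true
    fib (i , x) (y , false) = i - 1# , y ∷ x , false
    inj : ∀ u a b → fib u a ≡ fib u b → a ≡ b
    inj (i , x) (y , true) (y′ , true) eq = cong (_, true) (∷ʳ-injectiveʳ x x (cong (proj₁ ∘ proj₂) eq))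
    inj (i , x) (y , false) (y′ , false) eq = cong (_, false) (∷-injectiveˡ (cong (proj₁ ∘ proj₂) eq))
    inj (i , x) (y , true) (y′ , false) eq = contradiction (cong (proj₂ ∘ proj₂) eq) λ ()
    inj (i , x) (y , false) (y′ , true) eq = contradiction (cong (proj₂ ∘ proj₂) eq) λ ()
    sr : ∀ u a → src Γ (fib u a) ≡ u
    sr (i , x) (y , true) = cong (i ,_) (init-∷ʳ y x)
    sr (i , x) (y , false) = cong (_, x) (trans (+1-def (i - 1#)) (suc-pred i))
    com : ∀ a → ∃ λ b → fib (src Γ a) b ≡ a
    com (i , c , true) = (last c , true) , cong (λ c → i , c , true) (sym (proj₂ (proj₂ (initLast c))))
    com (i , y ∷ c , false) = (y , false) , cong (λ i → i , y ∷ c , false) (trans (cong (_- 1#) (+1-def i)) (pred-suc i))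

  cycle-fibres : ∀ m .{{_ : NonZero m}} → Fibres (CycleGraph m) 2
  cycle-fibres m = fibresVia (↔-sym 2↔Bool) (zeroZ m , true) fib inj sr com
    where
    Γ : DGraph
    Γ = CycleGraph m
    -1# : Fin m
    -1# = negZ m (oneZ m)
    fib : Fin m → Bool → Arc Γ
    fib i true = i , true
    fib i false = addZ m i -1# , false
    inj : ∀ i a b → fib i a ≡ fib i b → a ≡ b
    inj i true true _ = refl
    inj i false false _ = refl
    inj i true false eq = contradiction (cong proj₂ eq) λ ()
    inj i false true eq = contradiction (cong proj₂ eq) λ ()
    sr : ∀ i a → src Γ (fib i a) ≡ i
    sr i true = refl
    sr i false = addZ-cancel m i -1# (oneZ m) (addZ-inverseˡ m (oneZ m))
    com : ∀ a → ∃ λ b → fib (src Γ a) b ≡ a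
    com (i , true) = true , refl
    com (i , false) = false , cong (_, false) (addZ-cancel m i (oneZ m) -1# (addZ-inverseʳ m (oneZ m)))

  augPX-fibres : ∀ s δ → Fibres (AugPX p r s δ) (p ℕ.* 2) ⊎ Fibres (AugPX p r s δ) 2
  augPX-fibres zero true = inj₁ (px-fibres zero)
  augPX-fibres zero false = inj₂ (cycle-fibres (p ℕ.* r))
  augPX-fibres (suc s) δ = inj₁ (px-fibres (suc s))

  -- Both possible valencies, 2p and 2, divide 2p, so a single exponent serves every augmented
  -- graph.
  underlying-period : ∀ {n R L} s δ → UnderlyingIso n R L (AugPX p r s δ) → Fin n × (∀ x → Rpow R (p ℕ.* 2) x ≡ x)
  underlying-period {R = R} {L} s δ und with augPX-fibres s δ
  ... | inj₁ fib = proj₁ (proj₁ (proj₂ und)) (Fibres.someArc fib) , fibre-period {R = R} {L} fib und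
  ... | inj₂ fib = proj₁ (proj₁ (proj₂ und)) (Fibres.someArc fib) , λ x → Orbit.Rpow-* R p 2 x (fibre-period {R = R} {L} fib und x)

  ·-isGroup : IsGroup _≡_ _·_ e dihInv
  ·-isGroup = record
    { isMonoid = record
      { isSemigroup = record
        { isMagma = record { isEquivalence = isEquivalence ; ∙-cong = cong₂ _·_ }
        ; assoc = ·-assoc }
      ; identity = ·-identityˡ , ·-identityʳ }
    ; inverse = ·-inverseˡ , ·-inverseʳ
    ; ⁻¹-cong = cong dihInv }

  module D = GroupMap _·_ e dihInv ·-isGroup

  generated-swap : ∀ {a b g} → D.Generated a b g → D.Generated b a g
  generated-swap D.one = D.one
  generated-swap (q D.▸a) = generated-swap q D.▸b
  generated-swap (q D.▸b) = generated-swap q D.▸a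

  toℕ-0# : toℕ 0# ≡ 0
  toℕ-0# = trans (cong toℕ (sym 0-mod)) (trans (toℕ-mod r 0) (0%n≡0 r))

  toℕ-1# : toℕ 1# ≡ 1
  toℕ-1# = trans (cong toℕ 1#-def) (trans (toℕ-mod r 1) (m<n⇒m%n≡m (ℕ.<-trans (s≤s (s≤s z≤n)) 3≤r)))

  0#≢1# : 0# ≢ 1#
  0#≢1# eq = contradiction (trans (sym toℕ-0#) (trans (cong toℕ eq) toℕ-1#)) λ ()

  1#+1#≢0# : 1# + 1# ≢ 0#
  1#+1#≢0# eq = ℕ.<⇒≱ 3≤r (∣⇒≤ (mod≡0⇒∣ r 2 (trans (mod-+ r 1 1) (trans (sym (trans (+-def 1# 1#) (cong₂ (addZ r) 1#-def 1#-def))) (trans eq (sym 0-mod))))))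

  -- A central rotation of order at most two and a reflection generate at most four elements.
  rotation-reflection-¬generate : ∀ i j → (i , false) · (i , false) ≡ e → ¬ (∀ g → D.Generated (i , false) (j , true) g)
  rotation-reflection-¬generate i j ii gen = absurd (small (gen (1# , false))) (small (gen (1# + 1# , false)))
    where
    i+i : i + i ≡ 0#
    i+i = cong proj₁ (trans (sym (rot· i i false)) (trans ii e-def))
    Small : Dih r → Set
    Small (k , false) = k ≡ 0# ⊎ k ≡ i
    Small (k , true) = k ≡ j ⊎ k ≡ i + j
    step-a : ∀ g → Small g → Small (g · (i , false))
    step-a (k , false) (inj₁ refl) = subst Small (sym (rot· _ _ _)) (inj₂ (+-identityˡ i))
    step-a (k , false) (inj₂ refl) = subst Small (sym (rot· _ _ _)) (inj₁ i+i)
    step-a (k , true) (inj₁ refl) = subst Small (sym (ref· _ _ _)) (inj₂ (begin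
      j - i  ≡⟨ solveᵣ (i ∷ j ∷ []) (x₁ᵣ :-ᵣ x₀ᵣ) ((x₀ᵣ :+ᵣ x₁ᵣ) :-ᵣ (x₀ᵣ :+ᵣ x₀ᵣ)) refl ⟩
      (i + j) - (i + i)  ≡⟨ cong (λ k → (i + j) - k) i+i ⟩
      (i + j) - 0#  ≡⟨ solveᵣ (i + j ∷ []) (x₀ᵣ :-ᵣ :0ᵣ) x₀ᵣ refl ⟩
      i + j  ∎))
    step-a (k , true) (inj₂ refl) = subst Small (sym (ref· _ _ _)) (inj₁ (solveᵣ (i ∷ j ∷ []) ((x₀ᵣ :+ᵣ x₁ᵣ) :-ᵣ x₀ᵣ) x₁ᵣ refl))
    step-b : ∀ g → Small g → Small (g · (j , true))
    step-b (k , false) (inj₁ refl) = subst Small (sym (rot· _ _ _)) (inj₁ (+-identityˡ j))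
    step-b (k , false) (inj₂ refl) = subst Small (sym (rot· _ _ _)) (inj₂ refl)
    step-b (k , true) (inj₁ refl) = subst Small (sym (ref· _ _ _)) (inj₁ (-‿inverseʳ j))
    step-b (k , true) (inj₂ refl) = subst Small (sym (ref· _ _ _)) (inj₂ (solveᵣ (i ∷ j ∷ []) ((x₀ᵣ :+ᵣ x₁ᵣ) :-ᵣ x₁ᵣ) x₀ᵣ refl))
    small : ∀ {g} → D.Generated (i , false) (j , true) g → Small g
    small D.one = subst Small (sym e-def) (inj₁ refl)
    small (q D.▸a) = step-a _ (small q)
    small (q D.▸b) = step-b _ (small q)
    absurd : 1# ≡ 0# ⊎ 1# ≡ i → 1# + 1# ≡ 0# ⊎ 1# + 1# ≡ i → ⊥
    absurd (inj₁ q) _ = 0#≢1# (sym q)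
    absurd (inj₂ _) (inj₁ q) = 1#+1#≢0# q
    absurd (inj₂ q) (inj₂ q′) = 0#≢1# (sym (begin
      1#  ≡⟨ solveᵣ (1# ∷ []) x₀ᵣ ((x₀ᵣ :+ᵣ x₀ᵣ) :-ᵣ x₀ᵣ) refl ⟩
      (1# + 1#) - 1#  ≡⟨ cong₂ _-_ q′ q ⟩
      i - i  ≡⟨ -‿inverseʳ i ⟩
      0#  ∎))

  rotations-¬generate : ∀ i j → ¬ (∀ g → D.Generated (i , false) (j , false) g)
  rotations-¬generate i j gen = contradiction (flag (gen τ)) λ ()
    where
    flag : ∀ {g} → D.Generated (i , false) (j , false) g → proj₂ g ≡ false
    flag D.one = cong proj₂ e-def
    flag (D._▸a {k , b} q) with flag q
    ... | refl = cong proj₂ (rot· k i false)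
    flag (D._▸b {k , b} q) with flag q
    ... | refl = cong proj₂ (rot· k j false)

  generators-are-reflections : ∀ a b → a · a ≡ e → b · b ≡ e → (∀ g → D.Generated a b g) →
    ∃ λ i → ∃ λ j → a ≡ (i , true) × b ≡ (j , true)
  generators-are-reflections (i , true) (j , true) _ _ _ = i , j , refl , refl
  generators-are-reflections (i , false) (j , true) aa _ gen = contradiction gen (rotation-reflection-¬generate i j aa)
  generators-are-reflections (i , true) (j , false) _ bb gen = contradiction (λ g → generated-swap (gen g)) (rotation-reflection-¬generate j i bb)
  generators-are-reflections (i , false) (j , false) _ _ gen = contradiction gen (rotations-¬generate i j)

  -- The order of a rotation divides r, which is coprime to p, so the factor p cancels from the
  -- exponent.
  2p-torsion⇒involution : ∀ g → dihPow g (p ℕ.* 2) ≡ e → g · g ≡ e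
  2p-torsion⇒involution (i , true) _ = ref² i
  2p-torsion⇒involution (i , false) eq = begin
    (i , false) · (i , false)  ≡⟨ cong (_· (i , false)) (·-identityˡ (i , false)) ⟨
    dihPow (i , false) 2  ≡⟨ dihPow-rot i 2 ⟩
    ((2 ℕ.* toℕ i) mod r , false)  ≡⟨ cong (_, false) (trans (∣⇒mod≡0 r (2 ℕ.* toℕ i) r∣2i) 0-mod) ⟩
    (0# , false)  ≡⟨ e-def ⟨
    e  ∎
    where
    r∣2i : r ∣ 2 ℕ.* toℕ i
    r∣2i = coprime-divisor coprime-r-p (subst (r ∣_) (ℕ.*-assoc p 2 (toℕ i)) (mod≡0#⇒∣ (p ℕ.* 2 ℕ.* toℕ i) (trans (sym (dihPow-rot i (p ℕ.* 2))) eq)))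

  module Remark (i j : Fin r) (generates : ∀ g → D.Generated (i , true) (j , true) g) where

    t : Fin r → Fin r
    t = times (i - j)

    -- An automorphism taking τ and β to the reflections i and j must send ρ = τβ to their product,
    -- the rotation by i - j; this is the multiplier in `t`, and adding i places the image of τ.
    -- That i - j is a unit modulo r is never shown: surjectivity comes from generation and
    -- injectivity from finiteness.
    σ : Dih r → Dih r
    σ (k , false) = t k , false
    σ (k , true) = t k + i , true

    t-sub : ∀ k l → t (k - l) ≡ t k - t l
    t-sub k l = trans (times-+ (i - j) k (- l)) (cong (t k +_) (times-neg (i - j) l))

    σ-· : ∀ g h → σ (g · h) ≡ σ g · σ h
    σ-· (k , false) (l , false) = trans (cong σ (rot· k l false)) (trans (cong (_, false) (times-+ (i - j) k l)) (sym (rot· _ _ _)))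
    σ-· (k , false) (l , true) = trans (cong σ (rot· k l true)) (trans (cong (_, true) (trans (cong (_+ i) (times-+ (i - j) k l)) (+-assoc _ _ _))) (sym (rot· _ _ _)))
    σ-· (k , true) (l , false) = trans (cong σ (ref· k l false)) (trans (cong (_, true) (trans (cong (_+ i) (t-sub k l))
      (solveᵣ (t k ∷ t l ∷ i ∷ []) ((x₀ᵣ :-ᵣ x₁ᵣ) :+ᵣ x₂ᵣ) ((x₀ᵣ :+ᵣ x₂ᵣ) :-ᵣ x₁ᵣ) refl))) (sym (ref· _ _ _)))
    σ-· (k , true) (l , true) = trans (cong σ (ref· k l true)) (trans (cong (_, false) (trans (t-sub k l)
      (solveᵣ (t k ∷ t l ∷ i ∷ []) (x₀ᵣ :-ᵣ x₁ᵣ) ((x₀ᵣ :+ᵣ x₂ᵣ) :-ᵣ (x₁ᵣ :+ᵣ x₂ᵣ)) refl))) (sym (ref· _ _ _)))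

    σ-e : σ e ≡ e
    σ-e = trans (cong σ e-def) (trans (cong (_, false) (times-0 (i - j))) (sym e-def))

    σ-τ : σ τ ≡ (i , true)
    σ-τ = cong (_, true) (trans (cong (_+ i) (times-0 (i - j))) (+-identityˡ i))

    σ-β : σ β ≡ (j , true)
    σ-β = cong (_, true) (trans (cong (_+ i) (trans (times-neg (i - j) 1#) (cong -_ (times-1 (i - j)))))
      (solveᵣ (i ∷ j ∷ []) ((:⊖ᵣ (x₀ᵣ :-ᵣ x₁ᵣ)) :+ᵣ x₀ᵣ) x₁ᵣ refl))

    opaque
      σ-surjective : ∀ g → ∃ λ h → σ h ≡ g
      σ-surjective g = go (generates g)
        where
        go : ∀ {g} → D.Generated (i , true) (j , true) g → ∃ λ h → σ h ≡ g
        go D.one = e , σ-e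
        go (q D.▸a) with go q
        ... | h , refl = h · τ , trans (σ-· h τ) (cong (σ h ·_) σ-τ)
        go (q D.▸b) with go q
        ... | h , refl = h · β , trans (σ-· h β) (cong (σ h ·_) σ-β)

      σ-injective : ∀ g h → σ g ≡ σ h → g ≡ h
      σ-injective = surjective⇒injective (dih↔ r) σ σ-surjective

    opaque
      remark-irreducible : ∀ {d} (ψ : Dih r → Mat p d d) → IsIrreducible p r d ψ → IsIrreducible p r d (ψ ∘ σ)
      remark-irreducible ψ (1≤d , (hom , one) , noW) = 1≤d ,
        ((λ g h → trans (cong ψ (trans (cong σ (sym (·-def g h))) (trans (σ-· g h) (·-def _ _)))) (hom _ _)) ,
         trans (cong ψ (trans (cong σ (sym e-dihOne)) (trans σ-e e-dihOne))) one) ,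
        λ { (W , (W0 , W+ , W∙ , Wψ) , rest) → noW (W , (W0 , W+ , W∙ , λ g v Wv → let h , eq = σ-surjective g in
          subst (λ g → W (matVec p (ψ g) v)) eq (Wψ h v Wv)) , rest) }

-- Every irreducible rotary map is one of the standard Cayley maps

module Classification (p r : ℕ) .{{_ : NonZero p}} .{{_ : NonZero r}} (prime : Prime p) (p≢2 : p ≢ 2) (p∤r : ¬ (p ∣ r)) (3≤r : 3 ≤ r) where

  open Recognition p r prime p≢2 p∤r 3≤r public
  open ≡-Reasoning

  module _ {d d′} (M : Irr d) (M′ : Irr d′) (f : V d → V d′) (f-⊕ : Additive f)
           (f-act : Equivariant (Irr.rep M) (Irr.rep M′) f) (f-surjective : ∀ y → ∃ λ x → f x ≡ y) where
    private
      module A = Irr M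
      module B = Irr M′

    exceptional-transfer : Marked.Exceptional M → Marked.Exceptional M′
    exceptional-transfer exc y with f-surjective y
    ... | x , refl = trans (sym (f-act τ x)) (trans (cong f (proj₁ (exc x))) (additive-⊖ f-⊕ x)) ,
                     trans (sym (f-act β x)) (cong f (proj₂ (exc x)))

    good-transfer : (∀ x y → f x ≡ f y → x ≡ y) → ∀ v → Marked.Good M v → Marked.Good M′ (f v)
    good-transfer f-inj v (v≢𝟘 , adapted) = (λ fv → v≢𝟘 (f-inj v 𝟘 (trans fv (sym (additive-𝟘 f-⊕))))) , transfer adapted
      where
      transfer : Marked.Adapted M v → Marked.Adapted M′ (f v)
      transfer (inj₁ τv) = inj₁ (trans (sym (f-act τ v)) (cong f τv))
      transfer (inj₂ sgn) = inj₂ λ y → let x , fx = f-surjective y in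
        trans (cong (B.act τ) (sym fx)) (trans (sym (f-act τ x)) (trans (cong f (proj₁ (sgn x))) (trans (additive-⊖ f-⊕ x) (cong ⊖_ fx)))) ,
        trans (cong (B.act β) (sym fx)) (trans (sym (f-act β x)) (trans (cong f (proj₂ (sgn x))) (trans (additive-⊖ f-⊕ x) (cong ⊖_ fx))))

  exceptional-iso : ∀ X Y → RepIso p r X Y → Marked.Exceptional (irrOf X) → Marked.Exceptional (irrOf Y)
  exceptional-iso X Y iso with RepIso⇒equivariant X Y iso
  ... | f , g , f-⊕ , _ , _ , fg , f-act = exceptional-transfer (irrOf X) (irrOf Y) f f-⊕ f-act (λ y → g y , fg y)

  module RegularMap (n : ℕ) (R L : Permutation′ n) (map : IsMap n R L) (rotary : IsRotary n R L)
    (period : ∀ x → Rpow R (p ℕ.* 2) x ≡ x) (base : Fin n)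
    (d : ℕ) (ψ : Dih r → Mat p d d) (irr : IsIrreducible p r d ψ) (aut : AutIsoSD p r n R L d ψ) where

    M : Irr d
    M = toIrr ψ irr

    open Irr M
    open SD-Group rep
    open SD-Pow rep using (proj₂-pow)

    G : Set
    G = SD p r d

    Φ : G → Fin n → Fin n
    Φ = proj₁ aut

    Φ-aut : ∀ g → IsAut n R L (Φ g)
    Φ-aut = proj₁ (proj₂ aut)

    Φ-⋆ : ∀ g h x → Φ (g ⋆ h) x ≡ Φ g (Φ h x)
    Φ-⋆ g h x = trans (cong (λ k → Φ k x) (sym (sdMul-def ψ irr g h))) (proj₁ (proj₂ (proj₂ aut)) g h x)

    Φ-R : ∀ g x → Φ g (R ⟨$⟩ʳ x) ≡ R ⟨$⟩ʳ (Φ g x)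
    Φ-R g = proj₁ (Φ-aut g)

    Φ-L : ∀ g x → Φ g (L ⟨$⟩ʳ x) ≡ L ⟨$⟩ʳ (Φ g x)
    Φ-L g = proj₁ (proj₂ (Φ-aut g))

    Φ-injective : ∀ g x y → Φ g x ≡ Φ g y → x ≡ y
    Φ-injective g x y eq = let h , hΦ , _ = proj₂ (proj₂ (Φ-aut g)) in trans (sym (hΦ x)) (trans (cong h eq) (hΦ y))

    Φ-ε : ∀ x → Φ ε x ≡ x
    Φ-ε x = Φ-injective ε _ _ (trans (sym (Φ-⋆ ε ε x)) (cong (λ g → Φ g x) (identityˡ ε)))

    transitive : ∀ y → ∃ λ g → Φ g base ≡ y
    transitive y = let f , f-aut , fx = rotary base y
                       g , Φg = proj₂ (proj₂ (proj₂ (proj₂ aut))) f f-aut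
                   in g , trans (Φg base) fx

    dart : G → Fin n
    dart g = Φ g base

    dart-ε : dart ε ≡ base
    dart-ε = Φ-ε base

    opaque
      -- Since each Φ g commutes with R and L, following them from the dart of g amounts to
      -- multiplying g on the right by the elements that move the base dart one step. This
      -- identifies the given map with a Cayley map.
      α z : G
      α = proj₁ (transitive (R ⟨$⟩ʳ base))
      z = proj₁ (transitive (L ⟨$⟩ʳ base))

      dart-α : ∀ g → dart (g ⋆ α) ≡ R ⟨$⟩ʳ dart g
      dart-α g = trans (Φ-⋆ g α base) (trans (cong (Φ g) (proj₂ (transitive (R ⟨$⟩ʳ base)))) (Φ-R g base))

      dart-z : ∀ g → dart (g ⋆ z) ≡ L ⟨$⟩ʳ dart g
      dart-z g = trans (Φ-⋆ g z base) (trans (cong (Φ g) (proj₂ (transitive (L ⟨$⟩ʳ base)))) (Φ-L g base))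

    -- Automorphisms that agree on the base dart agree along every path of R and L steps, hence
    -- everywhere by connectedness, and Φ is faithful.
    dart-injective : ∀ g h → dart g ≡ dart h → g ≡ h
    dart-injective g h eq = proj₁ (proj₂ (proj₂ (proj₂ aut))) g h (λ x → agree (proj₂ (proj₂ map) base x))
      where
      agree : ∀ {x} → Reach R L base x → Φ g x ≡ Φ h x
      agree here = eq
      agree (stepR q) = trans (Φ-R g _) (trans (cong (R ⟨$⟩ʳ_) (agree q)) (sym (Φ-R h _)))
      agree (stepL q) = trans (Φ-L g _) (trans (cong (L ⟨$⟩ʳ_) (agree q)) (sym (Φ-L h _)))

    generates : ∀ g → Generated α z g
    generates g = let h , gen , eq = reached (proj₂ (proj₂ map) base (dart g)) in subst (Generated α z) (dart-injective h g eq) gen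
      where
      reached : ∀ {y} → Reach R L base y → ∃ λ h → Generated α z h × dart h ≡ y
      reached here = ε , one , dart-ε
      reached (stepR q) = let h , gen , eq = reached q in h ⋆ α , gen ▸a , trans (dart-α h) (cong (R ⟨$⟩ʳ_) eq)
      reached (stepL q) = let h , gen , eq = reached q in h ⋆ z , gen ▸b , trans (dart-z h) (cong (L ⟨$⟩ʳ_) eq)

    dart-pow : ∀ k → dart (pow α k) ≡ Rpow R k base
    dart-pow zero = dart-ε
    dart-pow (suc k) = trans (dart-α (pow α k)) (cong (R ⟨$⟩ʳ_) (dart-pow k))

    α-period : pow α (p ℕ.* 2) ≡ ε
    α-period = dart-injective _ _ (trans (dart-pow (p ℕ.* 2)) (trans (period base) (sym dart-ε)))

    zz : z ⋆ z ≡ ε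
    zz = dart-injective _ _ (trans (dart-z z) (trans (cong (L ⟨$⟩ʳ_) (trans (cong dart (sym (identityˡ z))) (dart-z ε))) (proj₁ map (dart ε))))

    a w : V d
    a = proj₁ α
    w = proj₁ z

    ᾱ z̄ : Dih r
    ᾱ = proj₂ α
    z̄ = proj₂ z

    dih-generates : ∀ g → D.Generated ᾱ z̄ g
    dih-generates g = project (generates (𝟘 , g))
      where
      project : ∀ {h} → Generated α z h → D.Generated ᾱ z̄ (proj₂ h)
      project one = D.one
      project (q ▸a) = project q D.▸a
      project (q ▸b) = project q D.▸b

    opaque
      reflections : ∃ λ i → ∃ λ j → ᾱ ≡ (i , true) × z̄ ≡ (j , true)
      reflections = generators-are-reflections ᾱ z̄
        (2p-torsion⇒involution ᾱ (trans (sym (proj₂-pow α (p ℕ.* 2))) (cong proj₂ α-period))) (cong proj₂ zz) dih-generates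

    i j : Fin r
    i = proj₁ reflections
    j = proj₁ (proj₂ reflections)

    ᾱ≡ : ᾱ ≡ (i , true)
    ᾱ≡ = proj₁ (proj₂ (proj₂ reflections))

    z̄≡ : z̄ ≡ (j , true)
    z̄≡ = proj₂ (proj₂ (proj₂ reflections))

    generates′ : ∀ g → D.Generated (i , true) (j , true) g
    generates′ g = subst₂ (λ a b → D.Generated a b g) ᾱ≡ z̄≡ (dih-generates g)

    open Remark i j generates′ using (σ; σ-·; σ-e; σ-τ; σ-β; σ-injective; remark-irreducible)

    -- The representation under which the map is filed. In it τ and β act as the two reflections of
    -- the map do under ψ; it need not be isomorphic to ψ.
    marked : IrrRep p r
    marked = d , ψ ∘ σ , remark-irreducible ψ irr

    module M′ = Irr (irrOf marked)

    act-σ : ∀ g x → M′.act g x ≡ act (σ g) x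
    act-σ g x = trans (act-toRep (ψ ∘ σ) _ g x) (sym (act-toRep ψ _ (σ g) x))

    act-τ : ∀ x → M′.act τ x ≡ act ᾱ x
    act-τ x = trans (act-σ τ x) (cong (λ g → act g x) (trans σ-τ (sym ᾱ≡)))

    act-β : ∀ x → M′.act β x ≡ act z̄ x
    act-β x = trans (act-σ β x) (cong (λ g → act g x) (trans σ-β (sym z̄≡)))

    open Marked (irrOf marked) using (Good; Adapted; straighten; good-transitive; good⇒¬exceptional)

    opaque
      straightened : Σ (V d) λ u → u ⊝ M′.act β u ≡ w × Adapted (a ⊝ (u ⊝ M′.act τ u))
      -- The vector part of z² = 1 says that β negates `w`.
      straightened = straighten a w (⊖-uniqueˡ _ w (trans (⊕-comm _ w) (trans (cong (w ⊕_) (act-β w)) (cong proj₁ zz))))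

    u v₁ : V d
    u = proj₁ straightened
    v₁ = a ⊝ (u ⊝ M′.act τ u)

    w≡ : w ≡ u ⊝ act z̄ u
    w≡ = trans (sym (proj₁ (proj₂ straightened))) (cong (u ⊝_) (act-β u))

    a≡ : a ≡ v₁ ⊕ (u ⊝ act ᾱ u)
    a≡ = trans (solve (a ∷ (u ⊝ M′.act τ u) ∷ []) x₀ ((x₀ :- x₁) :+ x₁) refl) (cong (λ y → v₁ ⊕ (u ⊝ y)) (act-τ u))

    -- Conjugation by u composed with an equivariant map f sending v to v₁.
    module Transport {d′} (N : Irr d′) (f : V d′ → V d) (f-⊕ : Additive f) (f-act : Equivariant (Irr.rep N) M′.rep f) where

      module N = SD-Group (Irr.rep N)

      F : SD p r d′ → G
      F (x , g) = (u ⊕ f x) ⊝ act (σ g) u , σ g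

      F-ε : F N.ε ≡ ε
      F-ε = cong₂ _,_ (trans (cong₂ (λ y g → (u ⊕ y) ⊝ act g u) (additive-𝟘 f-⊕) σ-e) (trans (cong₂ _⊝_ (⊕-identityʳ u) (act-e u)) (⊖-inverseʳ u))) σ-e

      F-step : ∀ v g h → proj₁ h ≡ f v ⊕ (u ⊝ act (proj₂ h) u) → proj₂ h ≡ σ g → ∀ b → F (b N.⋆ (v , g)) ≡ F b ⋆ h
      F-step v g (y , .(σ g)) y≡ refl (x , b) = cong₂ _,_ (begin
        (u ⊕ f (x ⊕ Irr.act N b v)) ⊝ act (σ (b · g)) u
          ≡⟨ cong₂ (λ y k → (u ⊕ y) ⊝ act k u) (f-⊕ x _) (σ-· b g) ⟩
        (u ⊕ (f x ⊕ f (Irr.act N b v))) ⊝ act (σ b · σ g) u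
          ≡⟨ cong₂ (λ y k → (u ⊕ (f x ⊕ y)) ⊝ k) (trans (f-act b v) (act-σ b (f v))) (act-· (σ b) (σ g) u) ⟩
        (u ⊕ (f x ⊕ act (σ b) (f v))) ⊝ act (σ b) (act (σ g) u)
          ≡⟨ solve (u ∷ f x ∷ act (σ b) (f v) ∷ act (σ b) (act (σ g) u) ∷ act (σ b) u ∷ [])
               ((x₀ :+ (x₁ :+ x₂)) :- x₃) (((x₀ :+ x₁) :- x₄) :+ (x₂ :+ (x₄ :- x₃))) refl ⟩
        ((u ⊕ f x) ⊝ act (σ b) u) ⊕ (act (σ b) (f v) ⊕ (act (σ b) u ⊝ act (σ b) (act (σ g) u)))
          ≡⟨ cong (((u ⊕ f x) ⊝ act (σ b) u) ⊕_) (trans (act-⊕ (σ b) _ _) (cong (act (σ b) (f v) ⊕_) (act-⊝ (σ b) u _))) ⟨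
        ((u ⊕ f x) ⊝ act (σ b) u) ⊕ act (σ b) (f v ⊕ (u ⊝ act (σ g) u))
          ≡⟨ cong (λ y → ((u ⊕ f x) ⊝ act (σ b) u) ⊕ act (σ b) y) y≡ ⟨
        ((u ⊕ f x) ⊝ act (σ b) u) ⊕ act (σ b) y ∎)
        (σ-· b g)

      F-α : ∀ v → f v ≡ v₁ → ∀ b → F (b N.⋆ (v , τ)) ≡ F b ⋆ α
      F-α v fv = F-step v τ α (trans a≡ (cong (_⊕ (u ⊝ act ᾱ u)) (sym fv))) (trans ᾱ≡ (sym σ-τ))

      F-z : ∀ b → F (b N.⋆ (𝟘 , β)) ≡ F b ⋆ z
      F-z = F-step 𝟘 β z (trans w≡ (trans (sym (⊕-identityˡ _)) (cong (_⊕ (u ⊝ act z̄ u)) (sym (additive-𝟘 f-⊕))))) (trans z̄≡ (sym σ-β))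

      F-surjective : ∀ v → f v ≡ v₁ → ∀ g → ∃ λ b → F b ≡ g
      F-surjective v fv g = go (generates g)
        where
        go : ∀ {g} → Generated α z g → ∃ λ b → F b ≡ g
        go one = N.ε , F-ε
        go (q ▸a) with go q
        ... | b , refl = b N.⋆ (v , τ) , F-α v fv b
        go (q ▸b) with go q
        ... | b , refl = b N.⋆ (𝟘 , β) , F-z b

      F-injective : (∀ x y → f x ≡ f y → x ≡ y) → ∀ b c → F b ≡ F c → b ≡ c
      F-injective f-inj (x , b) (y , c) eq = cong₂ _,_
        (f-inj x y (⊕-cancelˡ u (f x) (f y) (⊕-cancelʳ (⊖ act (σ b) u) (u ⊕ f x) (u ⊕ f y)
          (trans (cong proj₁ eq) (cong (λ g → (u ⊕ f y) ⊝ act g u) (sym (cong proj₂ eq)))))))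
        (σ-injective b c (cong proj₂ eq))

    -- If `v₁` were zero, the zero map could be transported: α and z would lie in a conjugate of the
    -- complement D, and no nonzero translation would be generated.
    v₁≢𝟘 : v₁ ≢ 𝟘
    v₁≢𝟘 v₁≡𝟘 = proj₂ nontrivial (begin
      x  ≡⟨ cong proj₁ (proj₂ pre) ⟨
      (u ⊕ 𝟘) ⊝ act (σ b) u  ≡⟨ cong₂ _⊝_ (⊕-identityʳ u) (cong (λ g → act g u) (cong proj₂ (proj₂ pre))) ⟩
      u ⊝ act e u  ≡⟨ cong (u ⊝_) (act-e u) ⟩
      u ⊝ u  ≡⟨ ⊖-inverseʳ u ⟩
      𝟘  ∎)
      where
      module T = Transport (irrOf marked) (λ _ → 𝟘) (λ _ _ → sym (⊕-identityˡ 𝟘)) (λ g _ → sym (M′.act-𝟘 g))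
      x : V d
      x = proj₁ nontrivial
      pre : ∃ λ b → T.F b ≡ (x , e)
      pre = T.F-surjective 𝟘 (sym v₁≡𝟘) (x , e)
      b : Dih r
      b = proj₂ (proj₁ pre)

    good : Good v₁
    good = v₁≢𝟘 , proj₂ (proj₂ straightened)

    marked-¬exceptional : ¬ Marked.Exceptional (irrOf marked)
    marked-¬exceptional = good⇒¬exceptional v₁ good

    -- Two arbitrary choices are absorbed here: `t` changes the representative within its
    -- isomorphism class, and an element of the centraliser moves the good vector `t y` to `v₁`.
    module Iso (Y : IrrRep p r) (y : V (proj₁ Y)) (good-y : Marked.Good (irrOf Y) y)
      (t : V (proj₁ Y) → V d) (t⁻ : V d → V (proj₁ Y)) (t-⊕ : Additive t) (t⁻t : ∀ x → t⁻ (t x) ≡ x) (tt⁻ : ∀ x → t (t⁻ x) ≡ x)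
      (t-act : Equivariant (Irr.rep (irrOf Y)) M′.rep t) where

      good-ty : Good (t y)
      good-ty = good-transfer (irrOf Y) (irrOf marked) t t-⊕ t-act (λ x → t⁻ x , tt⁻ x)
        (λ x x′ eq → trans (sym (t⁻t x)) (trans (cong t⁻ eq) (t⁻t x′))) y good-y

      opaque
        equivariant : Σ (V (proj₁ Y) → V d) λ f → Additive f × Equivariant (Irr.rep (irrOf Y)) M′.rep f × f y ≡ v₁
        equivariant = let θ , θ-⊕ , θ-act , θty = good-transitive (t y) v₁ good-ty good in
          θ ∘ t , (λ x x′ → trans (cong θ (t-⊕ x x′)) (θ-⊕ (t x) (t x′))) ,
          (λ g x → trans (cong θ (t-act g x)) (θ-act g (t x))) , θty

      f : V (proj₁ Y) → V d
      f = proj₁ equivariant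

      f-⊕ : Additive f
      f-⊕ = proj₁ (proj₂ equivariant)

      f-act : Equivariant (Irr.rep (irrOf Y)) M′.rep f
      f-act = proj₁ (proj₂ (proj₂ equivariant))

      fy : f y ≡ v₁
      fy = proj₂ (proj₂ (proj₂ equivariant))

      open Transport (irrOf Y) f f-⊕ f-act
      module C = MapOf Y y good-y

      opaque
        F-inj : ∀ b c → F b ≡ F c → b ≡ c
        F-inj = F-injective (Schur.injective (irrOf Y) (irrOf marked) f f-⊕ f-act y (λ eq → v₁≢𝟘 (trans (sym fy) eq)))

        preimage : ∀ x → ∃ λ b → dart (F b) ≡ x
        preimage x = let g , Φg = transitive x
                         b , Fb = F-surjective y fy g
                     in b , trans (cong dart Fb) Φg

      K : Fin _ → Fin n
      K s = dart (F (C.dec s))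

      K-injective : ∀ s s′ → K s ≡ K s′ → s ≡ s′
      K-injective s s′ eq = trans (sym (C.enc-dec s)) (trans (cong C.enc (F-inj _ _ (dart-injective _ _ eq))) (C.enc-dec s′))

      K⁻ : Fin n → Fin _
      K⁻ x = C.enc (proj₁ (preimage x))

      KK⁻ : ∀ x → K (K⁻ x) ≡ x
      KK⁻ x = trans (cong (dart ∘ F) (C.dec-enc _)) (proj₂ (preimage x))

      K-R : ∀ s → K (C.R ⟨$⟩ʳ s) ≡ R ⟨$⟩ʳ K s
      K-R s = trans (cong (dart ∘ F) (C.dec-enc _)) (trans (cong dart (F-α y fy (C.dec s))) (dart-α (F (C.dec s))))

      K-L : ∀ s → K (C.L ⟨$⟩ʳ s) ≡ L ⟨$⟩ʳ K s
      K-L s = trans (cong (dart ∘ F) (C.dec-enc _)) (trans (cong dart (F-z (C.dec s))) (dart-z (F (C.dec s))))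

      K⁻-commutes : ∀ (A : Fin n → Fin n) (B : Fin _ → Fin _) → (∀ s → K (B s) ≡ A (K s)) → ∀ x → K⁻ (A x) ≡ B (K⁻ x)
      K⁻-commutes A B KB x = K-injective _ _ (trans (KK⁻ (A x)) (sym (trans (KB (K⁻ x)) (cong A (KK⁻ x)))))

  -- Quantified over `Y` and `y` because the count fixes its own representatives and good vectors,
  -- and the isomorphism must end in the map built from those.
  recognise : (m : IrrRotAugPXMap p r) → Σ (IrrRep p r) λ X → ¬ Marked.Exceptional (irrOf X) ×
    (∀ Y y (good : Marked.Good (irrOf Y) y) → RepIso p r X Y → MapIso p r m (mapOf Y y good))
  recognise m@(n , R , L , map , rotary , (s , δ , und) , d , ψ , irr , aut) = marked , marked-¬exceptional , isoTo
    where
    open RegularMap n R L map rotary (proj₂ (underlying-period {R = R} {L} s δ und)) (proj₁ (underlying-period {R = R} {L} s δ und)) d ψ irr aut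
    isoTo : ∀ Y y (good : Marked.Good (irrOf Y) y) → RepIso p r marked Y → MapIso p r m (mapOf Y y good)
    isoTo Y y good iso with RepIso⇒equivariant Y marked (RepIso-sym {marked} {Y} iso)
    ... | t , t⁻ , t-⊕ , _ , t⁻t , tt⁻ , t-act = K⁻ , K , KK⁻ , (λ s → K-injective _ _ (KK⁻ (K s))) ,
      K⁻-commutes (L ⟨$⟩ʳ_) (MapOf.L Y y good ⟨$⟩ʳ_) K-L , inj₁ (K⁻-commutes (R ⟨$⟩ʳ_) (MapOf.R Y y good ⟨$⟩ʳ_) K-R)
      where open Iso Y y good t t⁻ t-⊕ t⁻t tt⁻ t-act

-- The exceptional character and the count

odd : ℕ → Bool
odd = not ∘ isEven

odd-+ : ∀ j k → odd (j ℕ.+ k) ≡ odd j xor odd k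
odd-+ zero k = refl
odd-+ (suc j) k = trans (cong not (odd-+ j k)) (not-distribˡ-xor (odd j) (odd k))

odd-* : ∀ j k → odd k ≡ false → odd (j ℕ.* k) ≡ false
odd-* zero k _ = refl
odd-* (suc j) k eq = trans (odd-+ k (j ℕ.* k)) (cong₂ _xor_ eq (odd-* j k eq))

odd-% : ∀ n .{{_ : NonZero n}} → odd n ≡ false → ∀ k → odd (k % n) ≡ odd k
odd-% n eq k = sym (trans (cong odd (m≡m%n+[m/n]*n k n)) (trans (odd-+ (k % n) (k / n ℕ.* n))
  (trans (cong (odd (k % n) xor_) (odd-* (k / n) n eq)) (xor-identityʳ (odd (k % n))))))

module Counting (p r : ℕ) .{{_ : NonZero p}} .{{_ : NonZero r}} (prime : Prime p) (p≢2 : p ≢ 2) (p∤r : ¬ (p ∣ r)) (3≤r : 3 ≤ r) where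

  open Classification p r prime p≢2 p∤r 3≤r
  open ≡-Reasoning

  ExceptionalRep : IrrRep p r → Set
  ExceptionalRep X = Marked.Exceptional (irrOf X)

  -- On an exceptional representation ρ = τβ acts as -1, so for odd r the relation ρʳ = 1 gives x =
  -- -x for every x; but p is odd and some x is nonzero.
  odd⇒¬exceptional : odd r ≡ true → ∀ X → ¬ ExceptionalRep X
  odd⇒¬exceptional odd-r X exc = proj₂ nontrivial (minus-fixed⇒𝟘 x (begin
    x  ≡⟨ act-e x ⟨
    act e x  ≡⟨ cong (λ g → act g x) (trans e-def (cong (_, false) (sym r-mod))) ⟩
    act (r mod r , false) x  ≡⟨ alternates r ⟩
    sign (odd r)  ≡⟨ cong sign odd-r ⟩
    ⊖ x  ∎))
    where
    open Irr (irrOf X)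
    open Marked (irrOf X)
    x : V (proj₁ X)
    x = proj₁ nontrivial
    sign : Bool → V (proj₁ X)
    sign b = if b then ⊖ x else x
    ρ-minus : ∀ y → act ρ y ≡ ⊖ y
    ρ-minus y = trans (ρ-def y) (trans (cong (act τ) (proj₂ (exc y))) (proj₁ (exc y)))
    sign-not : ∀ b → ⊖ sign b ≡ sign (not b)
    sign-not false = refl
    sign-not true = ⊖-involutive x
    alternates : ∀ k → act (k mod r , false) x ≡ sign (odd k)
    alternates zero = trans (cong (λ g → act g x) (trans (cong (_, false) 0-mod) (sym e-def))) (act-e x)
    alternates (suc k) = begin
      act (suc k mod r , false) x  ≡⟨ cong (λ g → act g x) (rot-suc k) ⟩
      act (ρ · (k mod r , false)) x  ≡⟨ act-· ρ _ x ⟩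
      act ρ (act (k mod r , false) x)  ≡⟨ ρ-minus _ ⟩
      ⊖ act (k mod r , false) x  ≡⟨ cong ⊖_ (alternates k) ⟩
      ⊖ sign (odd k)  ≡⟨ sign-not (odd k) ⟩
      sign (odd (suc k))  ∎

  module Even (even-r : odd r ≡ false) where

    odd-+ᵣ : ∀ i j → odd (toℕ (i + j)) ≡ odd (toℕ i) xor odd (toℕ j)
    odd-+ᵣ i j = trans (cong odd (trans (cong toℕ (+-def i j)) (toℕ-mod r (toℕ i ℕ.+ toℕ j))))
      (trans (odd-% r even-r _) (odd-+ (toℕ i) (toℕ j)))

    odd-neg : ∀ i → odd (toℕ (- i)) ≡ odd (toℕ i)
    odd-neg i = begin
      odd (toℕ (- i))  ≡⟨ cong (_xor odd (toℕ (- i))) (xor-same (odd (toℕ i))) ⟨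
      (odd (toℕ i) xor odd (toℕ i)) xor odd (toℕ (- i))  ≡⟨ xor-assoc (odd (toℕ i)) (odd (toℕ i)) (odd (toℕ (- i))) ⟩
      odd (toℕ i) xor (odd (toℕ i) xor odd (toℕ (- i)))  ≡⟨ cong (odd (toℕ i) xor_) (odd-+ᵣ i (- i)) ⟨
      odd (toℕ i) xor odd (toℕ (i - i))  ≡⟨ cong (λ k → odd (toℕ i) xor odd k) (trans (cong toℕ (-‿inverseʳ i)) toℕ-0#) ⟩
      odd (toℕ i) xor false  ≡⟨ xor-identityʳ _ ⟩
      odd (toℕ i)  ∎

    -- The exponent of -1 in the character with ρ and τ both sent to -1, so that β = ρ⁻¹τ goes to 1.
    -- The parity of the rotation index is compatible with addition modulo r because r is even.
    χ : Dih r → Bool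
    χ (i , b) = odd (toℕ i) xor b

    χ-· : ∀ g h → χ (g · h) ≡ χ g xor χ h
    χ-· (i , false) (j , c) = begin
      χ ((i , false) · (j , c))  ≡⟨ cong χ (rot· i j c) ⟩
      odd (toℕ (i + j)) xor c  ≡⟨ cong (_xor c) (odd-+ᵣ i j) ⟩
      (odd (toℕ i) xor odd (toℕ j)) xor c  ≡⟨ xor-assoc (odd (toℕ i)) (odd (toℕ j)) c ⟩
      odd (toℕ i) xor (odd (toℕ j) xor c)  ≡⟨ cong (_xor (odd (toℕ j) xor c)) (xor-identityʳ (odd (toℕ i))) ⟨
      (odd (toℕ i) xor false) xor (odd (toℕ j) xor c) ∎
    χ-· (i , true) (j , c) = begin
      χ ((i , true) · (j , c))  ≡⟨ cong χ (ref· i j c) ⟩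
      odd (toℕ (i - j)) xor not c  ≡⟨ cong (_xor not c) (trans (odd-+ᵣ i (- j)) (cong (odd (toℕ i) xor_) (odd-neg j))) ⟩
      (odd (toℕ i) xor odd (toℕ j)) xor (true xor c)  ≡⟨ xor-assoc (odd (toℕ i)) (odd (toℕ j)) (true xor c) ⟩
      odd (toℕ i) xor (odd (toℕ j) xor (true xor c))  ≡⟨ cong (odd (toℕ i) xor_) (swap (odd (toℕ j)) c) ⟩
      odd (toℕ i) xor (true xor (odd (toℕ j) xor c))  ≡⟨ xor-assoc (odd (toℕ i)) true (odd (toℕ j) xor c) ⟨
      (odd (toℕ i) xor true) xor (odd (toℕ j) xor c)  ∎
      where
      swap : ∀ a c → a xor (true xor c) ≡ true xor (a xor c)
      swap a c = sym (not-distribʳ-xor a c)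

    χ-e : χ e ≡ false
    χ-e = trans (cong χ e-def) (trans (xor-identityʳ _) (cong odd toℕ-0#))

    χ-τ : χ τ ≡ true
    χ-τ = cong (λ k → odd k xor true) toℕ-0#

    χ-β : χ β ≡ false
    χ-β = cong (_xor true) (trans (odd-neg 1#) (cong odd toℕ-1#))

    ν : Bool → Fin p
    ν true = negZ p (oneZ p)
    ν false = oneZ p

    ν-xor : ∀ a b (x : V 1) → ν (a xor b) ∙ x ≡ ν a ∙ (ν b ∙ x)
    ν-xor false b x = sym (∙-identity _)
    ν-xor true false x = cong (ν true ∙_) (sym (∙-identity x))
    ν-xor true true x = trans (∙-identity x) (sym (trans (negOne∙ _) (trans (cong ⊖_ (negOne∙ x)) (⊖-involutive x))))

    ψ : Dih r → Mat p 1 1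
    ψ g = (ν (χ g) ∷ []) ∷ []

    ψ-rep : IsRep p r 1 ψ
    ψ-rep = (λ g h → matVec-ext _ _ λ x → begin
        matVec p (ψ (dihMul r g h)) x  ≡⟨ scalar-matVec _ x ⟩
        ν (χ (dihMul r g h)) ∙ x  ≡⟨ cong (λ b → ν b ∙ x) (trans (cong χ (sym (·-def g h))) (χ-· g h)) ⟩
        ν (χ g xor χ h) ∙ x  ≡⟨ ν-xor (χ g) (χ h) x ⟩
        ν (χ g) ∙ (ν (χ h) ∙ x)  ≡⟨ trans (scalar-matVec _ _) (cong (ν (χ g) ∙_) (scalar-matVec _ x)) ⟨
        matVec p (ψ g) (matVec p (ψ h) x)  ≡⟨ matVec-matMul (ψ g) (ψ h) x ⟨
        matVec p (matMul p (ψ g) (ψ h)) x  ∎) ,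
      matVec-ext _ _ λ x → begin
        matVec p (ψ (dihOne r)) x  ≡⟨ scalar-matVec _ x ⟩
        ν (χ (dihOne r)) ∙ x  ≡⟨ cong (λ b → ν b ∙ x) (trans (cong χ (sym e-dihOne)) χ-e) ⟩
        oneZ p ∙ x  ≡⟨ ∙-identity x ⟩
        x  ≡⟨ matVec-idMat x ⟨
        matVec p (idMat p 1) x  ∎

    line : ∀ (v u : V 1) → v ≢ 𝟘 → ∃ λ c → c ∙ v ≡ u
    line (a ∷ []) (b ∷ []) v≢𝟘 = mulZ p b a⁻¹ , (begin
      mulZ p b a⁻¹ ∙ (a ∷ [])  ≡⟨ ∷-∙ _ a [] ⟩
      mulZ p (mulZ p b a⁻¹) a ∷ _  ≡⟨ cong₂ _∷_ (trans (Z.*-assoc b a⁻¹ a) (trans (cong (mulZ p b) (trans (Z.*-comm a⁻¹ a) (proj₂ inv-a))) (Z.*-identityʳ b))) (V0 _) ⟩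
      b ∷ []  ∎)
      where
      V0 : (x : V 0) → x ≡ []
      V0 [] = refl
      a≢0 : a ≢ zeroZ p
      a≢0 refl = v≢𝟘 (trans (cong (zeroZ p ∷_) (𝟘-unique [])) (sym 𝟘-suc))
      inv-a : Σ (Fin p) λ c → mulZ p a c ≡ oneZ p
      inv-a = inverse a a≢0
      a⁻¹ : Fin p
      a⁻¹ = proj₁ inv-a

    ψ-cyclic : ∀ v → v ≢ 𝟘 → ∀ u → InSpan (ψorbit ψ v) (r ℕ.* 2) u
    ψ-cyclic v v≢𝟘 u with line v u v≢𝟘 | enumDih-surjective e
    ... | c , cv | k , k< , ke = subst (InSpan w (r ℕ.* 2)) cv (InSpan-∙ w _ c v (subst (InSpan w (r ℕ.* 2)) wk (InSpan-family w _ k k<)))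
      where
      w : Family 1
      w = ψorbit ψ v
      wk : w k ≡ v
      wk = trans (ψorbit-def ψ v k) (trans (scalar-matVec _ v) (trans (cong (λ b → ν b ∙ v) (trans (cong χ ke) χ-e)) (∙-identity v)))

    opaque
      exceptional-irreducible : IsIrreducible p r 1 ψ
      exceptional-irreducible = cyclic⇒irreducible ψ ψ-rep (s≤s z≤n) ψ-cyclic

    exceptionalRep : IrrRep p r
    exceptionalRep = 1 , ψ , exceptional-irreducible

    exceptionalRep-exceptional : ExceptionalRep exceptionalRep
    exceptionalRep-exceptional x =
      trans (act-toRep ψ _ τ x) (trans (scalar-matVec _ x) (trans (cong (λ b → ν b ∙ x) χ-τ) (negOne∙ x))) ,
      trans (act-toRep ψ _ β x) (trans (scalar-matVec _ x) (trans (cong (λ b → ν b ∙ x) χ-β) (∙-identity x)))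

    -- Sending the basis vector to any nonzero `v` is equivariant, since both sides act through the
    -- same signs. Schur's lemma makes it bijective, which also forces dimension one.
    exceptional-unique : ∀ X → ExceptionalRep X → RepIso p r exceptionalRep X
    exceptional-unique X exc = schur⇒RepIso exceptionalRep X f f-⊕
      (dih-induction (λ g → ∀ x → f (E.act g x) ≡ act g (f x))
        (λ x → trans (cong f (proj₁ (exceptionalRep-exceptional x))) (trans (additive-⊖ f-⊕ x) (sym (proj₁ (exc (f x))))))
        (λ x → trans (cong f (proj₂ (exceptionalRep-exceptional x))) (sym (proj₂ (exc (f x)))))
        (λ g h p q x → trans (cong f (E.act-· g h x)) (trans (p _) (trans (cong (act g) (q x)) (sym (act-· g h (f x)))))))
      ((oneZ p ∷ []) , λ eq → proj₂ nontrivial (trans (sym (∙-identity v)) eq))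
      where
      open Irr (irrOf X)
      module E = Irr (irrOf exceptionalRep)
      v : V (proj₁ X)
      v = proj₁ nontrivial
      f : V 1 → V (proj₁ X)
      f x = head x ∙ v
      f-⊕ : Additive f
      f-⊕ (a ∷ []) (b ∷ []) = trans (cong f (∷-⊕ a b [] [])) (∙-distribʳ a b v)

  goodVector : ∀ X → ¬ ExceptionalRep X → ∃ (Marked.Good (irrOf X))
  goodVector X ¬exc with Marked.good⊎exceptional (irrOf X)
  ... | inj₁ good = good
  ... | inj₂ exc = contradiction exc ¬exc

  MapCount : ℕ → Set₁
  MapCount = HasCount (IrrRotAugPXMap p r) (MapIso p r)

  -- The selection `κ` picks the representatives that carry a map: all of them for odd r, all except
  -- one index for even r.
  map-count : ∀ {N K} (f : Fin N → IrrRep p r) → (∀ i j → RepIso p r (f i) (f j) → i ≡ j) →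
    (κ : Fin K → Fin N) → (∀ i j → κ i ≡ κ j → i ≡ j) → (∀ k → ¬ ExceptionalRep (f (κ k))) →
    (∀ X → ¬ ExceptionalRep X → ∃ λ k → RepIso p r X (f (κ k))) → MapCount K
  map-count f f-inj κ κ-inj ¬exc cover =
    (λ k → mapOf (f (κ k)) (vec k) (good k)) ,
    (λ i j iso → κ-inj i j (f-inj _ _ (MapIso⇒RepIso (f (κ i)) (f (κ j)) (vec i) (vec j) (good i) (good j) iso))) ,
    λ m → let X , X-¬exc , isoTo = recognise m
              k , iso = cover X X-¬exc
          in k , isoTo (f (κ k)) (vec k) (good k) iso
    where
    vec : ∀ k → V (proj₁ (f (κ k)))
    vec k = proj₁ (goodVector (f (κ k)) (¬exc k))
    good : ∀ k → Marked.Good (irrOf (f (κ k))) (vec k)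
    good k = proj₂ (goodVector (f (κ k)) (¬exc k))

  map-count-odd : ∀ {N} → HasCount (IrrRep p r) (RepIso p r) N → odd r ≡ true → MapCount N
  map-count-odd (f , f-inj , f-sur) odd-r =
    map-count f f-inj id (λ _ _ eq → eq) (λ k → odd⇒¬exceptional odd-r (f k)) (λ X _ → f-sur X)

  map-count-even : ∀ {N} → HasCount (IrrRep p r) (RepIso p r) N → odd r ≡ false → MapCount (N ∸ 1)
  -- Truncated subtraction does no harm: the exceptional representation exists, so N is at least 1.
  map-count-even {zero} (f , f-inj , f-sur) even-r = contradiction (proj₁ (f-sur (Even.exceptionalRep even-r))) λ ()
  map-count-even {suc N} (f , f-inj , f-sur) even-r = map-count f f-inj (punchIn i₀) (punchIn-injective i₀)
      (λ k exc → punchInᵢ≢i i₀ k (f-inj _ i₀ (RepIso-trans {f (punchIn i₀ k)} {exceptionalRep} {f i₀}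
        (RepIso-sym {exceptionalRep} {f (punchIn i₀ k)} (exceptional-unique (f (punchIn i₀ k)) exc)) iso₀)))
      cover
    where
    open Even even-r
    i₀ : Fin (suc N)
    i₀ = proj₁ (f-sur exceptionalRep)
    iso₀ : RepIso p r exceptionalRep (f i₀)
    iso₀ = proj₂ (f-sur exceptionalRep)
    cover : ∀ X → ¬ ExceptionalRep X → ∃ λ k → RepIso p r X (f (punchIn i₀ k))
    cover X ¬exc with f-sur X
    ... | i , iso = punchOut i₀≢i , subst (λ j → RepIso p r X (f j)) (sym (punchIn-punchOut i₀≢i)) iso
      where
      i₀≢i : i₀ ≢ i
      i₀≢i refl = ¬exc (exceptional-iso (f i₀) X (RepIso-sym {X} {f i₀} iso)
        (exceptional-iso exceptionalRep (f i₀) iso₀ exceptionalRep-exceptional))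

  count : Σ ℕ λ N → HasCount (IrrRep p r) (RepIso p r) N × MapCount (if isEven r then N ∸ 1 else N)
  count with irr-count
  ... | N , irr with isEven r in eq
  ...   | true = N , irr , map-count-even irr (cong not eq)
  ...   | false = N , irr , map-count-odd irr (cong not eq)

theorem5p7 : (p r : ℕ) .{{_ : NonZero p}} .{{_ : NonZero r}} →
    Prime p → p ≢ 2 → 3 ≤ r → ¬ (p ∣ r) →
    Σ ℕ λ N → HasCount (IrrRep p r) (RepIso p r) N
    × HasCount (IrrRotAugPXMap p r) (MapIso p r) (if isEven r then N ∸ 1 else N)
theorem5p7 p r p-prime p≢2 3≤r p∤r = Counting.count p r p-prime p≢2 p∤r 3≤r
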